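{- There exists an absolute constant $c>0$ such that for all integers $g\geq 0$ and $d\geq 8$, there are infinitely many integers $n$ for which there is an $n$-vertex $(g,d)$-map graph with treewidth at least $c\sqrt{(g+1)dn}$ and layered treewidth at least $c\,(g+1)d$.
   Context: The Euler genus of the orientable surface with $h$ handles is $2h$; the Euler genus of the non-orientable surface with $c$ cross-caps is $c$. A $(g,d)$-map graph is defined as follows. Start with a graph $G_0$ embedded (without crossings) in a surface of Euler genus at most $g$, with each face labelled a "nation" or a "lake", where each vertex of $G_0$ is incident with at most $d$ nations. Let $G$ be the graph whose vertices are the nations of $G_0$, where two vertices are adjacent in $G$ if the corresponding faces of $G_0$ share a vertex. Then $G$ is called a $(g,d)$-map graph. Treewidth is the usual one: the minimum, over all tree-decompositions, of (maximum bag size) $-1$. A layering of a graph $G$ is a partition $(V_0,V_1,\dots,V_t)$ of $V(G)$ such that for every edge $vw\in E(G)$, if $v\in V_i$ and $w\in V_j$, then $|i-j|\leq 1$; each $V_i$ is called a layer. The layered width of a tree-decomposition $(B_x:x\in V(T))$ of $G$ is the minimum integer $\ell$ such that, for some layering $(V_0,V_1,\dots,V_t)$ of $G$, each bag $B_x$ contains at most $\ell$ vertices in each layer $V_i$. The layered treewidth of $G$ is the minimum layered width of a tree-decomposition of $G$. -}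

module Defs where

open import Algebra.Definitions using (Involutive)
open import Data.Fin using (Fin; zero; suc; inject₁; fromℕ; toℕ; _≟_)
open import Data.Fin.Subset using (Subset; _∈_; _∩_; ∣_∣)
open import Data.Integer as ℤ using (ℤ; +_)
open import Data.List using (List; length)
import Data.List.Membership.Propositional as List
open import Data.Nat using (ℕ; suc; _+_; _*_; _∸_; _⊔_; _≤_; NonZero; ∣_-_∣)
open import Data.Product using (_×_; _,_; ∃; ∃-syntax)
open import Data.Rational as ℚ using (ℚ)
open import Data.Sum using (_⊎_)
open import Data.Vec using (tabulate)
open import Data.Vec.Functional using (foldr)
open import Function using (_∘_; _↔_; _⇔_; Inverse; Injective; Surjective)
open import Level using (0ℓ)
open import Relation.Binary using (Rel; Symmetric; Irreflexive; Decidable)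
open import Relation.Binary.Construct.Closure.Equivalence using (EqClosure)
open import Relation.Binary.Construct.Closure.ReflexiveTransitive using (Star)
open import Relation.Binary.PropositionalEquality using (_≡_; _≢_)
open import Relation.Nullary using (¬_)
open import Relation.Nullary.Decidable using (⌊_⌋)

record Graph (n : ℕ) : Set₁ where
  field
    Adj    : Rel (Fin n) 0ℓ
    sym    : Symmetric Adj
    irrefl : Irreflexive _≡_ Adj
    adj?   : Decidable Adj

open Graph public using (Adj)

record Cycle {n} (G : Graph n) : Set where
  field
    {k}       : ℕ
    vertex    : Fin (3 + k) → Fin n
    injective : Injective _≡_ _≡_ vertex
    step      : ∀ (i : Fin (2 + k)) → Adj G (vertex (inject₁ i)) (vertex (suc i))
    close     : Adj G (vertex (fromℕ (2 + k))) (vertex zero)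

record IsTree {n} (T : Graph n) : Set where
  field
    nonEmpty  : NonZero n
    connected : ∀ x y → Star (Adj T) x y
    acyclic   : ¬ Cycle T

maximum : ∀ {m} → (Fin m → ℕ) → ℕ
maximum = foldr _⊔_ 0

record TreeDecomposition {n} (G : Graph n) : Set₁ where
  field
    {m}           : ℕ
    T             : Graph m
    isTree        : IsTree T
    bag           : Fin m → Subset n
    vertexCovered : ∀ v → ∃[ x ] v ∈ bag x
    edgeCovered   : ∀ {v w} → Adj G v w → ∃[ x ] (v ∈ bag x × w ∈ bag x)
    subtree       : ∀ v {x y} → v ∈ bag x → v ∈ bag y →
                    Star (λ s t → Adj T s t × v ∈ bag s × v ∈ bag t) x y

-- Some bag is non-empty unless n ≡ 0, so the truncated subtraction is
-- the ordinary one for every graph with at least one vertex.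
width : ∀ {n} {G : Graph n} → TreeDecomposition G → ℕ
width D = maximum (λ x → ∣ bag x ∣) ∸ 1
  where open TreeDecomposition D

record Layering {n} (G : Graph n) : Set where
  field
    {t}     : ℕ
    layerOf : Fin n → Fin (suc t)
    close   : ∀ {v w} → Adj G v w → ∣ toℕ (layerOf v) - toℕ (layerOf w) ∣ ≤ 1

  layer : Fin (suc t) → Subset n
  layer i = tabulate (λ v → ⌊ layerOf v ≟ i ⌋)

-- The layered width of D is the minimum of widthAlong D L over all L.
widthAlong : ∀ {n} {G : Graph n} → TreeDecomposition G → Layering G → ℕ
widthAlong D L = maximum (λ x → maximum (λ i → ∣ bag x ∩ layer i ∣))
  where open TreeDecomposition D
        open Layering L

ℕ→ℚ : ℕ → ℚ
ℕ→ℚ n = + n ℚ./ 1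

-- c √ m ≤ k, for c ≥ 0, with both (non-negative) sides squared.
_√_≤_ : ℚ → ℕ → ℕ → Set
c √ m ≤ k = c ℚ.* c ℚ.* ℕ→ℚ m ℚ.≤ ℕ→ℚ k ℚ.* ℕ→ℚ k

-- Both parameters are minima of non-empty sets of naturals; such a minimum
-- is at least r exactly when every member of the set is.
treewidth_≥_√_ : ∀ {n} → Graph n → ℚ → ℕ → Set₁
treewidth G ≥ c √ m = ∀ (D : TreeDecomposition G) → c √ m ≤ width D

layeredTreewidth_≥_ : ∀ {n} → Graph n → ℚ → Set₁
layeredTreewidth G ≥ r =
  ∀ (D : TreeDecomposition G) (L : Layering G) → r ℚ.≤ ℕ→ℚ (widthAlong D L)

record Finite (A : Set) : Set where
  field
    size        : ℕ
    enumeration : A ↔ Fin size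

∥_∥ : {A : Set} → Finite A → ℕ
∥_∥ = Finite.size

total : {A : Set} → Finite A → (A → ℕ) → ℕ
total fin f = foldr _+_ 0 (f ∘ Inverse.from enumeration)
  where open Finite fin

-- π identifies B with the set of orbits of the group generated by σ and τ.
record IsOrbitMap {A B : Set} (σ τ : A → A) (π : A → B) : Set where
  field
    surjective : Surjective _≡_ _≡_ π
    kernel     : ∀ x y → π x ≡ π y ⇔ EqClosure (λ a b → b ≡ σ a ⊎ b ≡ τ a) x y

-- A finite simple graph embedded without crossings in a closed connected
-- surface, orientable or not; faces need not be open discs.
--
-- A flag is an end of an edge together with a side of that edge.  τ₀ moves
-- to the other end along the same side, τ₂ to the other side at the same
-- end, and τ₁ turns across the corner of the face at that end to the next
-- edge.  Vertices, edges and facial walks are the orbits of ⟨τ₁,τ₂⟩,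
-- ⟨τ₀,τ₂⟩ and ⟨τ₀,τ₁⟩.  (By noLoop, neither τ₀ nor τ₀τ₂ has fixed points.)
--
-- A face f is the interior of a compact surface whose boundary circles
-- correspond to the facial walks w with faceOfWalk w ≡ f; faceGenus f is
-- the Euler genus of the closed surface got by capping these circles with
-- discs.  Thus f is a disc iff it has one facial walk and faceGenus f ≡ 0.
--
-- Isolated vertices are omitted: such a vertex lies in a single face, so
-- deleting it alters neither the set of faces nor which distinct faces
-- share a vertex.
record EmbeddedGraph : Set₁ where
  field
    Flag Vertex Edge Walk Face : Set
    flags    : Finite Flag
    vertices : Finite Vertex
    edges    : Finite Edge
    walks    : Finite Walk
    faces    : Finite Face

    τ₀ τ₁ τ₂      : Flag → Flag
    τ₀-involutive : Involutive _≡_ τ₀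
    τ₁-involutive : Involutive _≡_ τ₁
    τ₂-involutive : Involutive _≡_ τ₂
    τ₀τ₂-commute  : ∀ x → τ₀ (τ₂ x) ≡ τ₂ (τ₀ x)
    τ₁-free       : ∀ x → τ₁ x ≢ x
    τ₂-free       : ∀ x → τ₂ x ≢ x

    vertexOf : Flag → Vertex
    edgeOf   : Flag → Edge
    walkOf   : Flag → Walk
    vertexOf-orbits : IsOrbitMap τ₁ τ₂ vertexOf
    edgeOf-orbits   : IsOrbitMap τ₀ τ₂ edgeOf
    walkOf-orbits   : IsOrbitMap τ₀ τ₁ walkOf

    noLoop     : ∀ x → vertexOf (τ₀ x) ≢ vertexOf x
    noParallel : ∀ x y → vertexOf x ≡ vertexOf y →
                 vertexOf (τ₀ x) ≡ vertexOf (τ₀ y) → edgeOf x ≡ edgeOf y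

    faceOfWalk : Walk → Face
    faceGenus  : Face → ℕ

  faceOf : Flag → Face
  faceOf = faceOfWalk ∘ walkOf

  field
    -- The surface is non-empty, and connected: any two faces are joined by
    -- a sequence of crossings of edges.
    someFace  : Face
    connected : ∀ f f′ →
      EqClosure (λ a b → ∃[ x ] (faceOf x ≡ a × faceOf (τ₂ x) ≡ b)) f f′

  -- V - E + Σ_f (2 - faceGenus f - number of facial walks of f)
  eulerCharacteristic : ℤ
  eulerCharacteristic =
    (+ ∥ vertices ∥ ℤ.- + ∥ edges ∥) ℤ.+
    (+ (2 * ∥ faces ∥) ℤ.- + (total faces faceGenus + ∥ walks ∥))

  -- The characteristic is 2 - 2h with h handles and 2 - c with c cross-caps.
  eulerGenus : ℤ
  eulerGenus = + 2 ℤ.- eulerCharacteristic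

  Incident : Vertex → Face → Set
  Incident v f = ∃[ x ] (vertexOf x ≡ v × faceOf x ≡ f)

data Label : Set where
  nation lake : Label

AtMost : ℕ → {A : Set} → (A → Set) → Set
AtMost d P = ∃[ xs ] (length xs ≤ d × (∀ a → P a → a List.∈ xs))

record IsMapGraph (g d : ℕ) {n} (G : Graph n) : Set₁ where
  field
    G₀ : EmbeddedGraph
  open EmbeddedGraph G₀
  field
    genus≤g    : eulerGenus ℤ.≤ + g
    label      : Face → Label
    nations≤d  : ∀ v → AtMost d (λ f → label f ≡ nation × Incident v f)
    nationOf   : Fin n ↔ (∃[ f ] label f ≡ nation)

  face : Fin n → Face
  face i = let (f , _) = Inverse.to nationOf i in f

  field
    adjacency  : ∀ i j → Adj G i j ⇔
                 (i ≢ j × ∃[ v ] (Incident v (face i) × Incident v (face j)))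

{-# OPTIONS --safe #-}

-- A graph of hubs is drawn on the surface and each of its links is replaced by
-- r = ⌊d/4⌋ parallel nations, so that two nations are adjacent iff their links
-- share a hub.  The hubs form s × s grids: two such sheets, zipped together along
-- one side, make a piece, and gluing K pieces along their other three sides costs
-- Euler genus at most 2K − 2.  The pieces are grouped into nH blocks of bounded
-- size, each chained together along two sides; the third side follows a matching,
-- found greedily, that joins any two disjoint sets of at least nH/8 blocks.
--
-- If a set X of few nations (compared with s r nH) is deleted, then in most blocks
-- most rows and columns of the grids survive; these hang together, and expansion
-- puts more than half of the blocks into a single component.  The majorities of
-- two sets X and Y share a block, so their components touch: a haven, which forces
-- a large bag in every tree-decomposition.  For a layering, a sparse residue class
-- of layers modulo p is deleted first.  This confines the haven to p − 1
-- consecutive layers, where a bag of layered width ℓ has at most p ℓ vertices.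
module Submission where

open import Algebra.Definitions using (Involutive)
open import Data.Bool using (Bool; true; false; not; _xor_; if_then_else_)
open import Data.Bool.Properties using (T-≡; not-involutive; not-¬; xor-identityʳ)
open import Data.Empty using (⊥)
open import Data.Fin as Fin using
  (Fin; zero; suc; toℕ; inject₁; fromℕ; opposite; combine; remQuot; punchOut; punchIn; _↑ˡ_; _↑ʳ_)
open import Data.Fin.Induction using (<-weakInduction)
import Data.Fin.Properties as Fin
open import Data.Fin.Subset using (Subset; _∈_; _∉_; _∩_; ∣_∣)
open import Data.Fin.Subset.Properties using (_∈?_; x∈p∩q⁺)
open import Data.Integer as ℤ using () renaming (+_ to nat)
import Data.Integer.Properties as ℤ
import Data.Integer.Tactic.RingSolver as ℤ-solver
open import Data.List as List using (List; []; _∷_; length; filter; map; _++_; cartesianProduct)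
import Data.List.Membership.Propositional as List
open import Data.List.Membership.Propositional.Properties as List using (∈-tabulate⁺)
import Data.List.Properties as List
open import Data.List.Relation.Unary.All as All using (All; []; _∷_)
import Data.List.Relation.Unary.All.Properties as All
open import Data.List.Relation.Unary.Any using (here; there)
open import Data.Maybe as Maybe using (Maybe; just; nothing)
open import Data.Nat
open import Data.Nat.DivMod
open import Data.Nat.Properties
import Algebra.Properties.CommutativeMonoid.Sum +-0-commutativeMonoid as ∑
open import Data.Nat.Tactic.RingSolver using (solve-∀)
open import Data.Product using (_×_; _,_; proj₁; proj₂; ∃; ∃₂; ∃-syntax; Σ-syntax)
open import Data.Product.Function.NonDependent.Propositional using (_×-↔_)
open import Data.Rational as ℚ using (ℚ; 0ℚ)
import Data.Rational.Properties as ℚ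
open import Data.Rational.Unnormalised as ℚᵘ using (mkℚᵘ; *≤*; *<*)
import Data.Rational.Unnormalised.Properties as ℚᵘ
open import Data.Sum as Sum using (_⊎_; inj₁; inj₂; [_,_]′)
open import Data.Sum.Function.Propositional using (_⊎-↔_)
import Data.Sum.Properties as Sum
open import Data.Vec using ([]; _∷_; tabulate)
import Data.Vec.Functional as Vector
open import Data.Vec.Properties using (lookup∘tabulate; lookup⇒[]=; []=⇒lookup)
open import Function using (_∘_; id; _↔_; mk⇔; mk↔ₛ′; Injective; Inverse; Equivalence)
open import Function.Consequences.Propositional using (strictlySurjective⇒surjective)
open import Function.Construct.Composition using (_↔-∘_)
open import Function.Construct.Identity using (↔-id)
open import Function.Construct.Symmetry using (↔-sym)
open import Level using (0ℓ)
open import Relation.Binary using (Rel; IsEquivalence; DecidableEquality)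
open import Relation.Binary.Construct.Closure.Equivalence as Eq using (EqClosure)
open import Relation.Binary.Construct.Closure.ReflexiveTransitive as Star using (Star; ε; _◅_; _◅◅_)
open import Relation.Binary.PropositionalEquality
open import Relation.Nullary using (¬_; Dec; yes; no; contradiction)
open import Relation.Nullary.Decidable using
  (map′; _×-dec_; _⊎-dec_; _→-dec_; ¬?; ⌊_⌋; decidable-stable; toWitness; fromWitness)
open import Defs

-- Why an expander: with K pieces of side s and strips of r nations, n is 4 K s² r, so the square of
-- s r K is of order (K r) n. The bound on the treewidth therefore asks for K proportional to g + 1
-- and for a haven that survives the loss of a small constant times s r K nations. A mere chain of
-- blocks would not do, since deleting the 2 s r nations at one joint cuts it in two. Why two
-- sheets: zipped on all four sides, a piece is a sphere, and a gluing opens a zip into a slit whose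
-- two banks are joined to those of another slit. Any pairing of the sides thus gives a closed
-- surface, even one that leaves some sides unpaired, and the genus can be bounded before the
-- matching is known. Why lines are counted per block: row and column numbers persist across glued
-- sides, and a number counts as surviving in a block only if it survives in every piece there. In a
-- good block more than half of the numbers survive, so two good blocks glued together always have a
-- surviving column number in common.

-- Finite sums and counting

module Sums where

  private variable
    k l n : ℕ

  -- Opaque, so that the summand can be inferred from a sum.
  opaque

    sum : (Fin n → ℕ) → ℕ
    sum = ∑.sum

    sum-cong-≗ : {f g : Fin n → ℕ} → f ≗ g → sum f ≡ sum g
    sum-cong-≗ = ∑.sum-cong-≗

    ∑-distrib-+ : (f g : Fin n → ℕ) → sum (λ i → f i + g i) ≡ sum f + sum g
    ∑-distrib-+ = ∑.∑-distrib-+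

    ∑-comm : (f : Fin k → Fin n → ℕ) → sum (λ i → sum (f i)) ≡ sum (λ j → sum (λ i → f i j))
    ∑-comm = ∑.∑-comm

    sum-mono-≤ : {f g : Fin n → ℕ} → (∀ i → f i ≤ g i) → sum f ≤ sum g
    sum-mono-≤ {zero}  le = z≤n
    sum-mono-≤ {suc n} le = +-mono-≤ (le zero) (sum-mono-≤ (le ∘ suc))

    term≤sum : (f : Fin n → ℕ) → ∀ i → f i ≤ sum f
    term≤sum f zero    = m≤m+n (f zero) _
    term≤sum f (suc i) = ≤-trans (term≤sum (f ∘ suc) i) (m≤n+m _ (f zero))

    sum-const : ∀ n c → sum {n} (λ _ → c) ≡ n * c
    sum-const zero    c = refl
    sum-const (suc n) c = cong (c +_) (sum-const n c)

    sum-*ˡ : ∀ c (f : Fin n → ℕ) → sum (λ i → c * f i) ≡ c * sum f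
    sum-*ˡ {zero}  c f = sym (*-zeroʳ c)
    sum-*ˡ {suc n} c f = trans (cong (c * f zero +_) (sum-*ˡ c (f ∘ suc)))
                               (sym (*-distribˡ-+ c (f zero) (sum (f ∘ suc))))

  sum-*ʳ : ∀ (f : Fin n → ℕ) c → sum (λ i → f i * c) ≡ sum f * c
  sum-*ʳ f c = trans (sum-cong-≗ (λ i → *-comm (f i) c)) (trans (sum-*ˡ c f) (*-comm c (sum f)))

  𝟙 : ∀ {p} {P : Set p} → Dec P → ℕ
  𝟙 (yes _) = 1
  𝟙 (no  _) = 0

  𝟙≤ : ∀ {p} {P : Set p} (d : Dec P) {k} → (P → 1 ≤ k) → 𝟙 d ≤ k
  𝟙≤ (yes p) le = le p
  𝟙≤ (no  _) le = z≤n

  𝟙-yes : ∀ {p} {P : Set p} (d : Dec P) → P → 1 ≤ 𝟙 d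
  𝟙-yes (yes _) p = ≤-refl
  𝟙-yes (no ¬p) p = contradiction p ¬p

  𝟙-no : ∀ {p} {P : Set p} (d : Dec P) → ¬ P → 𝟙 d ≡ 0
  𝟙-no (yes p) ¬p = contradiction p ¬p
  𝟙-no (no  _) ¬p = refl

  𝟙-mono : ∀ {p q} {P : Set p} {Q : Set q} (d : Dec P) (e : Dec Q) → (P → Q) → 𝟙 d ≤ 𝟙 e
  𝟙-mono (yes p) e f = 𝟙-yes e (f p)
  𝟙-mono (no  _) e f = z≤n

  # : ∀ {p} {P : Fin n → Set p} → (∀ i → Dec (P i)) → ℕ
  # P? = sum (λ i → 𝟙 (P? i))

  opaque
    unfolding sum

    #-subsingleton : ∀ {p} {P : Fin n → Set p} (P? : ∀ i → Dec (P i)) →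
                     (∀ i j → P i → P j → i ≡ j) → # P? ≤ 1
    #-subsingleton {zero}  P? uniq = z≤n
    #-subsingleton {suc n} {P = P} P? uniq with P? zero
    ... | no  _ = #-subsingleton (P? ∘ suc) (λ i j p q → Fin.suc-injective (uniq (suc i) (suc j) p q))
    ... | yes p = s≤s (≤-reflexive (trans (sum-cong-≗ (λ i → 𝟙-no (P? (suc i)) (λ q →
                    contradiction (uniq zero (suc i) p q) λ ()))) (trans (sum-const n 0) (*-zeroʳ n))))

  injection⇒≤sum : (f : Fin k → Fin n) → Injective _≡_ _≡_ f →
                   (g : Fin n → ℕ) → (∀ j → 1 ≤ g (f j)) → k ≤ sum g
  injection⇒≤sum {k} {n} f inj g pos = begin
    k                                                   ≡⟨ sym (trans (sum-const k 1) (*-identityʳ k)) ⟩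
    sum {k} (λ _ → 1)
      ≤⟨ sum-mono-≤ (λ j → ≤-trans (𝟙-yes (f j Fin.≟ f j) refl)
          (≤-trans (m≤m*n _ (g (f j)) {{>-nonZero (pos j)}})
          (term≤sum (λ i → 𝟙 (f j Fin.≟ i) * g i) (f j)))) ⟩
    sum (λ j → sum (λ i → 𝟙 (f j Fin.≟ i) * g i))       ≡⟨ ∑-comm (λ j i → 𝟙 (f j Fin.≟ i) * g i) ⟩
    sum (λ i → sum (λ j → 𝟙 (f j Fin.≟ i) * g i))
      ≡⟨ sum-cong-≗ (λ i → sum-*ʳ (λ j → 𝟙 (f j Fin.≟ i)) (g i)) ⟩
    sum (λ i → # (λ j → f j Fin.≟ i) * g i)             ≤⟨ sum-mono-≤ (λ i → *-monoˡ-≤ (g i)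
          (#-subsingleton (λ j → f j Fin.≟ i)
          (λ j j′ p q → inj (trans p (sym q))))) ⟩
    sum (λ i → 1 * g i)                                 ≡⟨ sum-cong-≗ (λ i → *-identityˡ (g i)) ⟩
    sum g                                               ∎
    where open ≤-Reasoning

  majorities-meet : ∀ {p q} {P : Fin n → Set p} {Q : Fin n → Set q}
                    (P? : ∀ i → Dec (P i)) (Q? : ∀ i → Dec (Q i)) →
                    n < 2 * # P? → n < 2 * # Q? → ∃[ i ] (P i × Q i)
  majorities-meet {n} P? Q? hP hQ with Fin.any? (λ i → P? i ×-dec Q? i)
  ... | yes r = r
  ... | no ¬r = contradiction (≤-<-trans bound lt) (<-irrefl refl)
    where
    one : ∀ i → 𝟙 (P? i) + 𝟙 (Q? i) ≤ 1
    one i with P? i | Q? i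
    ... | yes p | yes q = contradiction (i , p , q) ¬r
    ... | yes p | no  _ = ≤-refl
    ... | no  _ | yes _ = ≤-refl
    ... | no  _ | no  _ = z≤n
    bound : 2 * # P? + 2 * # Q? ≤ 2 * n
    bound = begin
      2 * # P? + 2 * # Q?                        ≡⟨ sym (*-distribˡ-+ 2 (# P?) (# Q?)) ⟩
      2 * (# P? + # Q?)
        ≡⟨ cong (2 *_) (sym (∑-distrib-+ (λ i → 𝟙 (P? i)) (λ i → 𝟙 (Q? i)))) ⟩
      2 * sum (λ i → 𝟙 (P? i) + 𝟙 (Q? i))        ≤⟨ *-monoʳ-≤ 2 (sum-mono-≤ one) ⟩
      2 * sum {n} (λ _ → 1)                      ≡⟨ cong (2 *_) (trans (sum-const n 1) (*-identityʳ n)) ⟩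
      2 * n                                      ∎
      where open ≤-Reasoning
    lt : 2 * n < 2 * # P? + 2 * # Q?
    lt = subst (_< 2 * # P? + 2 * # Q?) (cong (n +_) (sym (+-identityʳ n))) (+-mono-< hP hQ)

  #-complement : ∀ {p q} {P : Fin n → Set p} {Q : Fin n → Set q}
                 (P? : ∀ i → Dec (P i)) (Q? : ∀ i → Dec (Q i)) →
                 (∀ i → ¬ P i → Q i) → n ≤ # P? + # Q?
  #-complement {n} P? Q? cover = begin
    n                                      ≡⟨ sym (trans (sum-const n 1) (*-identityʳ n)) ⟩
    sum {n} (λ _ → 1)                      ≤⟨ sum-mono-≤ one ⟩
    sum (λ i → 𝟙 (P? i) + 𝟙 (Q? i))        ≡⟨ ∑-distrib-+ (λ i → 𝟙 (P? i)) (λ i → 𝟙 (Q? i)) ⟩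
    # P? + # Q?                            ∎
    where
    open ≤-Reasoning
    one : ∀ i → 1 ≤ 𝟙 (P? i) + 𝟙 (Q? i)
    one i with P? i
    ... | yes _ = s≤s z≤n
    ... | no ¬p = 𝟙-yes (Q? i) (cover i ¬p)

  𝟙-map′ : ∀ {P Q : Set} {f : P → Q} {g : Q → P} (d : Dec P) → 𝟙 d ≡ 𝟙 (map′ f g d)
  𝟙-map′ (yes _) = refl
  𝟙-map′ (no  _) = refl

  opaque
    unfolding sum

    ∣p∣≡# : (p : Subset n) → ∣ p ∣ ≡ # (λ i → i ∈? p)
    ∣p∣≡# []          = refl
    ∣p∣≡# (true ∷ p)  = cong suc (trans (∣p∣≡# p) (sum-cong-≗ (λ i → 𝟙-map′ (i ∈? p))))
    ∣p∣≡# (false ∷ p) = trans (∣p∣≡# p) (sum-cong-≗ (λ i → 𝟙-map′ (i ∈? p)))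

open Sums

-- Paths, trees, and havens as obstructions to tree-decompositions

module Havens where

  private variable
    k l n : ℕ

  module _ {m} (R : Rel (Fin m) 0ℓ) where

    data Path : Fin m → Fin m → ℕ → Set
    vert : ∀ {x y} → Path x y l → Fin (suc l) → Fin m

    data Path where
      []   : ∀ {x} → Path x x 0
      extend : ∀ {x z y} → R x z → (p : Path z y l) → (∀ i → vert p i ≢ x) → Path x y (suc l)

    vert {x = x} p  zero    = x
    vert (extend r p f) (suc i) = vert p i

  module _ {m} {R : Rel (Fin m) 0ℓ} where

    vert-injective : ∀ {x y} (p : Path R x y l) → Injective _≡_ _≡_ (vert R p)
    vert-injective []           {zero}  {zero}  eq = refl
    vert-injective (extend r p f) {zero}  {zero}  eq = refl
    vert-injective (extend r p f) {zero}  {suc j} eq = contradiction (sym eq) (f j)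
    vert-injective (extend r p f) {suc i} {zero}  eq = contradiction eq (f i)
    vert-injective (extend r p f) {suc i} {suc j} eq = cong suc (vert-injective p eq)

    vert-step : ∀ {x y} (p : Path R x y l) (i : Fin l) → R (vert R p (inject₁ i)) (vert R p (suc i))
    vert-step (extend r p f) zero    = r
    vert-step (extend r p f) (suc i) = vert-step p i

    vert-last : ∀ {x y} (p : Path R x y l) → vert R p (fromℕ l) ≡ y
    vert-last []           = refl
    vert-last (extend r p f) = vert-last p

    dropTo : ∀ {x y} (p : Path R x y l) (i : Fin (suc l)) → ∃[ k ] Path R (vert R p i) y k
    dropTo p            zero    = _ , p
    dropTo (extend r p f) (suc i) = dropTo p i

    takeTo : ∀ {x y} (p : Path R x y l) (i : Fin (suc l)) → Path R x (vert R p i) (toℕ i)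
    takeTo-⊆ : ∀ {x y} (p : Path R x y l) (i : Fin (suc l)) j →
               ∃[ k ] vert R p k ≡ vert R (takeTo p i) j

    takeTo p            zero    = []
    takeTo (extend r p f) (suc i) = extend r (takeTo p i)
      (λ j eq → let (k , eq′) = takeTo-⊆ p i j in f k (trans eq′ eq))

    takeTo-⊆ p            zero    zero    = zero , refl
    takeTo-⊆ (extend r p f) (suc i) zero    = zero , refl
    takeTo-⊆ (extend r p f) (suc i) (suc j) = let (k , eq) = takeTo-⊆ p i j in suc k , eq

    loopErase : ∀ {x y} → Star R x y → ∃[ l ] Path R x y l
    loopErase ε = 0 , []
    loopErase {x} (r ◅ rs) with loopErase rs
    ... | l , p with Fin.any? (λ i → vert R p i Fin.≟ x)
    ...   | no  x∉p       = suc l , extend r p (λ i eq → x∉p (i , eq))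
    ...   | yes (i , refl) = dropTo p i

    length< : ∀ {x y} → Path R x y l → l < m
    length< p = Fin.injective⇒≤ (vert-injective p)

  module _ {m} {T : Graph m} where

    closePath : ∀ {R x y} → (∀ {a b} → R a b → Adj T a b) →
                Path R x y (2 + k) → Adj T y x → Cycle T
    closePath {k = k} {R = R} R⊆T p yx = record
      { k         = k
      ; vertex    = vert R p
      ; injective = vert-injective p
      ; step      = R⊆T ∘ vert-step p
      ; close     = subst (λ v → Adj T v _) (sym (vert-last p)) yx
      }

    -- The initial segment up to vertex `i` has exactly `toℕ i` edges, at least two, so the chord
    -- closes it to a cycle of length at least three.
    chord : ∀ {x y} (p : Path (Adj T) x y l) (i : Fin (suc l)) → 2 ≤ toℕ i →
            Adj T (vert (Adj T) p i) x → Cycle T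
    chord p i 2≤i e with toℕ i | takeTo p i
    chord p i (s≤s (s≤s _)) e | suc (suc k) | q = closePath (λ r → r) q e

    module _ (next : Fin m → Fin m) (adj : ∀ x → Adj T x (next x))
             (nonBacktracking : ∀ x → next (next x) ≢ x) where

      private
        -- The walk along next is kept reversed, so that it grows at its head.
        grow : ∀ fuel {x y z l} (r : Adj T x z) (p : Path (Adj T) z y l)
               (f : ∀ i → vert (Adj T) p i ≢ x) → next z ≡ x → m ≤ fuel + l → Cycle T
        grow zero r p f eq m≤l = contradiction (length< p) (≤⇒≯ m≤l)
        grow (suc fuel) {x} {l = l} r p f eq m≤l
          with Fin.any? (λ i → vert (Adj T) (extend r p f) i Fin.≟ next x)
        ... | no fresh = grow fuel (Graph.sym T (adj x)) (extend r p f) (λ i e → fresh (i , e)) refl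
                           (subst (m ≤_) (sym (+-suc fuel l)) m≤l)
        ... | yes (zero , e) = contradiction (adj x) (Graph.irrefl T e)
        ... | yes (suc zero , e) = contradiction (trans (cong next eq) (sym e)) (nonBacktracking _)
        ... | yes (suc (suc i) , e) = chord (extend r p f) (suc (suc i)) (s≤s (s≤s z≤n))
                                       (subst (λ v → Adj T v x) (sym e) (Graph.sym T (adj x)))

      -- A walk along `next` in a finite set must revisit a vertex. The first revisit is neither to
      -- the current vertex, as there are no loops, nor to the one before it, so it is a chord of
      -- the path walked so far.
      pointers⇒cycle : Fin m → Cycle T
      pointers⇒cycle x = grow m (Graph.sym T (adj x)) []
        (λ { zero e → Graph.irrefl T e (adj x) }) refl (m≤m+n m 0)

  module _ {n} (G : Graph n) where

    Avoiding : (Fin n → Set) → Rel (Fin n) 0ℓ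
    Avoiding X u v = Adj G u v × ¬ X u × ¬ X v

    Touching : Rel (Fin n) 0ℓ
    Touching u v = u ≡ v ⊎ Adj G u v

  module _ {n} {G : Graph n} (D : TreeDecomposition G) where
    open TreeDecomposition D

    private
      Off : Fin m → Rel (Fin m) 0ℓ
      Off x s t = Adj T s t × s ≢ x × t ≢ x

      bags-joined : ∀ {x v y z} → v ∉ bag x → v ∈ bag y → v ∈ bag z → Star (Off x) y z
      bags-joined {x} {v} v∉x v∈y v∈z = Star.map
        (λ { (st , v∈s , v∈t) → st , (λ { refl → v∉x v∈s }) , λ { refl → v∉x v∈t } })
        (subtree v v∈y v∈z)

      -- Consecutive vertices of the walk share a bag, and the subtree of each of them misses `x`.
      -- So all bags that a component of `G` minus `bag x` meets lie in one branch of the tree at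
      -- `x`.
      component-joined : ∀ {x u v y z} → Star (Avoiding G (_∈ bag x)) u v → u ∉ bag x →
                         u ∈ bag y → v ∈ bag z → Star (Off x) y z
      component-joined ε u∉x u∈y v∈z = bags-joined u∉x u∈y v∈z
      component-joined ((uw , _ , w∉x) ◅ ws) u∉x u∈y v∈z =
        let (t , u∈t , w∈t) = edgeCovered uw in
        bags-joined u∉x u∈y u∈t ◅◅ component-joined ws w∉x w∈t v∈z

      touching-bag : ∀ {u v} → Touching G u v → ∃[ z ] (u ∈ bag z × v ∈ bag z)
      touching-bag (inj₁ refl) = let (z , u∈z) = vertexCovered _ in z , u∈z , u∈z
      touching-bag (inj₂ uv)   = edgeCovered uv

    -- Every node would point to the neighbour behind which the component of
    -- h x lies; in a finite tree two adjacent nodes then point at each other,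
    -- and a bag meeting both components joins them off their common edge.
    no-haven : (h : Fin m → Fin n) → (∀ x → h x ∉ bag x) →
               (∀ x y → ∃₂ λ u v → Star (Avoiding G (_∈ bag x)) (h x) u ×
                                    Star (Avoiding G (_∈ bag y)) (h y) v × Touching G u v) → ⊥
    no-haven h h∉ meet = IsTree.acyclic isTree
      (pointers⇒cycle (proj₁ ∘ pointer) (proj₁ ∘ proj₂ ∘ pointer) nonBacktracking root)
      where
      root : Fin m
      root = helper m (IsTree.nonEmpty isTree)
        where
        helper : ∀ m → NonZero m → Fin m
        helper (suc m) _ = zero

      pointer : ∀ x → ∃[ y ] (Adj T x y × ∃[ z ] (h x ∈ bag z × Star (Off x) y z))
      pointer x = go (loopErase (IsTree.connected isTree x z))
        where
        z = proj₁ (vertexCovered (h x))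
        hx∈z = proj₂ (vertexCovered (h x))
        offPath : ∀ {y w l} (p : Path (Adj T) y w l) → (∀ i → vert (Adj T) p i ≢ x) → Star (Off x) y w
        offPath []           f = ε
        offPath (extend r p _) f = (r , f zero , f (suc zero)) ◅ offPath p (f ∘ suc)
        go : ∃[ l ] Path (Adj T) x z l → ∃[ y ] (Adj T x y × ∃[ z ] (h x ∈ bag z × Star (Off x) y z))
        go (_ , p) with z | hx∈z
        go (_ , []) | _ | hx∈x = contradiction hx∈x (h∉ x)
        go (_ , extend r p f) | z | hx∈z = _ , r , z , hx∈z , offPath p f

      nonBacktracking : ∀ x → proj₁ (pointer (proj₁ (pointer x))) ≢ x
      nonBacktracking x back = go (pointer x) (pointer (proj₁ (pointer x))) back
        where
        go : (px : ∃[ y ] (Adj T x y × ∃[ z ] (h x ∈ bag z × Star (Off x) y z))) →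
             (py : ∃[ w ] (Adj T (proj₁ px) w × ∃[ z ] (h (proj₁ px) ∈ bag z × Star (Off (proj₁ px)) w z))) →
             proj₁ py ≡ x → ⊥
        go (y , xy , z , hx∈z , y⇝z) (x , _ , z′ , hy∈z′ , x⇝z′) refl =
          let (u , v , hx⇝u , hy⇝v , touch) = meet x y
              (t , u∈t , v∈t) = touching-bag touch
              y⇝t = y⇝z ◅◅ component-joined hx⇝u (h∉ x) hx∈z u∈t
              x⇝t = x⇝z′ ◅◅ component-joined hy⇝v (h∉ y) hy∈z′ v∈t
          in closeUp (loopErase (Star.map (λ { (st , _ , t≢y) → st , t≢y ∘ proj₂ }) x⇝t ◅◅
                                 Star.reverse (λ { (st , _ , t≢x) → Graph.sym T st , t≢x ∘ proj₁ }) y⇝t))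
          where
          -- Only the step from `x` to `y` is forbidden: the first half of the walk never enters `y`
          -- and the second half never leaves `x`. Hence the loop-erased walk is not the edge itself
          -- and closes up with it to a cycle.
          R : Rel (Fin m) 0ℓ
          R s t = Adj T s t × ¬ (s ≡ x × t ≡ y)
          closeUp : ∃[ l ] Path R x y l → ⊥
          closeUp (_ , []) = Graph.irrefl T refl xy
          closeUp (_ , extend (_ , ne) [] _) = ne (refl , refl)
          closeUp (_ , p@(extend _ (extend _ _ _) _)) =
            IsTree.acyclic isTree (closePath {T = T} proj₁ p (Graph.sym T xy))

open Havens

-- From havens to bag sizes and layered width

module LayeredHavens where

  private variable
    k l n : ℕ

  small-term : .{{NonZero n}} → (f : Fin n → ℕ) → sum f ≤ n * l → ∃[ i ] f i ≤ l
  small-term {n} {l} f le with Fin.any? (λ i → f i ≤? l)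
  ... | yes r = r
  ... | no ¬r = contradiction
    (≤-trans (≤-trans (≤-reflexive (sym (sum-const n (suc l)))) (sum-mono-≤ (λ i → ≰⇒> (¬r ∘ (i ,_))))) le)
    (<⇒≱ (*-monoʳ-< n ≤-refl))

  module _ {P : Fin n → Set} (P? : ∀ i → Dec (P i)) where

    ⟦_⟧ : Subset n
    ⟦_⟧ = tabulate (λ i → ⌊ P? i ⌋)

    ∈⟦⟧⁺ : ∀ {i} → P i → i ∈ ⟦_⟧
    ∈⟦⟧⁺ {i} p = lookup⇒[]= i _ (trans (lookup∘tabulate _ i)
      (Equivalence.to T-≡ (fromWitness {a? = P? i} p)))

    ∈⟦⟧⁻ : ∀ {i} → i ∈ ⟦_⟧ → P i
    ∈⟦⟧⁻ {i} i∈ = toWitness {a? = P? i} (Equivalence.from T-≡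
      (trans (sym (lookup∘tabulate _ i)) ([]=⇒lookup i∈)))

    ∣⟦⟧∣ : ∣ ⟦_⟧ ∣ ≤ # P?
    ∣⟦⟧∣ = ≤-trans (≤-reflexive (∣p∣≡# ⟦_⟧)) (sum-mono-≤ (λ i → 𝟙-mono (i ∈? ⟦_⟧) (P? i) ∈⟦⟧⁻))

  ≤maximum : (f : Fin n → ℕ) → ∀ i → f i ≤ maximum f
  ≤maximum f zero    = m≤m⊔n (f zero) _
  ≤maximum f (suc i) = ≤-trans (≤maximum (f ∘ suc) i) (m≤n⊔m (f zero) _)

  record HavenOfOrder (k : ℕ) {n} (G : Graph n) : Set₁ where
    field
      home   : (X : Subset n) → ∣ X ∣ ≤ k → Fin n
      home∉  : ∀ X X≤k → home X X≤k ∉ X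
      meet   : ∀ X Y X≤k Y≤k → ∃₂ λ u v →
               Star (Avoiding G (_∈ X)) (home X X≤k) u × Star (Avoiding G (_∈ Y)) (home Y Y≤k) v ×
               Touching G u v

  module _ {G : Graph n} (H : HavenOfOrder k G) (D : TreeDecomposition G) where
    open HavenOfOrder H
    open TreeDecomposition D

    haven⇒largeBag : k < maximum (λ x → ∣ bag x ∣)
    haven⇒largeBag = ≰⇒> λ max≤k →
      let small x = ≤-trans (≤maximum (λ x → ∣ bag x ∣) x) max≤k in
      no-haven D (λ x → home (bag x) (small x)) (λ x → home∉ (bag x) (small x))
        (λ x y → meet (bag x) (bag y) (small x) (small y))

    module _ (L : Layering G) (p : ℕ) .{{_ : NonZero p}} (w : ℕ) (n≤pw : n ≤ p * w)
             (ℓ : ℕ) (room : w + p * ℓ ≤ k) where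
      open Layering L renaming (close to layer-close)

      private
        λ[_] : Fin n → ℕ
        λ[ v ] = toℕ (layerOf v)

        Cut : Fin p → Fin n → Set
        Cut ρ v = λ[ v ] % p ≡ toℕ ρ

        cut? : ∀ ρ v → Dec (Cut ρ v)
        cut? ρ v = λ[ v ] % p ≟ toℕ ρ

        thinCut : ∃[ ρ ] # (cut? ρ) ≤ w
        thinCut = small-term (λ ρ → # (cut? ρ)) (begin
          sum (λ ρ → # (cut? ρ))                    ≡⟨ ∑-comm (λ ρ v → 𝟙 (cut? ρ v)) ⟩
          sum (λ v → # (λ ρ → cut? ρ v))            ≤⟨ sum-mono-≤ (λ v → #-subsingleton (λ ρ → cut? ρ v)
                (λ ρ σ e e′ → Fin.toℕ-injective (trans (sym e) e′))) ⟩
          sum {n} (λ _ → 1)                         ≡⟨ trans (sum-const n 1) (*-identityʳ n) ⟩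
          n                                         ≤⟨ n≤pw ⟩
          p * w                                     ∎)
          where open ≤-Reasoning

        module _ (ρ : Fin p) (thinρ : # (cut? ρ) ≤ w) where

          off : ℕ
          off = p ∸ toℕ ρ

          cutAt : ∀ {v} c → λ[ v ] + off ≡ c * p → Cut ρ v
          cutAt {v} c eq = begin
            λ[ v ] % p                    ≡⟨ sym ([m+n]%n≡m%n λ[ v ] p) ⟩
            (λ[ v ] + p) % p              ≡⟨ cong (_% p) (begin
              λ[ v ] + p                    ≡⟨ cong (λ[ v ] +_) (sym (m∸n+n≡m (<⇒≤ (Fin.toℕ<n ρ)))) ⟩
              λ[ v ] + (off + toℕ ρ)        ≡⟨ sym (+-assoc λ[ v ] off (toℕ ρ)) ⟩
              λ[ v ] + off + toℕ ρ          ≡⟨ cong (_+ toℕ ρ) eq ⟩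
              c * p + toℕ ρ                 ≡⟨ +-comm (c * p) (toℕ ρ) ⟩
              toℕ ρ + c * p                 ∎) ⟩
            (toℕ ρ + c * p) % p           ≡⟨ [m+kn]%n≡m%n (toℕ ρ) c p ⟩
            toℕ ρ % p                     ≡⟨ m<n⇒m%n≡m (Fin.toℕ<n ρ) ⟩
            toℕ ρ                         ∎
            where open ≡-Reasoning

          -- The shift by off makes the layers that are cut the multiples of p.
          Chunk : ℕ → Fin n → Set
          Chunk q v = q * p < λ[ v ] + off × λ[ v ] + off < suc q * p

          inSomeChunk : ∀ v → ¬ Cut ρ v → ∃[ q ] Chunk q v
          inSomeChunk v uncut = q ,
            ≤∧≢⇒< (m/n*n≤m a p) (uncut ∘ cutAt q ∘ sym) ,
            subst (_< suc q * p) (sym (m≡m%n+[m/n]*n a p)) (+-monoˡ-< (q * p) (m%n<n a p))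
            where
            a = λ[ v ] + off
            q = a / p

          chunk-close : ∀ q {u v} → Touching G u v → ¬ Cut ρ v → Chunk q u → Chunk q v
          chunk-close q (inj₁ refl) uncut in-q = in-q
          chunk-close q {u} {v} (inj₂ uv) uncut (lo , hi) =
            ≤∧≢⇒< (≤-pred (≤-trans lo (u≤1+v))) (uncut ∘ cutAt q ∘ sym) ,
            ≤∧≢⇒< (≤-trans v≤1+u hi) (uncut ∘ cutAt (suc q))
            where
            u≤1+v : λ[ u ] + off ≤ suc (λ[ v ] + off)
            u≤1+v = +-monoˡ-≤ off (≤-trans (m≤n+∣m-n∣ λ[ u ] λ[ v ])
                      (≤-trans (+-monoʳ-≤ λ[ v ] (layer-close uv)) (≤-reflexive (+-comm λ[ v ] 1))))
            v≤1+u : λ[ v ] + off ≤ suc (λ[ u ] + off)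
            v≤1+u = +-monoˡ-≤ off (≤-trans (m≤n+∣n-m∣ λ[ v ] λ[ u ])
                      (≤-trans (+-monoʳ-≤ λ[ u ] (layer-close uv)) (≤-reflexive (+-comm λ[ u ] 1))))

          S : Subset n
          S = ⟦ cut? ρ ⟧

          S≤k : ∣ S ∣ ≤ k
          S≤k = ≤-trans (∣⟦⟧∣ (cut? ρ)) (≤-trans thinρ (≤-trans (m≤m+n w _) room))

          chunk? : ∀ q v → Dec (Chunk q v)
          chunk? q v = (q * p <? λ[ v ] + off) ×-dec (λ[ v ] + off <? suc q * p)

          module _ (q₀ : ℕ) (home∈q₀ : Chunk q₀ (home S S≤k)) where

            -- Next to the cut, only the part of the bag inside the chunk is deleted. For components
            -- inside the chunk this is as good as deleting the whole bag, but it costs at most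
            -- `p * ℓ` vertices.
            X? : ∀ x v → Dec (Cut ρ v ⊎ (v ∈ bag x × Chunk q₀ v))
            X? x v = cut? ρ v ⊎-dec (v ∈? bag x ×-dec chunk? q₀ v)

            X : Fin m → Subset n
            X x = ⟦ X? x ⟧

            module _ (thin : widthAlong D L ≤ ℓ) where

              level≤ℓ : ∀ x (j : Fin p) → # (λ v → v ∈? bag x ×-dec (λ[ v ] + off ≟ toℕ j + q₀ * p)) ≤ ℓ
              level≤ℓ x j with Fin.any? (λ v → λ[ v ] + off ≟ toℕ j + q₀ * p)
              -- A level without vertices may lie outside the range of the layers, so that no layer
              -- is there to compare it with.
              ... | no none = ≤-trans (≤-reflexive (trans (sum-cong-≗ (λ v →
                       𝟙-no (v ∈? bag x ×-dec (λ[ v ] + off ≟ toℕ j + q₀ * p)) (none ∘ (v ,_) ∘ proj₂)))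
                       (trans (sum-const n 0) (*-zeroʳ n)))) z≤n
              ... | yes (u , eq) = begin
                # (λ v → v ∈? bag x ×-dec (λ[ v ] + off ≟ toℕ j + q₀ * p))
                  ≤⟨ sum-mono-≤ (λ v → 𝟙-mono (v ∈? bag x ×-dec (λ[ v ] + off ≟ toℕ j + q₀ * p))
                      (v ∈? (bag x ∩ layer i)) (λ (v∈x , e) → x∈p∩q⁺ (v∈x ,
                      ∈⟦⟧⁺ (λ v → layerOf v Fin.≟ i)
                      (Fin.toℕ-injective (+-cancelʳ-≡ off λ[ v ] λ[ u ] (trans e (sym eq))))))) ⟩
                # (λ v → v ∈? (bag x ∩ layer i)) ≡⟨ sym (∣p∣≡# (bag x ∩ layer i)) ⟩
                ∣ bag x ∩ layer i ∣              ≤⟨ ≤maximum (λ i → ∣ bag x ∩ layer i ∣) i ⟩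
                maximum (λ i → ∣ bag x ∩ layer i ∣)
                  ≤⟨ ≤maximum (λ x → maximum (λ i → ∣ bag x ∩ layer i ∣)) x ⟩
                widthAlong D L                   ≤⟨ thin ⟩
                ℓ                                ∎
                where
                open ≤-Reasoning
                i = layerOf u

              slice≤ : ∀ x → # (λ v → v ∈? bag x ×-dec chunk? q₀ v) ≤ p * ℓ
              slice≤ x = begin
                # (λ v → v ∈? bag x ×-dec chunk? q₀ v)                              ≤⟨ sum-mono-≤ split ⟩
                sum (λ v → # (λ j → level? j v))
                  ≡⟨ ∑-comm (λ v j → 𝟙 (level? j v)) ⟩
                sum (λ j → # (level? j))
                  ≤⟨ sum-mono-≤ (level≤ℓ x) ⟩
                sum {p} (λ _ → ℓ)                                                   ≡⟨ sum-const p ℓ ⟩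
                p * ℓ                                                               ∎
                where
                open ≤-Reasoning
                level? : ∀ (j : Fin p) v → Dec (v ∈ bag x × λ[ v ] + off ≡ toℕ j + q₀ * p)
                level? j v = v ∈? bag x ×-dec (λ[ v ] + off ≟ toℕ j + q₀ * p)
                split : ∀ v → 𝟙 (v ∈? bag x ×-dec chunk? q₀ v) ≤ # (λ j → level? j v)
                split v with v ∈? bag x ×-dec chunk? q₀ v
                ... | no  _ = z≤n
                ... | yes (v∈x , lo , hi) = ≤-trans (𝟙-yes (level? j v) (v∈x , eq)) (term≤sum (λ j → 𝟙 (level? j v)) j)
                  where
                  a = λ[ v ] + off ∸ q₀ * p
                  a<p : a < p
                  a<p = +-cancelʳ-< (q₀ * p) a p (subst (_< p + q₀ * p) (sym (m∸n+n≡m (<⇒≤ lo))) hi)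
                  j = Fin.fromℕ< a<p
                  eq : λ[ v ] + off ≡ toℕ j + q₀ * p
                  eq = trans (sym (m∸n+n≡m (<⇒≤ lo))) (cong (_+ q₀ * p) (sym (Fin.toℕ-fromℕ< a<p)))

              X≤k : ∀ x → ∣ X x ∣ ≤ k
              X≤k x = begin
                ∣ X x ∣                                                    ≤⟨ ∣⟦⟧∣ (X? x) ⟩
                # (X? x)                                                   ≤⟨ sum-mono-≤ split ⟩
                sum (λ v → 𝟙 (cut? ρ v) + 𝟙 (v ∈? bag x ×-dec chunk? q₀ v))
                  ≡⟨ ∑-distrib-+ (λ v → 𝟙 (cut? ρ v)) _ ⟩
                # (cut? ρ) + # (λ v → v ∈? bag x ×-dec chunk? q₀ v)        ≤⟨ +-mono-≤ thinρ (slice≤ x) ⟩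
                w + p * ℓ                                                  ≤⟨ room ⟩
                k                                                          ∎
                where
                open ≤-Reasoning
                split : ∀ v → 𝟙 (X? x v) ≤ 𝟙 (cut? ρ v) + 𝟙 (v ∈? bag x ×-dec chunk? q₀ v)
                split v with X? x v
                ... | no _ = z≤n
                ... | yes (inj₁ c) = ≤-trans (𝟙-yes (cut? ρ v) c) (m≤m+n _ _)
                ... | yes (inj₂ c) = ≤-trans (𝟙-yes (v ∈? bag x ×-dec chunk? q₀ v) c) (m≤n+m _ (𝟙 (cut? ρ v)))

              uncut-walk : ∀ {Y : Fin n → Set} {u v} → (∀ {v} → Cut ρ v → Y v) → ¬ Y u →
                           Star (Avoiding G Y) u v → ¬ Cut ρ v
              uncut-walk cut⊆Y u∉Y ε = u∉Y ∘ cut⊆Y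
              uncut-walk cut⊆Y u∉Y ((_ , _ , v∉Y) ◅ ws) = uncut-walk cut⊆Y v∉Y ws

              cut⊆X : ∀ x {v} → Cut ρ v → v ∈ X x
              cut⊆X x = ∈⟦⟧⁺ (X? x) ∘ inj₁

              chunk-walk : ∀ {Y : Fin n → Set} {u v} → (∀ {v} → Cut ρ v → Y v) → Chunk q₀ u →
                           Star (Avoiding G Y) u v → Chunk q₀ v
              chunk-walk cut⊆Y in-q ε = in-q
              chunk-walk cut⊆Y in-q ((uv , _ , v∉Y) ◅ ws) =
                chunk-walk cut⊆Y (chunk-close q₀ (inj₂ uv) (v∉Y ∘ cut⊆Y) in-q) ws

              reverseWalk : ∀ {Y : Fin n → Set} {u v} → Star (Avoiding G Y) u v → Star (Avoiding G Y) v u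
              reverseWalk = Star.reverse λ (e , u∉ , v∉) → Graph.sym G e , v∉ , u∉

              h : Fin m → Fin n
              h x = home (X x) (X≤k x)

              -- The components chosen for the bare cut and for `X x` touch, and both avoid the cut,
              -- so neither they nor the edge between them can leave the chunk of the first.
              h∈chunk : ∀ x → Chunk q₀ (h x)
              h∈chunk x =
                let (u , v , hS⇝u , hx⇝v , touch) = meet S (X x) S≤k (X≤k x)
                    uncut-v = uncut-walk (cut⊆X x) (home∉ (X x) (X≤k x)) hx⇝v
                    u∈ = chunk-walk (∈⟦⟧⁺ (cut? ρ)) home∈q₀ hS⇝u
                    v∈ = chunk-close q₀ touch uncut-v u∈
                in chunk-walk (cut⊆X x) v∈ (reverseWalk hx⇝v)

              h∉bag : ∀ x → h x ∉ bag x
              h∉bag x h∈x = home∉ (X x) (X≤k x) (∈⟦⟧⁺ (X? x) (inj₂ (h∈x , h∈chunk x)))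

              avoidBag : ∀ x {u v} → Chunk q₀ u → Star (Avoiding G (_∈ X x)) u v → Star (Avoiding G (_∈ bag x)) u v
              avoidBag x in-q ε = ε
              avoidBag x in-q ((uv , u∉ , v∉) ◅ ws) =
                (uv , (λ u∈x → u∉ (∈⟦⟧⁺ (X? x) (inj₂ (u∈x , in-q)))) ,
                      (λ v∈x → v∉ (∈⟦⟧⁺ (X? x) (inj₂ (v∈x , in-q′))))) ◅ avoidBag x in-q′ ws
                where in-q′ = chunk-close q₀ (inj₂ uv) (v∉ ∘ cut⊆X x) in-q

              absurd : ⊥
              absurd = no-haven D h h∉bag λ x y →
                let (u , v , hx⇝u , hy⇝v , touch) = meet (X x) (X y) (X≤k x) (X≤k y)
                in u , v , avoidBag x (h∈chunk x) hx⇝u , avoidBag y (h∈chunk y) hy⇝v , touch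

      -- If all bags had at most `ℓ` vertices per layer, every `X x` would be within the order of
      -- the haven, and the homes of these sets would contradict `no-haven`.
      haven⇒layeredWidth : ℓ < widthAlong D L
      haven⇒layeredWidth =
        let (ρ , thinρ) = thinCut
            (q , home∈q) = inSomeChunk ρ thinρ _ (home∉ (S ρ thinρ) (S≤k ρ thinρ) ∘ ∈⟦⟧⁺ (cut? ρ))
        in ≰⇒> (absurd ρ thinρ q home∈q)

open LayeredHavens

-- Quotients of finite sets and counting of orbits

module Quotients where

  private variable
    k l n N M : ℕ

  ≡-eqClosure : {A B : Set} {R : Rel A 0ℓ} (f : A → B) → (∀ {x y} → R x y → f x ≡ f y) →
                ∀ {x y} → EqClosure R x y → f x ≡ f y
  ≡-eqClosure f inv = Eq.gfold isEquivalence f inv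

  record FiniteQuotient (R : Rel (Fin N) 0ℓ) : Set where
    field
      {size}  : ℕ
      class   : Fin N → Fin size
      member  : Fin size → Fin N
      section : ∀ c → class (member c) ≡ c
      sound   : ∀ {x y} → R x y → class x ≡ class y
      exact   : ∀ x y → class x ≡ class y → EqClosure R x y

  module _ {k} {a b : Fin (suc k)} (b≢a : b ≢ a) where

    identify : Fin (suc k) → Fin k
    identify i with b Fin.≟ i
    ... | yes _   = punchOut b≢a
    ... | no  b≢i = punchOut b≢i

    identify-≡ : identify a ≡ identify b
    identify-≡ with b Fin.≟ a | b Fin.≟ b
    ... | yes b≡a | _       = contradiction b≡a b≢a
    ... | no  _   | no b≢b  = contradiction refl b≢b
    ... | no  _   | yes _   = Fin.punchOut-cong b refl

    identify-exact : ∀ i j → identify i ≡ identify j →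
                     i ≡ j ⊎ (i ≡ b × j ≡ a) ⊎ (i ≡ a × j ≡ b)
    identify-exact i j eq with b Fin.≟ i | b Fin.≟ j
    ... | yes p | yes q = inj₁ (trans (sym p) q)
    ... | yes p | no  q = inj₂ (inj₁ (sym p , sym (Fin.punchOut-injective b≢a q eq)))
    ... | no  p | yes q = inj₂ (inj₂ (Fin.punchOut-injective p b≢a eq , sym q))
    ... | no  p | no  q = inj₁ (Fin.punchOut-injective p q eq)

    identify-punchIn : ∀ c → identify (punchIn b c) ≡ c
    identify-punchIn c with b Fin.≟ punchIn b c
    ... | yes p = contradiction (sym p) (Fin.punchInᵢ≢i b c)
    ... | no  q = Fin.punchOut-punchIn b

  Joined : (Fin M → Fin N) → (Fin M → Fin N) → Rel (Fin N) 0ℓ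
  Joined l r x y = ∃[ i ] (l i ≡ x × r i ≡ y)

  -- The generating pairs are processed one at a time as in union-find: each lies within a class
  -- already or merges two classes.
  quotient : (l r : Fin M → Fin N) → FiniteQuotient (Joined l r)
  quotient {zero} l r = record
    { class = λ x → x ; member = λ c → c ; section = λ _ → refl
    ; sound = λ { (() , _) } ; exact = λ { x .x refl → Eq.reflexive _ } }
  quotient {suc M} {N} l r = merge (quotient (l ∘ suc) (r ∘ suc))
    where
    R = Joined l r
    lift : ∀ {x y} → EqClosure (Joined (l ∘ suc) (r ∘ suc)) x y → EqClosure R x y
    lift = Eq.map λ (i , p) → suc i , p
    merge : FiniteQuotient (Joined (l ∘ suc) (r ∘ suc)) → FiniteQuotient R
    merge Q with FiniteQuotient.class Q (l zero) in la | FiniteQuotient.class Q (r zero) in rb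
    ... | a | b with b Fin.≟ a
    ...   | yes b≡a = record
      { class = class ; member = member ; section = section
      ; sound = λ { (zero , refl , refl) → trans la (trans (sym b≡a) (sym rb)) ; (suc i , p) → sound (i , p) }
      ; exact = λ x y → lift ∘ exact x y }
      where open FiniteQuotient Q
    ...   | no b≢a = mergeDistinct Q a b la rb b≢a
      where
      mergeDistinct : (Q : FiniteQuotient (Joined (l ∘ suc) (r ∘ suc))) →
                      let open FiniteQuotient Q in
                      ∀ a b → class (l zero) ≡ a → class (r zero) ≡ b → b ≢ a → FiniteQuotient R
      mergeDistinct record { size = suc k ; class = class ; member = member ; section = section
                           ; sound = sound ; exact = exact } a b la rb b≢a = record
        { class   = identify b≢a ∘ class
        ; member  = member ∘ punchIn b
        ; section = λ c → trans (cong (identify b≢a) (section (punchIn b c))) (identify-punchIn b≢a c)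
        ; sound   = λ { (zero , refl , refl) → trans (cong (identify b≢a) la)
                          (trans (identify-≡ b≢a) (cong (identify b≢a) (sym rb)))
                      ; (suc i , p) → cong (identify b≢a) (sound (i , p)) }
        ; exact   = λ x y eq → exact′ x y (identify-exact b≢a (class x) (class y) eq)
        }
        where
        l₀~r₀ : EqClosure R (l zero) (r zero)
        l₀~r₀ = Eq.return (zero , refl , refl)
        exact′ : ∀ x y → class x ≡ class y ⊎ (class x ≡ b × class y ≡ a) ⊎ (class x ≡ a × class y ≡ b) →
                 EqClosure R x y
        exact′ x y (inj₁ eq) = lift (exact x y eq)
        exact′ x y (inj₂ (inj₁ (xb , ya))) = Eq.transitive _ (lift (exact x (r zero) (trans xb (sym rb))))
          (Eq.transitive _ (Eq.symmetric _ l₀~r₀) (lift (exact (l zero) y (trans la (sym ya)))))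
        exact′ x y (inj₂ (inj₂ (xa , yb))) = Eq.transitive _ (lift (exact x (l zero) (trans xa (sym la))))
          (Eq.transitive _ l₀~r₀ (lift (exact (r zero) y (trans rb (sym yb)))))

  module _ {A : Set} (fin : Finite A) (σ τ : A → A) where
    open Finite fin renaming (size to ∣A∣)
    private
      to = Inverse.to enumeration
      from = Inverse.from enumeration
      from-to : ∀ x → from (to x) ≡ x
      from-to x = Inverse.strictlyInverseʳ enumeration x
      to-from : ∀ x → to (from x) ≡ x
      to-from x = Inverse.strictlyInverseˡ enumeration x

      moves : Fin (∣A∣ + ∣A∣) → Fin ∣A∣
      moves i = [ to ∘ σ ∘ from , to ∘ τ ∘ from ]′ (Fin.splitAt ∣A∣ i)

      starts : Fin (∣A∣ + ∣A∣) → Fin ∣A∣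
      starts i = [ (λ x → x) , (λ x → x) ]′ (Fin.splitAt ∣A∣ i)

      Step : Rel A 0ℓ
      Step a b = b ≡ σ a ⊎ b ≡ τ a

      Q : FiniteQuotient (Joined starts moves)
      Q = quotient starts moves

    open FiniteQuotient Q renaming (size to orbitCount) using () public

    orbitOf : A → Fin orbitCount
    orbitOf = FiniteQuotient.class Q ∘ to

    orbitOf-isOrbitMap : IsOrbitMap σ τ orbitOf
    orbitOf-isOrbitMap = record
      { surjective = strictlySurjective⇒surjective λ c → from (member c) ,
          trans (cong class (to-from (member c))) (section c)
      ; kernel = λ x y → mk⇔ (⇒ x y) (≡-eqClosure orbitOf invariant)
      }
      where
      open FiniteQuotient Q
      toStep : ∀ {x y} → Joined starts moves x y → EqClosure Step (from x) (from y)
      toStep (i , refl , refl) with Fin.splitAt ∣A∣ i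
      ... | inj₁ x = Eq.return (inj₁ (from-to _))
      ... | inj₂ x = Eq.return (inj₂ (from-to _))
      ⇒ : ∀ x y → orbitOf x ≡ orbitOf y → EqClosure Step x y
      ⇒ x y eq = subst₂ (EqClosure Step) (from-to x) (from-to y)
        (Eq.gfold (Eq.isEquivalence Step) from toStep (exact (to x) (to y) eq))
      invariant : ∀ {x y} → Step x y → orbitOf x ≡ orbitOf y
      invariant {x} (inj₁ refl) = sound (to x ↑ˡ ∣A∣ ,
        cong [ _ , _ ]′ (Fin.splitAt-↑ˡ ∣A∣ (to x) ∣A∣) ,
        trans (cong [ _ , _ ]′ (Fin.splitAt-↑ˡ ∣A∣ (to x) ∣A∣)) (cong (to ∘ σ) (from-to x)))
      invariant {x} (inj₂ refl) = sound (∣A∣ ↑ʳ to x ,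
        cong [ _ , _ ]′ (Fin.splitAt-↑ʳ ∣A∣ ∣A∣ (to x)) ,
        trans (cong [ _ , _ ]′ (Fin.splitAt-↑ʳ ∣A∣ ∣A∣ (to x))) (cong (to ∘ τ) (from-to x)))

    module _ {C : Set} (finC : Finite C) (f : A → C) (witness : C → A) (f-witness : ∀ c → f (witness c) ≡ c)
             (f-σ : ∀ x → f (σ x) ≡ f x) (f-τ : ∀ x → f (τ x) ≡ f x) where

      -- Elements with different values of an invariant lie in different orbits. The inequality
      -- points the right way for faces: an upper bound on the Euler genus asks for a lower bound on
      -- their number.
      invariant⇒orbitCount≥ : ∥ finC ∥ ≤ orbitCount
      invariant⇒orbitCount≥ = Fin.injective⇒≤ {f = orbitOf ∘ witness ∘ Inverse.from enumC} λ {i} {j} eq →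
        injective-from i j (trans (sym (f-witness _)) (trans
          (≡-eqClosure f step (Equivalence.to (IsOrbitMap.kernel orbitOf-isOrbitMap _ _) eq)) (f-witness _)))
        where
        enumC = Finite.enumeration finC
        step : ∀ {x y} → Step x y → f x ≡ f y
        step (inj₁ refl) = sym (f-σ _)
        step (inj₂ refl) = sym (f-τ _)
        injective-from : ∀ i j → Inverse.from enumC i ≡ Inverse.from enumC j → i ≡ j
        injective-from i j eq = trans (sym (Inverse.strictlyInverseˡ enumC i))
          (trans (cong (Inverse.to enumC) eq) (Inverse.strictlyInverseˡ enumC j))

  module _ {A B : Set} {σ τ : A → A} (π : A → B) (canon : B → A) where
    isOrbitMap : (∀ b → π (canon b) ≡ b) → (∀ x → π (σ x) ≡ π x) → (∀ x → π (τ x) ≡ π x) →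
                 (∀ x → EqClosure (λ a b → b ≡ σ a ⊎ b ≡ τ a) x (canon (π x))) → IsOrbitMap σ τ π
    isOrbitMap π-canon π-σ π-τ toCanon = record
      { surjective = strictlySurjective⇒surjective λ b → canon b , π-canon b
      ; kernel = λ x y → mk⇔
          (λ eq → Eq.transitive _ (toCanon x) (subst (λ b → EqClosure _ (canon b) y) (sym eq) (Eq.symmetric _ (toCanon y))))
          (≡-eqClosure π λ { (inj₁ refl) → sym (π-σ _) ; (inj₂ refl) → sym (π-τ _) })
      }

open Quotients

-- The surfaces and the map graphs drawn on them

module Surfaces where

  finite-Fin : ∀ n → Finite (Fin n)
  finite-Fin n = record { size = n ; enumeration = ↔-id (Fin n) }

  finite-Bool : Finite Bool
  finite-Bool = record { size = 2 ; enumeration = ↔-sym Fin.2↔Bool }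

  infixr 2 _×-finite_
  infixr 1 _⊎-finite_

  opaque

    ×-enumeration : {A B : Set} {k l : ℕ} → A ↔ Fin k → B ↔ Fin l → (A × B) ↔ Fin (k * l)
    ×-enumeration {k = k} {l} f g = ↔-sym (Fin.*↔× {k} {l}) ↔-∘ (f ×-↔ g)

    ⊎-enumeration : {A B : Set} {k l : ℕ} → A ↔ Fin k → B ↔ Fin l → (A ⊎ B) ↔ Fin (k + l)
    ⊎-enumeration {k = k} {l} f g = ↔-sym (Fin.+↔⊎ {k} {l}) ↔-∘ (f ⊎-↔ g)

  _×-finite_ : {A B : Set} → Finite A → Finite B → Finite (A × B)
  fa ×-finite fb = record
    { size = ∥ fa ∥ * ∥ fb ∥ ; enumeration = ×-enumeration (Finite.enumeration fa) (Finite.enumeration fb) }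

  _⊎-finite_ : {A B : Set} → Finite A → Finite B → Finite (A ⊎ B)
  fa ⊎-finite fb = record
    { size = ∥ fa ∥ + ∥ fb ∥ ; enumeration = ⊎-enumeration (Finite.enumeration fa) (Finite.enumeration fb) }

  finite⇒≟ : {A : Set} → Finite A → DecidableEquality A
  finite⇒≟ fin x y = map′ injective (cong to) (to x Fin.≟ to y)
    where
    open Inverse (Finite.enumeration fin)
    injective : to x ≡ to y → x ≡ y
    injective eq = trans (sym (strictlyInverseʳ x)) (trans (cong from eq) (strictlyInverseʳ y))

  atMost-image : ∀ {d} {A B : Set} {P : A → Set} (fin : Finite B) → ∥ fin ∥ ≤ d → (f : B → A) →
                 (∀ a → P a → ∃[ b ] f b ≡ a) → AtMost d P
  atMost-image fin le f cover = List.tabulate (f ∘ from) ,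
    ≤-trans (≤-reflexive (List.length-tabulate (f ∘ from))) le ,
    λ a p → let (b , eq) = cover a p in
      subst (List._∈ List.tabulate (f ∘ from)) (trans (cong f (strictlyInverseʳ b)) eq) (∈-tabulate⁺ (to b))
    where open Inverse (Finite.enumeration fin)

  lower : ∀ {m} → Fin (suc m) → Maybe (Fin m)
  lower {zero}  _       = nothing
  lower {suc m} zero    = just zero
  lower {suc m} (suc p) = Maybe.map suc (lower p)

  lower-inject₁ : ∀ {m} (i : Fin m) → lower (inject₁ i) ≡ just i
  lower-inject₁ zero    = refl
  lower-inject₁ (suc i) = cong (Maybe.map suc) (lower-inject₁ i)

  lower-just : ∀ {m} (p : Fin (suc m)) {i} → lower p ≡ just i → p ≡ inject₁ i
  lower-just {suc m} zero    refl = refl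
  lower-just {suc m} (suc p) eq with lower p in eq′
  lower-just {suc m} (suc p) refl | just i = cong suc (lower-just p eq′)

  lower-fromℕ : ∀ m → lower (fromℕ m) ≡ nothing
  lower-fromℕ zero    = refl
  lower-fromℕ (suc m) = cong (Maybe.map suc) (lower-fromℕ m)

  module Segment {m : ℕ} where

    -- The cells of a row are Fin (suc m), separated by the points Fin m; wall p e
    -- is the point bounding the cell p at its upper (e = true) or lower end.
    wall : Fin (suc m) → Bool → Maybe (Fin m)
    wall p       true  = lower p
    wall zero    false = nothing
    wall (suc i) false = just i

    cell : Fin m → Bool → Fin (suc m)
    cell i true  = inject₁ i
    cell i false = suc i

    extreme : Bool → Fin (suc m)
    extreme true  = fromℕ m
    extreme false = zero

    wall-cell : ∀ i e → wall (cell i e) e ≡ just i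
    wall-cell i true  = lower-inject₁ i
    wall-cell i false = refl

    cell-wall : ∀ p e {i} → wall p e ≡ just i → p ≡ cell i e
    cell-wall p       true  eq   = lower-just p eq
    cell-wall (suc i) false refl = refl

    wall-extreme : ∀ e → wall (extreme e) e ≡ nothing
    wall-extreme true  = lower-fromℕ m
    wall-extreme false = refl

  open Segment

  pattern horizontal = false
  pattern vertical   = true
  pattern low        = false
  pattern high       = true
  pattern hub        = false
  pattern mid        = true
  pattern inner      = false
  pattern outer      = true

  -- Pieces are indexed by Σ₀.  Each consists of two sheets (Bool), each a square
  -- grid of suc m × suc m hubs; glue a e matches up the sides of the pieces at end e
  -- of axis a.  The colour of a hub is its sheet plus the parity of its position,
  -- so that every edge joins hubs of different colours.
  module Pieces (m : ℕ) {Σ₀ : Set} (glue : Bool → Bool → Σ₀ → Σ₀)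
                (glue-involutive : ∀ a e → Involutive _≡_ (glue a e)) where

    -- `Base` consists of the flags of the graph of hubs: an axis, the colour and the piece of a
    -- hub, its position along the axis with a direction, and its position across the axis with a
    -- side of the link. A `Dart` is the part of this that moves along the axis.
    Cell Dart Hub Base Link : Set
    Cell = Fin (suc m)
    Dart = Σ₀ × (Cell × Bool)
    Hub  = Bool × Σ₀ × Cell × Cell
    Base = Bool × Bool × Σ₀ × (Cell × Bool) × (Cell × Bool)
    Link = Bool × Dart × Cell

    -- Inside a piece a dart moves on to the next cell and is turned around. At a side it keeps its
    -- cell and its end. Since `β₀` flips the colour, a move with unchanged position changes the
    -- sheet, so that each side is glued to the opposite sheet of its partner.
    crossVia : Bool → Σ₀ → Cell → Bool → Maybe (Fin m) → Dart
    crossVia a σ p e (just i) = σ , cell i (not e) , not e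
    crossVia a σ p e nothing  = glue a e σ , p , e

    cross : Bool → Dart → Dart
    cross a (σ , p , e) = crossVia a σ p e (wall p e)

    cross-just : ∀ a σ p e {i} → wall p e ≡ just i → cross a (σ , p , e) ≡ (σ , cell i (not e) , not e)
    cross-just a σ p e eq = cong (crossVia a σ p e) eq

    cross-nothing : ∀ a σ p e → wall p e ≡ nothing → cross a (σ , p , e) ≡ (glue a e σ , p , e)
    cross-nothing a σ p e eq = cong (crossVia a σ p e) eq

    cross-involutive : ∀ a → Involutive _≡_ (cross a)
    cross-involutive a (σ , p , e) with wall p e in eq
    ... | nothing = trans (cross-nothing a (glue a e σ) p e eq)
                          (cong (_, p , e) (glue-involutive a e σ))
    ... | just i  = trans (cross-just a σ (cell i (not e)) (not e) (wall-cell i (not e)))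
                          (cong (σ ,_) (cong₂ _,_ (trans (cong (cell i) (not-involutive e)) (sym (cell-wall p e eq)))
                                (not-involutive e)))

    -- The flag involutions of the graph of hubs: to the other end of the link, across the corner to
    -- the perpendicular link, and to the other side of the link.
    β₀ β₁ β₂ : Base → Base
    β₀ (a , b , σ , P , Q) = let (σ′ , P′) = cross a (σ , P) in a , not b , σ′ , P′ , Q
    β₁ (a , b , σ , P , Q) = not a , b , σ , Q , P
    β₂ (a , b , σ , P , (q , e)) = a , b , σ , P , (q , not e)

    β₀-involutive : Involutive _≡_ β₀
    β₀-involutive (a , b , σ , P , Q) rewrite not-involutive b | cross-involutive a (σ , P) = refl

    β₁-involutive : Involutive _≡_ β₁
    β₁-involutive (a , b , σ , P , Q) rewrite not-involutive a = refl

    β₂-involutive : Involutive _≡_ β₂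
    β₂-involutive (a , b , σ , P , (q , e)) rewrite not-involutive e = refl

    place : Bool → Cell → Cell → Cell × Cell
    place horizontal p q = p , q
    place vertical   p q = q , p

    hubOf : Base → Hub
    hubOf (a , b , σ , (p , _) , (q , _)) = b , σ , place a p q

    colour side : Base → Bool
    colour (a , b , σ , P , Q) = b
    side   (a , b , σ , P , (q , e)) = e

    -- A link is recorded by its dart at the hub of colour false.
    recolour : Bool → Bool → Dart → Dart
    recolour false a d = d
    recolour true  a d = cross a d

    recolour-involutive : ∀ b a → Involutive _≡_ (recolour b a)
    recolour-involutive false a d = refl
    recolour-involutive true  a d = cross-involutive a d

    linkOf : Base → Link
    linkOf (a , b , σ , P , (q , _)) = a , recolour b a (σ , P) , q

    flagAt : Link → Bool → Bool → Base
    flagAt (a , d , q) b e = let (σ , P) = recolour b a d in a , b , σ , P , (q , e)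

    linkOf-flagAt : ∀ l b e → linkOf (flagAt l b e) ≡ l
    linkOf-flagAt (a , d , q) b e = cong (λ d → a , d , q) (recolour-involutive b a d)

    flagAt-linkOf : ∀ x → flagAt (linkOf x) (colour x) (side x) ≡ x
    flagAt-linkOf (a , b , σ , P , (q , e)) =
      cong (λ (σ , P) → a , b , σ , P , (q , e)) (recolour-involutive b a (σ , P))

    recolour-cross : ∀ b a d → recolour (not b) a (cross a d) ≡ recolour b a d
    recolour-cross false a d = cross-involutive a d
    recolour-cross true  a d = refl

    linkOf-β₀ : ∀ x → linkOf (β₀ x) ≡ linkOf x
    linkOf-β₀ (a , b , σ , P , (q , e)) = cong (λ d → a , d , q) (recolour-cross b a (σ , P))

    β₀-flagAt : ∀ l b e → β₀ (flagAt l b e) ≡ flagAt l (not b) e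
    β₀-flagAt (a , d , q) false e = refl
    β₀-flagAt (a , d , q) true  e = cong (λ (σ , P) → a , false , σ , P , (q , e)) (cross-involutive a d)

    hubOf-β₁ : ∀ x → hubOf (β₁ x) ≡ hubOf x
    hubOf-β₁ (horizontal , b , σ , P , Q) = refl
    hubOf-β₁ (vertical   , b , σ , P , Q) = refl

    hubAt : Bool → Link → Hub
    hubAt b l = hubOf (flagAt l b low)

    hubAt-linkOf : ∀ x → hubAt (colour x) (linkOf x) ≡ hubOf x
    hubAt-linkOf x@(a , b , σ , P , (q , e)) =
      cong (λ (σ , (p , _)) → b , σ , place a p q) (recolour-involutive b a (σ , P))

    corner : Hub → Base
    corner (b , σ , p , q) = horizontal , b , σ , (p , low) , (q , low)

    -- The relation is left general because there are two uses: the vertex orbits of the strips,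
    -- where `β₁` and `β₂` stand for sequences of flag moves, and the connectedness of the graph of
    -- hubs.
    hubOf⇒corner : ∀ {ℓ} (_~_ : Rel Base ℓ) → IsEquivalence _~_ → (∀ x → x ~ β₁ x) → (∀ x → x ~ β₂ x) →
                   ∀ x → x ~ corner (hubOf x)
    hubOf⇒corner _~_ eqv ~β₁ ~β₂ = go
      where
      open IsEquivalence eqv renaming (trans to ~trans)
      turned : ∀ {b σ p q} e → (horizontal , b , σ , (p , e) , (q , low)) ~ corner (b , σ , p , q)
      turned low  = IsEquivalence.refl eqv
      turned high = ~trans (~β₁ _) (~trans (~β₂ _) (~β₁ _))
      go : ∀ x → x ~ corner (hubOf x)
      go (horizontal , b , σ , (p , e) , (q , low))  = turned e
      go (horizontal , b , σ , (p , e) , (q , high)) = ~trans (~β₂ _) (turned e)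
      go (vertical   , b , σ , (p , low)  , (q , e)) = ~trans (~β₁ _) (turned e)
      go (vertical   , b , σ , (p , high) , (q , e)) = ~trans (~β₁ _) (~trans (~β₂ _) (turned e))

    opposite-inject₁ : ∀ {n} (j : Fin n) → opposite (inject₁ j) ≡ suc (opposite j)
    opposite-inject₁ {suc n} zero    = refl
    opposite-inject₁ {suc n} (suc j) = cong inject₁ (opposite-inject₁ j)

    module Strips (r′ : ℕ) (finΣ : Finite Σ₀) (σ₀ : Σ₀)
                  (zipped : ∀ σ → glue vertical low σ ≡ σ)
                  (linked : ∀ σ τ → EqClosure (λ σ τ → ∃₂ λ a e → τ ≡ glue a e σ) σ τ) where

      r : ℕ
      r = suc r′

      Nation Side Flag : Set
      Nation = Link × Fin r
      Side   = Base × Fin r × Bool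
      Flag   = Side × Bool

      flip? : ∀ {n} → Bool → Fin n → Fin n
      flip? low  j = j
      flip? high j = opposite j

      flip?-not : ∀ {n} e (j : Fin n) → flip? (not e) (opposite j) ≡ flip? e j
      flip?-not low  j = Fin.opposite-involutive j
      flip?-not high j = refl

      -- The link of x is replaced by r nations, the j-th one counted from the side
      -- of x; each is bounded by two paths of length two with their own midpoints.
      -- ((x , j , t) , o) is a flag on the path of nation j nearest to x, at the half
      -- of the link where x ends, at its end t, facing into (o = inner) or
      -- out of (o = outer) that nation.
      along across turn : Side → Side
      along (x , j , t) = x , j , not t
      across (x , j , mid) = β₀ x , j , mid
      across (x , j , hub) = β₂ x , opposite j , hub
      turn (x , j     , mid) = β₀ x , j , mid
      turn (x , zero  , hub) = β₁ x , zero , hub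
      turn (x , suc j , hub) = β₂ x , opposite (inject₁ j) , hub

      τ₀ τ₁ τ₂ : Flag → Flag
      τ₀ (y , o)     = along y , o
      τ₁ (y , inner) = across y , inner
      τ₁ (y , outer) = turn y , outer
      τ₂ (y , o)     = y , not o

      across-involutive : Involutive _≡_ across
      across-involutive (x , j , mid) = cong (_, j , mid) (β₀-involutive x)
      across-involutive (x , j , hub) = cong₂ (λ x j → x , j , hub) (β₂-involutive x) (Fin.opposite-involutive j)

      turn-involutive : Involutive _≡_ turn
      turn-involutive (x , j     , mid) = cong (_, j , mid) (β₀-involutive x)
      turn-involutive (x , zero  , hub) = cong (_, zero , hub) (β₁-involutive x)
      turn-involutive (x , suc j , hub) rewrite opposite-inject₁ j =
        cong₂ (λ x j → x , j , hub) (β₂-involutive x)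
          (trans (opposite-inject₁ (opposite j)) (cong suc (Fin.opposite-involutive j)))

      not-free : ∀ b → not b ≢ b
      not-free b eq = not-¬ refl (sym eq)

      -- The midpoints make the drawn graph simple. Each of them touches a single nation, so
      -- distinct nations share only hubs.
      Mid Vertex : Set
      Mid    = Link × Bool × Fin r
      Vertex = Hub ⊎ Mid

      vertexOf : Flag → Vertex
      vertexOf ((x , j , hub) , o) = inj₁ (hubOf x)
      vertexOf ((x , j , mid) , o) = inj₂ (linkOf x , side x , j)

      Around : Rel Flag 0ℓ
      Around = EqClosure (λ a b → b ≡ τ₁ a ⊎ b ≡ τ₂ a)

      around-τ₁ : ∀ x → Around x (τ₁ x)
      around-τ₁ x = Eq.return (inj₁ refl)

      around-τ₂ : ∀ x → Around x (τ₂ x)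
      around-τ₂ x = Eq.return (inj₂ refl)

      infixr 5 _▸_
      _▸_ : ∀ {x y z} → Around x y → Around y z → Around x z
      _▸_ = Eq.transitive _

      facing : ∀ y o o′ → Around (y , o) (y , o′)
      facing y inner inner = Eq.reflexive _
      facing y inner outer = around-τ₂ _
      facing y outer inner = around-τ₂ _
      facing y outer outer = Eq.reflexive _

      -- Around a hub, crossing the digon next to nation `suc j` and then the nation behind it
      -- lowers the index by one.
      outermost : ∀ x j → Around ((x , j , hub) , outer) ((x , zero , hub) , outer)
      outermost x = <-weakInduction _ (Eq.reflexive _) λ j ih →
        around-τ₁ _ ▸ facing _ outer inner ▸ around-τ₁ _ ▸ facing _ inner outer ▸
        subst (λ y → Around (y , outer) ((x , zero , hub) , outer)) (sym (across-involutive (x , inject₁ j , hub))) ih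

      canonVertex : Vertex → Flag
      canonVertex (inj₁ h) = (corner h , zero , hub) , outer
      canonVertex (inj₂ (l , e , j)) = (flagAt l false e , j , mid) , outer

      toCanonVertex : ∀ x → Around x (canonVertex (vertexOf x))
      toCanonVertex ((x , j , hub) , o) = facing _ o outer ▸ outermost x j ▸
        hubOf⇒corner (λ x y → Around ((x , zero , hub) , outer) ((y , zero , hub) , outer))
          (record { refl = Eq.reflexive _ ; sym = Eq.symmetric _ ; trans = Eq.transitive _ })
          (λ x → around-τ₁ _)
          (λ x → facing _ outer inner ▸ around-τ₁ _ ▸ facing _ inner outer ▸ outermost (β₂ x) _) x
      toCanonVertex ((x , j , mid) , o) = facing _ o outer ▸ byColour (colour x) refl
        where
        byColour : ∀ b → colour x ≡ b → Around ((x , j , mid) , outer) (canonVertex (inj₂ (linkOf x , side x , j)))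
        byColour false eq = subst (λ y → Around ((y , j , mid) , outer) (canonVertex (inj₂ (linkOf x , side x , j))))
          (trans (cong (λ b → flagAt (linkOf x) b (side x)) (sym eq)) (flagAt-linkOf x)) (Eq.reflexive _)
        byColour true eq = around-τ₁ _ ▸ subst (λ y → Around ((y , j , mid) , outer) (canonVertex (inj₂ (linkOf x , side x , j))))
          (sym (trans (cong β₀ (trans (sym (flagAt-linkOf x)) (cong (λ b → flagAt (linkOf x) b (side x)) eq)))
                      (β₀-flagAt (linkOf x) true (side x)))) (Eq.reflexive _)

      vertexOf-orbits : IsOrbitMap τ₁ τ₂ vertexOf
      vertexOf-orbits = isOrbitMap vertexOf canonVertex
        (λ { (inj₁ h) → refl ; (inj₂ (l , e , j)) → cong (λ l → inj₂ (l , e , j)) (linkOf-flagAt l false e) })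
        (λ { ((x , j     , hub) , inner) → refl
           ; ((x , zero  , hub) , outer) → cong inj₁ (hubOf-β₁ x)
           ; ((x , suc j , hub) , outer) → refl
           ; ((x , j     , mid) , inner) → cong (λ l → inj₂ (l , side x , j)) (linkOf-β₀ x)
           ; ((x , j     , mid) , outer) → cong (λ l → inj₂ (l , side x , j)) (linkOf-β₀ x) })
        (λ { ((x , j , hub) , o) → refl ; ((x , j , mid) , o) → refl })
        toCanonVertex

      Edge : Set
      Edge = Base × Fin r

      edgeOf : Flag → Edge
      edgeOf ((x , j , t) , o) = x , j

      edgeOf-orbits : IsOrbitMap τ₀ τ₂ edgeOf
      edgeOf-orbits = isOrbitMap edgeOf (λ (x , j) → (x , j , hub) , inner)
        (λ _ → refl) (λ _ → refl) (λ _ → refl)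
        λ { ((x , j , hub) , inner) → Eq.reflexive _
          ; ((x , j , hub) , outer) → Eq.return (inj₂ refl)
          ; ((x , j , mid) , inner) → Eq.return (inj₁ refl)
          ; ((x , j , mid) , outer) → Eq.transitive _ (Eq.return (inj₂ refl)) (Eq.return (inj₁ refl)) }

      nationOf : Side → Nation
      nationOf (x , j , t) = linkOf x , flip? (side x) j

      nationOf-orbits : IsOrbitMap along across nationOf
      nationOf-orbits = isOrbitMap nationOf (λ (l , j) → flagAt l false low , j , mid)
        (λ (l , j) → cong (_, j) (linkOf-flagAt l false low))
        (λ _ → refl)
        (λ { (x , j , hub) → cong (linkOf x ,_) (flip?-not (side x) j)
           ; (x , j , mid) → cong (_, flip? (side x) j) (linkOf-β₀ x) })
        toCanon
        where
        Round : Rel Side 0ℓ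
        Round = EqClosure (λ a b → b ≡ along a ⊎ b ≡ across a)
        canon : Nation → Side
        canon (l , j) = flagAt l false low , j , mid
        canon₀ : ∀ l e j → Round (flagAt l false e , j , mid) (flagAt l false low , flip? e j , mid)
        canon₀ l low  j = Eq.reflexive _
        canon₀ l high j = Eq.transitive _ (Eq.return (inj₁ refl))
          (Eq.transitive _ (Eq.return (inj₂ refl)) (Eq.return (inj₁ refl)))
        canon⇐ : ∀ l b e j → Round (flagAt l b e , j , mid) (flagAt l false low , flip? e j , mid)
        canon⇐ l false e j = canon₀ l e j
        canon⇐ l true e j = Eq.transitive _ (Eq.return (inj₂ refl))
          (subst (λ x → Round (x , j , mid) (flagAt l false low , flip? e j , mid)) (sym (β₀-flagAt l true e)) (canon₀ l e j))
        mid⇐ : ∀ x j → Round (x , j , mid) (canon (nationOf (x , j , mid)))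
        mid⇐ x j = subst (λ y → Round (y , j , mid) (canon (nationOf (x , j , mid)))) (flagAt-linkOf x)
          (canon⇐ (linkOf x) (colour x) (side x) j)
        toCanon : ∀ y → Round y (canon (nationOf y))
        toCanon (x , j , mid) = mid⇐ x j
        toCanon (x , j , hub) = Eq.transitive _ (Eq.return (inj₁ refl)) (mid⇐ x j)

      fin-Dart : Finite Dart
      fin-Dart = finΣ ×-finite finite-Fin (suc m) ×-finite finite-Bool

      fin-Base : Finite Base
      fin-Base = finite-Bool ×-finite finite-Bool ×-finite finΣ ×-finite
                 (finite-Fin (suc m) ×-finite finite-Bool) ×-finite (finite-Fin (suc m) ×-finite finite-Bool)

      fin-Link : Finite Link
      fin-Link = finite-Bool ×-finite fin-Dart ×-finite finite-Fin (suc m)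

      fin-Hub : Finite Hub
      fin-Hub = finite-Bool ×-finite finΣ ×-finite finite-Fin (suc m) ×-finite finite-Fin (suc m)

      fin-Nation : Finite Nation
      fin-Nation = fin-Link ×-finite finite-Fin r

      fin-Side : Finite Side
      fin-Side = fin-Base ×-finite finite-Fin r ×-finite finite-Bool

      fin-Vertex : Finite Vertex
      fin-Vertex = fin-Hub ⊎-finite (fin-Link ×-finite finite-Bool ×-finite finite-Fin r)

      fin-Edge : Finite Edge
      fin-Edge = fin-Base ×-finite finite-Fin r

      lakeCount : ℕ
      lakeCount = orbitCount fin-Side along turn

      -- The walks around nations are known beforehand. The outer flags are left to the general
      -- orbit construction, as their orbits depend on how the pieces are glued.
      Walk : Set
      Walk = Nation ⊎ Fin lakeCount

      fin-Walk : Finite Walk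
      fin-Walk = fin-Nation ⊎-finite finite-Fin lakeCount

      walkOf : Flag → Walk
      walkOf (y , inner) = inj₁ (nationOf y)
      walkOf (y , outer) = inj₂ (orbitOf fin-Side along turn y)

      walkOf-orbits : IsOrbitMap τ₀ τ₁ walkOf
      walkOf-orbits = record
        { surjective = strictlySurjective⇒surjective λ
            { (inj₁ ν) → let (y , eq) = surj nationOf-orbits ν in (y , inner) , cong inj₁ eq
            ; (inj₂ c) → let (y , eq) = surj lake-orbits c in (y , outer) , cong inj₂ eq }
        ; kernel = λ x y → mk⇔ (⇒ x y)
            (≡-eqClosure walkOf λ { (inj₁ refl) → invariant₀ _ ; (inj₂ refl) → invariant₁ _ })
        }
        where
        surj : ∀ {A B : Set} {σ τ : A → A} {π : A → B} → IsOrbitMap σ τ π → ∀ b → ∃[ a ] π a ≡ b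
        surj orb b = let (a , f) = IsOrbitMap.surjective orb b in a , f refl
        lake-orbits : IsOrbitMap along turn (orbitOf fin-Side along turn)
        lake-orbits = orbitOf-isOrbitMap fin-Side along turn
        open module N y z = Equivalence (IsOrbitMap.kernel nationOf-orbits y z) using () renaming (to to toN; from to fromN)
        open module L y z = Equivalence (IsOrbitMap.kernel lake-orbits y z) using () renaming (to to toL; from to fromL)
        ⇒ : ∀ x y → walkOf x ≡ walkOf y → EqClosure (λ a b → b ≡ τ₀ a ⊎ b ≡ τ₁ a) x y
        ⇒ (y , inner) (z , inner) eq = Eq.gmap (_, inner) (Sum.map (cong (_, inner)) (cong (_, inner))) (toN y z (Sum.inj₁-injective eq))
        ⇒ (y , outer) (z , outer) eq = Eq.gmap (_, outer) (Sum.map (cong (_, outer)) (cong (_, outer))) (toL y z (Sum.inj₂-injective eq))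
        invariant₀ : ∀ x → walkOf x ≡ walkOf (τ₀ x)
        invariant₀ (y , inner) = cong inj₁ (fromN y (along y) (Eq.return (inj₁ refl)))
        invariant₀ (y , outer) = cong inj₂ (fromL y (along y) (Eq.return (inj₁ refl)))
        invariant₁ : ∀ x → walkOf x ≡ walkOf (τ₁ x)
        invariant₁ (y , inner) = cong inj₁ (fromN y (across y) (Eq.return (inj₂ refl)))
        invariant₁ (y , outer) = cong inj₂ (fromL y (turn y) (Eq.return (inj₂ refl)))

      -- Besides the faces of the graph of hubs there are `r′` digons between consecutive nations of
      -- a link. The summand `Bool × Bool` has four elements in total and not four per piece: the
      -- number of lakes at corners varies with the gluing, but these four occur in every gluing.
      Digon Lake : Set
      Digon = Link × Fin r′
      Lake  = ((Σ₀ × Fin m × Fin m × Bool) ⊎ (Bool × Bool × Fin m × Σ₀) ⊎ (Bool × Bool)) ⊎ Digon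

      fin-Lake : Finite Lake
      fin-Lake = ((finΣ ×-finite finite-Fin m ×-finite finite-Fin m ×-finite finite-Bool) ⊎-finite
                  (finite-Bool ×-finite finite-Bool ×-finite finite-Fin m ×-finite finΣ) ⊎-finite
                  (finite-Bool ×-finite finite-Bool)) ⊎-finite
                 (fin-Link ×-finite finite-Fin r′)

      -- An invariant of the lakes: the point of the piece around which a lake lies,
      -- and enough of the sheets meeting there to tell the lakes apart, except at
      -- the corners of the piece.
      pointVia : Bool → Σ₀ → Bool → Bool → Maybe (Fin m) → Maybe (Fin m) →
                 (Σ₀ × Fin m × Fin m × Bool) ⊎ (Bool × Bool × Fin m × Σ₀) ⊎ (Bool × Bool)
      pointVia b σ e e′ (just i) (just j) = inj₁ (σ , i , j , b xor (e xor e′))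
      pointVia b σ e e′ (just i) nothing  =
        inj₂ (inj₁ (vertical , e′ , i , (if b xor e then σ else glue vertical e′ σ)))
      pointVia b σ e e′ nothing  (just j) =
        inj₂ (inj₁ (horizontal , e , j , (if b xor e′ then σ else glue horizontal e σ)))
      pointVia b σ e e′ nothing  nothing  = inj₂ (inj₂ (e , e′))

      pointOf : Base → (Σ₀ × Fin m × Fin m × Bool) ⊎ (Bool × Bool × Fin m × Σ₀) ⊎ (Bool × Bool)
      pointOf (horizontal , b , σ , (p , e) , (q , e′)) = pointVia b σ e e′ (wall p e) (wall q e′)
      pointOf (vertical   , b , σ , (p , e) , (q , e′)) = pointVia b σ e′ e (wall q e′) (wall p e)

      pointOf-β₁ : ∀ x → pointOf (β₁ x) ≡ pointOf x
      pointOf-β₁ (horizontal , _) = refl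
      pointOf-β₁ (vertical   , _) = refl

      xor-not-not : ∀ b e e′ → not b xor (not e xor e′) ≡ b xor (e xor e′)
      xor-not-not false false e′ = not-involutive e′
      xor-not-not false true  e′ = refl
      xor-not-not true  false e′ = refl
      xor-not-not true  true  e′ = sym (not-involutive e′)

      xor-not-not′ : ∀ b e e′ → not b xor (e xor not e′) ≡ b xor (e xor e′)
      xor-not-not′ false false e′ = not-involutive e′
      xor-not-not′ false true  e′ = not-involutive (not e′)
      xor-not-not′ true  false e′ = refl
      xor-not-not′ true  true  e′ = refl

      not-xor-not : ∀ b e → not b xor not e ≡ b xor e
      not-xor-not false e = not-involutive e
      not-xor-not true  e = refl

      if-glue : ∀ a e (c : Bool) σ → (if not c then glue a e σ else glue a e (glue a e σ)) ≡ (if c then σ else glue a e σ)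
      if-glue a e false σ = refl
      if-glue a e true  σ = glue-involutive a e σ

      not-xor : ∀ b e → not b xor e ≡ not (b xor e)
      not-xor false e = refl
      not-xor true  e = sym (not-involutive e)

      -- At an interior point each step flips the colour and one of the two ends. At a side point, a
      -- step along the side flips `b` and `e`, and a step over it flips `b` and passes to the
      -- partner piece. Hence `b xor e` tells the two sheets apart that meet there, and the piece
      -- whose sheet has the value `true` is constant around the lake.
      pointOf-β₀ : ∀ x → pointOf (β₀ x) ≡ pointOf x
      pointOf-β₀ (horizontal , b , σ , (p , e) , (q , e′)) with wall p e in eq
      ... | just i rewrite wall-cell i (not e) = lemma (wall q e′)
        where
        lemma : ∀ w → pointVia (not b) σ (not e) e′ (just i) w ≡ pointVia b σ e e′ (just i) w
        lemma (just j) = cong (λ c → inj₁ (σ , i , j , c)) (xor-not-not b e e′)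
        lemma nothing  = cong (λ c → inj₂ (inj₁ (vertical , e′ , i , (if c then σ else glue vertical e′ σ)))) (not-xor-not b e)
      ... | nothing rewrite eq = lemma (wall q e′)
        where
        lemma : ∀ w → pointVia (not b) (glue horizontal e σ) e e′ nothing w ≡ pointVia b σ e e′ nothing w
        lemma (just j) = cong (λ τ → inj₂ (inj₁ (horizontal , e , j , τ)))
          (trans (cong (if_then glue horizontal e σ else glue horizontal e (glue horizontal e σ)) (not-xor b e′))
                 (if-glue horizontal e (b xor e′) σ))
        lemma nothing  = refl
      pointOf-β₀ (vertical , b , σ , (p , e) , (q , e′)) with wall p e in eq
      ... | just i rewrite wall-cell i (not e) = lemma (wall q e′)
        where
        lemma : ∀ w → pointVia (not b) σ e′ (not e) w (just i) ≡ pointVia b σ e′ e w (just i)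
        lemma (just j) = cong (λ c → inj₁ (σ , j , i , c)) (xor-not-not′ b e′ e)
        lemma nothing  = cong (λ c → inj₂ (inj₁ (horizontal , e′ , i , (if c then σ else glue horizontal e′ σ)))) (not-xor-not b e)
      ... | nothing rewrite eq = lemma (wall q e′)
        where
        lemma : ∀ w → pointVia (not b) (glue vertical e σ) e′ e w nothing ≡ pointVia b σ e′ e w nothing
        lemma (just j) = cong (λ τ → inj₂ (inj₁ (vertical , e , j , τ)))
          (trans (cong (if_then glue vertical e σ else glue vertical e (glue vertical e σ)) (not-xor b e′))
                 (if-glue vertical e (b xor e′) σ))
        lemma nothing  = refl

      lakeOf : Side → Lake
      lakeOf (x , zero  , t) = inj₁ (pointOf x)
      lakeOf (x , suc j , t) = inj₂ (linkOf x , flip? (side x) j)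

      lakeOf-turn : ∀ y → lakeOf (turn y) ≡ lakeOf y
      lakeOf-turn (x , zero  , mid) = cong inj₁ (pointOf-β₀ x)
      lakeOf-turn (x , suc j , mid) = cong (λ l → inj₂ (l , flip? (side x) j)) (linkOf-β₀ x)
      lakeOf-turn (x , zero  , hub) = cong inj₁ (pointOf-β₁ x)
      lakeOf-turn (x , suc j , hub) rewrite opposite-inject₁ j =
        cong (λ j → inj₂ (linkOf x , j)) (flip?-not (side x) j)

      lakeOf-along : ∀ y → lakeOf (along y) ≡ lakeOf y
      lakeOf-along (x , zero  , t) = refl
      lakeOf-along (x , suc j , t) = refl

      shore : Lake → Side
      shore (inj₁ (inj₁ (σ , i , j , c))) = (horizontal , c , σ , (cell i high , high) , (cell j high , high)) , zero , hub
      shore (inj₁ (inj₂ (inj₁ (vertical , e , i , σ)))) =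
        (horizontal , false , σ , (cell i high , high) , (extreme e , e)) , zero , hub
      shore (inj₁ (inj₂ (inj₁ (horizontal , e , i , σ)))) =
        (horizontal , false , σ , (extreme e , e) , (cell i high , high)) , zero , hub
      shore (inj₁ (inj₂ (inj₂ (e , e′)))) = (horizontal , false , σ₀ , (extreme e , e) , (extreme e′ , e′)) , zero , hub
      shore (inj₂ (l , j)) = flagAt l false low , suc j , hub

      lakeOf-shore : ∀ c → lakeOf (shore c) ≡ c
      lakeOf-shore (inj₁ (inj₁ (σ , i , j , c))) rewrite lower-inject₁ i | lower-inject₁ j =
        cong (λ c → inj₁ (inj₁ (σ , i , j , c))) (xor-identityʳ c)
      lakeOf-shore (inj₁ (inj₂ (inj₁ (vertical , e , i , σ)))) rewrite lower-inject₁ i | wall-extreme {m} e = refl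
      lakeOf-shore (inj₁ (inj₂ (inj₁ (horizontal , e , i , σ)))) rewrite lower-inject₁ i | wall-extreme {m} e = refl
      lakeOf-shore (inj₁ (inj₂ (inj₂ (e , e′)))) rewrite wall-extreme {m} e | wall-extreme {m} e′ = refl
      lakeOf-shore (inj₂ (l , j)) = cong (λ l → inj₂ (l , j)) (linkOf-flagAt l false low)

      lakes≤lakeCount : ∥ fin-Lake ∥ ≤ lakeCount
      lakes≤lakeCount = invariant⇒orbitCount≥ fin-Side along turn fin-Lake lakeOf shore lakeOf-shore lakeOf-along lakeOf-turn

      -- Connectedness of the surface

      infix 4 _∼_
      _∼_ : Rel Base 0ℓ
      _∼_ = EqClosure (λ x y → y ≡ β₀ x ⊎ y ≡ β₁ x ⊎ y ≡ β₂ x)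

      infixr 5 _►_
      _►_ : ∀ {x y z} → x ∼ y → y ∼ z → x ∼ z
      _►_ = Eq.transitive _

      ∼-β₀ : ∀ x → x ∼ β₀ x
      ∼-β₀ x = Eq.return (inj₁ refl)

      ∼-hub : ∀ x y → hubOf x ≡ hubOf y → x ∼ y
      ∼-hub x y eq = toCorner x ► subst (λ h → corner h ∼ y) (sym eq) (Eq.symmetric _ (toCorner y))
        where
        toCorner : ∀ x → x ∼ corner (hubOf x)
        toCorner = hubOf⇒corner _∼_ (Eq.isEquivalence _)
          (λ x → Eq.return (inj₂ (inj₁ refl))) (λ x → Eq.return (inj₂ (inj₂ refl)))

      slide : ∀ a σ p e Q b → ∃[ b′ ] (a , b , σ , (p , e) , Q) ∼ (a , b′ , σ , (zero , low) , Q)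
      slide a σ p e Q b = let (b′ , s) = <-weakInduction P start next p b in b′ , ∼-hub _ _ refl ► s
        where
        P : Fin (suc m) → Set
        P p = ∀ b → ∃[ b′ ] (a , b , σ , (p , low) , Q) ∼ (a , b′ , σ , (zero , low) , Q)
        start : P zero
        start b = b , Eq.reflexive _
        next : ∀ i → P (inject₁ i) → P (suc i)
        next i ih b = let (b′ , s) = ih (not b) in b′ , ∼-β₀ _ ► ∼-hub _ _ refl ► s

      origin : Bool → Σ₀ → Base
      origin b σ = vertical , b , σ , (zero , low) , (zero , low)

      -- Within a sheet the colour is determined by the position. Crossing the zipped side leads
      -- back to the same position with the other colour, which is on the other sheet.
      switch : ∀ b σ → origin b σ ∼ origin (not b) σ
      switch b σ = subst (λ τ → origin b σ ∼ origin (not b) τ) (zipped σ) (∼-β₀ (origin b σ))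

      toOrigin : ∀ x → x ∼ origin false (proj₁ (proj₂ (hubOf x)))
      toOrigin (a , b , σ , (p , e) , (q , e′)) =
        let (b′ , s) = slide a σ p e (q , e′) b
            (b″ , t) = slide (not a) σ q e′ (zero , low) b′
        in s ► Eq.return (inj₂ (inj₁ refl)) ► t ► axis (not a) b″ ► switch? b″
        where
        axis : ∀ a b → (a , b , σ , (zero , low) , (zero , low)) ∼ origin b σ
        axis vertical   b = Eq.reflexive _
        axis horizontal b = Eq.return (inj₂ (inj₁ refl))
        switch? : ∀ b → origin b σ ∼ origin false σ
        switch? false = Eq.reflexive _
        switch? true  = switch true σ

      origins : ∀ σ τ → origin false σ ∼ origin false τ
      origins σ τ = Eq.gfold (Eq.isEquivalence _) (origin false) glued (linked σ τ)
        where
        glued : ∀ {σ τ} → (∃₂ λ a e → τ ≡ glue a e σ) → origin false σ ∼ origin false τ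
        glued {σ} (a , e , refl) = Eq.symmetric _ (toOrigin x) ►
          subst (x ∼_) (cong (λ (σ , P) → a , true , σ , P , (zero , low)) (cross-nothing a σ (extreme e) e (wall-extreme e))) (∼-β₀ x) ►
          toOrigin (a , true , glue a e σ , (extreme e , e) , (zero , low))
          where
          x : Base
          x = a , false , σ , (extreme e , e) , (zero , low)

      base-connected : ∀ x y → x ∼ y
      base-connected x y = toOrigin x ► origins _ _ ► Eq.symmetric _ (toOrigin y)

      Connected : Rel Flag 0ℓ
      Connected = EqClosure (λ x y → y ≡ τ₀ x ⊎ y ≡ τ₁ x ⊎ y ≡ τ₂ x)

      flags-connected : ∀ x y → Connected x y
      flags-connected x y = Eq.transitive _ (toHub x)
        (Eq.transitive _ (Eq.gfold (Eq.isEquivalence _) (λ x → (x , zero , hub) , outer) lift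
          (base-connected (proj₁ (proj₁ x)) (proj₁ (proj₁ y)))) (Eq.symmetric _ (toHub y)))
        where
        around : ∀ x y → vertexOf x ≡ vertexOf y → Connected x y
        around x y eq = Eq.map inj₂ (Equivalence.to (IsOrbitMap.kernel vertexOf-orbits x y) eq)
        toHub : ∀ x → Connected x ((proj₁ (proj₁ x) , zero , hub) , outer)
        toHub ((x , j , hub) , o) = around _ _ refl
        toHub ((x , j , mid) , o) = Eq.transitive _ (Eq.return (inj₁ refl)) (around ((x , j , hub) , o) _ refl)
        lift : ∀ {x y} → y ≡ β₀ x ⊎ y ≡ β₁ x ⊎ y ≡ β₂ x →
               Connected ((x , zero , hub) , outer) ((y , zero , hub) , outer)
        lift (inj₁ refl) = Eq.transitive _ (Eq.return (inj₁ refl))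
          (Eq.transitive _ (Eq.return (inj₂ (inj₁ refl))) (Eq.return (inj₁ refl)))
        lift {x} (inj₂ (inj₁ refl)) = around _ _ (cong inj₁ (sym (hubOf-β₁ x)))
        lift (inj₂ (inj₂ refl)) = around _ _ refl

      embedding : EmbeddedGraph
      embedding = record
        { Flag = Flag ; Vertex = Vertex ; Edge = Edge ; Walk = Walk ; Face = Walk
        ; flags    = fin-Side ×-finite finite-Bool
        ; vertices = fin-Vertex
        ; edges    = fin-Edge
        ; walks    = fin-Walk
        ; faces    = fin-Walk
        ; τ₀ = τ₀ ; τ₁ = τ₁ ; τ₂ = τ₂
        ; τ₀-involutive = λ ((x , j , t) , o) → cong (λ t → (x , j , t) , o) (not-involutive t)
        ; τ₁-involutive = λ { (y , inner) → cong (_, inner) (across-involutive y)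
                            ; (y , outer) → cong (_, outer) (turn-involutive y) }
        ; τ₂-involutive = λ (y , o) → cong (y ,_) (not-involutive o)
        ; τ₀τ₂-commute  = λ _ → refl
        ; τ₁-free = τ₁-free
        ; τ₂-free = λ (y , o) eq → not-free o (cong proj₂ eq)
        ; vertexOf = vertexOf ; edgeOf = edgeOf ; walkOf = walkOf
        ; vertexOf-orbits = vertexOf-orbits
        ; edgeOf-orbits = edgeOf-orbits
        ; walkOf-orbits = walkOf-orbits
        ; noLoop = λ { ((x , j , hub) , o) () ; ((x , j , mid) , o) () }
        ; noParallel = noParallel
        -- Every face is an open disc with one facial walk.
        ; faceOfWalk = id
        ; faceGenus  = λ _ → 0
        ; someFace = walkOf someFlag
        ; connected = connected
        }
        where
        τ₁-free : ∀ x → τ₁ x ≢ x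
        τ₁-free ((x , j , mid) , inner) eq = not-free _ (cong (colour ∘ proj₁ ∘ proj₁) eq)
        τ₁-free ((x , j , mid) , outer) eq = not-free _ (cong (colour ∘ proj₁ ∘ proj₁) eq)
        τ₁-free ((x , j , hub) , inner) eq = not-free _ (cong (side ∘ proj₁ ∘ proj₁) eq)
        τ₁-free ((x , zero , hub) , outer) eq = not-free _ (cong (proj₁ ∘ proj₁ ∘ proj₁) eq)
        τ₁-free ((x , suc j , hub) , outer) eq = not-free _ (cong (side ∘ proj₁ ∘ proj₁) eq)
        -- An edge is recovered from its ends: the midpoint yields link, side and index, and the hub
        -- yields the colour, that is, the half of the link.
        sameEdge : ∀ x y {j k} → hubOf x ≡ hubOf y → (linkOf x , side x , j) ≡ (linkOf y , side y , k) →
                   (x , j) ≡ (y , k)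
        sameEdge x y eq eq′ = cong₂ _,_
          (trans (sym (flagAt-linkOf x)) (trans
            (cong₂ (λ b (l , e , _) → flagAt l b e) (cong proj₁ eq) eq′) (flagAt-linkOf y)))
          (cong (proj₂ ∘ proj₂) eq′)
        noParallel : ∀ x y → vertexOf x ≡ vertexOf y → vertexOf (τ₀ x) ≡ vertexOf (τ₀ y) → edgeOf x ≡ edgeOf y
        noParallel ((x , j , hub) , _) ((y , k , hub) , _) eq eq′ =
          sameEdge x y (Sum.inj₁-injective eq) (Sum.inj₂-injective eq′)
        noParallel ((x , j , mid) , _) ((y , k , mid) , _) eq eq′ =
          sameEdge x y (Sum.inj₁-injective eq′) (Sum.inj₂-injective eq)
        someFlag : Flag
        someFlag = (origin false σ₀ , zero , hub) , outer
        Crossing : Rel Walk 0ℓ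
        Crossing a b = ∃[ x ] (walkOf x ≡ a × walkOf (τ₂ x) ≡ b)
        crossing : ∀ {x y} → y ≡ τ₀ x ⊎ y ≡ τ₁ x ⊎ y ≡ τ₂ x → EqClosure Crossing (walkOf x) (walkOf y)
        crossing {x} {y} (inj₁ eq) = subst (EqClosure Crossing (walkOf x))
          (Equivalence.from (IsOrbitMap.kernel walkOf-orbits x y) (Eq.return (inj₁ eq))) (Eq.reflexive _)
        crossing {x} {y} (inj₂ (inj₁ eq)) = subst (EqClosure Crossing (walkOf x))
          (Equivalence.from (IsOrbitMap.kernel walkOf-orbits x y) (Eq.return (inj₂ eq))) (Eq.reflexive _)
        crossing {x} (inj₂ (inj₂ refl)) = Eq.return (x , refl , refl)
        connected : ∀ f f′ → EqClosure Crossing f f′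
        connected f f′ =
          let (x , xf)  = IsOrbitMap.surjective walkOf-orbits f
              (y , yf′) = IsOrbitMap.surjective walkOf-orbits f′
          in subst₂ (EqClosure Crossing) (xf refl) (yf′ refl)
               (Eq.gfold (Eq.isEquivalence Crossing) walkOf crossing (flags-connected x y))

      open EmbeddedGraph embedding using (eulerCharacteristic; eulerGenus; Incident)

      K s : ℕ
      K = ∥ finΣ ∥
      s = suc m

      total-0 : {A : Set} (fin : Finite A) → total fin (λ _ → 0) ≡ 0
      total-0 fin = go ∥ fin ∥
        where
        go : ∀ n → Vector.foldr {A = ℕ} _+_ 0 {n} (λ _ → 0) ≡ 0
        go zero    = refl
        go (suc n) = go n

      -- A strip counts like the link that it replaces: its 2r midpoints, 4r edges, r nations and r
      -- - 1 digons contribute -1. The graph of hubs has 2Ks² hubs, 4Ks² links and at least 2Km² +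
      -- 4Km + 4 lakes, where s = m + 1, so the characteristic is at least 4 - 2K.
      eulerGenus≤ : ∀ {g} → 2 * K ≤ 2 + g → eulerGenus ℤ.≤ nat g
      eulerGenus≤ {g} 2K≤2+g = ℤ.≤-trans (ℤ.≤-reflexive eq) (ℤ.≤-trans (ℤ.+-monoˡ-≤ (ℤ.- nat (V + W)) (ℤ.+≤+ ineq)) (ℤ.≤-reflexive eq′))
        where
        V = ∥ fin-Vertex ∥
        E = ∥ fin-Edge ∥
        W = ∥ fin-Walk ∥
        ineq : 2 + E ≤ g + (V + W)
        ineq = +-cancelˡ-≤ 2 _ _ (begin
          2 + (2 + E)                                ≡⟨ sym (balance K m r′) ⟩
          V + (∥ fin-Nation ∥ + ∥ fin-Lake ∥) + 2 * K
            ≤⟨ +-mono-≤ (+-monoʳ-≤ V (+-monoʳ-≤ ∥ fin-Nation ∥ lakes≤lakeCount)) 2K≤2+g ⟩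
          V + W + (2 + g)                            ≡⟨ shuffle (V + W) g ⟩
          2 + (g + (V + W))                          ∎)
          where
          open ≤-Reasoning
          balance : ∀ K m r′ →
            (2 * (K * (suc m * suc m)) + (2 * ((K * (suc m * 2)) * suc m)) * (2 * suc r′)) +
            ((2 * ((K * (suc m * 2)) * suc m)) * suc r′ +
             ((K * (m * (m * 2)) + (2 * (2 * (m * K)) + 2 * 2)) + (2 * ((K * (suc m * 2)) * suc m)) * r′)) + 2 * K ≡
            2 + (2 + (2 * (2 * (K * ((suc m * 2) * (suc m * 2))))) * suc r′)
          balance = solve-∀
          shuffle : ∀ x g → x + (2 + g) ≡ 2 + (g + x)
          shuffle = solve-∀
        eq : eulerGenus ≡ nat (2 + E) ℤ.- nat (V + W)
        eq = trans (cong (λ t → nat 2 ℤ.- ((nat V ℤ.- nat E) ℤ.+ (nat (2 * W) ℤ.- nat (t + W)))) (total-0 fin-Walk))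
                   (collect (nat V) (nat E) (nat W))
          where
          collect : ∀ v e w → nat 2 ℤ.- ((v ℤ.- e) ℤ.+ ((w ℤ.+ (w ℤ.+ nat 0)) ℤ.- (nat 0 ℤ.+ w))) ≡ (nat 2 ℤ.+ e) ℤ.- (v ℤ.+ w)
          collect = ℤ-solver.solve-∀
        eq′ : nat (g + (V + W)) ℤ.- nat (V + W) ≡ nat g
        eq′ = cancel (nat g) (nat (V + W))
          where
          cancel : ∀ g x → (g ℤ.+ x) ℤ.- x ≡ g
          cancel = ℤ-solver.solve-∀

      -- The map graph of the nations

      n : ℕ
      n = ∥ fin-Nation ∥

      module Enum = Inverse (Finite.enumeration fin-Nation)

      nation# : Fin n → Nation
      nation# = Enum.from

      nation#-injective : ∀ {i j} → nation# i ≡ nation# j → i ≡ j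
      nation#-injective {i} {j} eq =
        trans (sym (Enum.strictlyInverseˡ i)) (trans (cong Enum.to eq) (Enum.strictlyInverseˡ j))

      SharesHub : Rel Nation 0ℓ
      SharesHub (l , _) (l′ , _) = ∃[ b ] hubAt b l ≡ hubAt b l′

      sharesHub? : ∀ ν ν′ → Dec (SharesHub ν ν′)
      sharesHub? (l , _) (l′ , _) = map′
        (λ { (inj₁ eq) → false , eq ; (inj₂ eq) → true , eq })
        (λ { (false , eq) → inj₁ eq ; (true , eq) → inj₂ eq })
        (finite⇒≟ fin-Hub (hubAt false l) (hubAt false l′) ⊎-dec finite⇒≟ fin-Hub (hubAt true l) (hubAt true l′))

      graph : Graph n
      graph = record
        { Adj    = λ i j → i ≢ j × SharesHub (nation# i) (nation# j)
        ; sym    = λ (i≢j , b , eq) → i≢j ∘ sym , b , sym eq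
        ; irrefl = λ i≡j (i≢j , _) → i≢j i≡j
        ; adj?   = λ i j → ¬? (i Fin.≟ j) ×-dec sharesHub? (nation# i) (nation# j)
        }

      isMapGraph : ∀ {g d} → 2 * K ≤ 2 + g → 4 * r ≤ d → IsMapGraph g d graph
      isMapGraph {g} {d} 2K≤2+g 4r≤d = record
        { G₀        = embedding
        ; genus≤g   = eulerGenus≤ 2K≤2+g
        ; label     = label
        ; nations≤d = nations≤d
        ; nationOf  = mk↔ₛ′ (λ i → inj₁ (nation# i) , refl) (λ { (inj₁ ν , _) → Enum.to ν ; (inj₂ _ , ()) })
            (λ { (inj₁ ν , refl) → cong (λ ν → inj₁ ν , refl) (Enum.strictlyInverseʳ ν) ; (inj₂ _ , ()) })
            Enum.strictlyInverseˡ
        ; adjacency = λ i j → mk⇔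
            (λ (i≢j , b , eq) → i≢j , inj₁ (hubAt b (proj₁ (nation# i))) ,
               hubIncident (nation# i) b , subst (λ h → Incident (inj₁ h) _) (sym eq) (hubIncident (nation# j) b))
            (λ (i≢j , v , iv , jv) → i≢j , meet i≢j v iv jv)
        }
        where
        label : Walk → Label
        label (inj₁ _) = nation
        label (inj₂ _) = lake

        hubIncident : ∀ ν b → Incident (inj₁ (hubAt b (proj₁ ν))) (inj₁ ν)
        hubIncident (l , j) b = ((flagAt l b low , j , hub) , inner) , refl ,
          cong (λ l → inj₁ (l , j)) (linkOf-flagAt l b low)

        incident-hub : ∀ {h ν} → Incident (inj₁ h) (inj₁ ν) → hubAt (proj₁ h) (proj₁ ν) ≡ h
        incident-hub (((x , j , hub) , inner) , refl , refl) = hubAt-linkOf x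

        incident-mid : ∀ {l e j f} → label f ≡ nation → Incident (inj₂ (l , e , j)) f → f ≡ inj₁ (l , flip? e j)
        incident-mid _ (((x , j , mid) , inner) , refl , refl) = refl
        incident-mid () (((x , j , mid) , outer) , refl , refl)

        meet : ∀ {i j} → i ≢ j → ∀ v → Incident v (inj₁ (nation# i)) → Incident v (inj₁ (nation# j)) →
               SharesHub (nation# i) (nation# j)
        meet i≢j (inj₁ h) iv jv = proj₁ h , trans (incident-hub iv) (sym (incident-hub jv))
        meet i≢j (inj₂ (l , e , k)) iv jv = contradiction
          (nation#-injective (Sum.inj₁-injective (trans (incident-mid refl iv) (sym (incident-mid refl jv))))) i≢j

        dart : Hub → Bool × Bool × Fin r → Walk
        dart (b , σ , p , q) (a , e , j) =
          let (p′ , q′) = place a p q in inj₁ (nationOf ((a , b , σ , (p′ , e) , (q′ , low)) , j , hub))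

        fin-Darts : Finite (Bool × Bool × Fin r)
        fin-Darts = finite-Bool ×-finite finite-Bool ×-finite finite-Fin r

        nations≤d : ∀ v → AtMost d (λ f → label f ≡ nation × Incident v f)
        nations≤d (inj₁ h) = atMost-image fin-Darts (≤-trans (≤-reflexive (four r)) 4r≤d) (dart h)
          λ f (lf , inc) → go f lf inc
          where
          four : ∀ r → 2 * (2 * r) ≡ 4 * r
          four = solve-∀
          go : ∀ f → label f ≡ nation → Incident (inj₁ h) f → ∃[ t ] dart h t ≡ f
          go f lf ((((horizontal , b , σ , (p , e) , (q , e′)) , j , hub) , inner) , refl , refl) =
            (horizontal , e , flip? e′ j) , refl
          go f lf ((((vertical , b , σ , (p , e) , (q , e′)) , j , hub) , inner) , refl , refl) =
            (vertical , e , flip? e′ j) , refl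
          go f () (((x , j , hub) , outer) , refl , refl)
        nations≤d (inj₂ (l , e , j)) = atMost-image (finite-Fin 1) (≤-trans (s≤s z≤n) 4r≤d) (λ _ → inj₁ (l , flip? e j))
          λ f (lf , inc) → zero , sym (incident-mid lf inc)

open Surfaces

-- The haven in the map graph

module Cores where

  open Segment

  finite-any? : {A : Set} (fin : Finite A) {P : A → Set} → (∀ a → Dec (P a)) → Dec (∃ P)
  finite-any? fin {P} P? = map′ (λ (i , p) → from i , p)
    (λ (a , p) → to a , subst P (sym (strictlyInverseʳ a)) p) (Fin.any? (P? ∘ from))
    where open Inverse (Finite.enumeration fin)

  #>0⇒∃ : ∀ {n} {P : Fin n → Set} (P? : ∀ i → Dec (P i)) → 0 < # P? → ∃ P
  #>0⇒∃ {n} P? pos with Fin.any? P?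
  ... | yes p = p
  ... | no ¬p = contradiction (subst (0 <_) (trans (sum-cong-≗ (λ i → 𝟙-no (P? i) (¬p ∘ (i ,_))))
                  (trans (sum-const n 0) (*-zeroʳ n))) pos) λ ()

  crossing : ∀ {P : ℕ → Set} → (∀ t → Dec (P t)) → ¬ P 0 → ∀ N → P N → ∃[ t ] (t < N × ¬ P t × P (suc t))
  crossing P? ¬P0 zero    PN = contradiction PN ¬P0
  crossing P? ¬P0 (suc N) PN with P? N
  ... | no ¬p = N , ≤-refl , ¬p , PN
  ... | yes p = let (t , t<N , r) = crossing P? ¬P0 N p in t , m<n⇒m<1+n t<N , r

  -- The block of v consists of the pieces σ with owner σ ≡ v.
  module Network (m : ℕ) {Σ₀ : Set} (glue : Bool → Bool → Σ₀ → Σ₀)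
                 (glue-involutive : ∀ a e → Involutive _≡_ (glue a e))
                 (r′ : ℕ) (finΣ : Finite Σ₀) (σ₀ : Σ₀)
                 (zipped : ∀ σ → glue vertical low σ ≡ σ)
                 (linked : ∀ σ τ → EqClosure (λ σ τ → ∃₂ λ a e → τ ≡ glue a e σ) σ τ)
                 {nH : ℕ} .{{_ : NonZero nH}} (owner : Σ₀ → Fin nH) (pieceOf : Fin nH → Σ₀)
                 (owner-pieceOf : ∀ v → owner (pieceOf v) ≡ v)
                 (owner-glue : ∀ e σ → owner (glue horizontal e σ) ≡ owner σ)
                 (chained : ∀ σ τ → owner σ ≡ owner τ → EqClosure (λ σ τ → ∃[ e ] τ ≡ glue horizontal e σ) σ τ)
                 (expanding : ∀ {A B : Fin nH → Set} (A? : ∀ v → Dec (A v)) (B? : ∀ v → Dec (B v)) →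
                              (∀ v → A v → ¬ B v) → nH ≤ 8 * # A? → nH ≤ 8 * # B? →
                              ∃[ σ ] (A (owner σ) × B (owner (glue vertical high σ))))
                 where
    open Pieces m glue glue-involutive
    open Strips r′ finΣ σ₀ zipped linked

    module Damaged (X : Subset n) where

      Lost : Nation → Set
      Lost ν = Enum.to ν ∈ X

      Live : Link → Set
      Live l = ∃[ j ] ¬ Lost (l , j)

      live? : ∀ l → Dec (Live l)
      live? l = Fin.any? λ j → ¬? (Enum.to (l , j) ∈? X)

      -- A line of a block is the union of all lines with the same axis and number in both sheets of
      -- all its pieces. A line that is not dead can thus be followed through the whole block.
      DeadLine : Bool → Fin nH → Cell → Set
      DeadLine a v q = Σ[ (b , σ , P) ∈ Bool × Dart ] (owner σ ≡ v × ¬ Live (linkOf (a , b , σ , P , (q , low))))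

      opaque
        deadLine? : ∀ a v q → Dec (DeadLine a v q)
        deadLine? a v q = finite-any? (finite-Bool ×-finite fin-Dart) λ (b , σ , P) →
          (owner σ Fin.≟ v) ×-dec ¬? (live? (linkOf (a , b , σ , P , (q , low))))

      dead : Bool → Fin nH → ℕ
      dead a v = # (deadLine? a v)

      lineV : Bool → Fin n → Fin nH
      lineV b i = owner (proj₁ (proj₂ (hubAt b (proj₁ (nation# i)))))

      lineQ : Fin n → Cell
      lineQ i = proj₂ (proj₂ (proj₁ (nation# i)))

      -- A dead line costs X all r nations of some link, and a nation lies on at most
      -- two lines, one at each end.
      hits : Bool → Fin nH → Cell → Fin n → ℕ
      hits b v q i = 𝟙 (lineV b i Fin.≟ v) * 𝟙 (lineQ i Fin.≟ q)

      deadLine-lost : ∀ a v q → 𝟙 (deadLine? a v q) * r ≤ sum (λ i → 𝟙 (i ∈? X) * (hits false v q i + hits true v q i))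
      deadLine-lost a v q with deadLine? a v q
      ... | no  _ = z≤n
      ... | yes ((b , σ , P) , own , ¬live) = ≤-trans (≤-reflexive (*-identityˡ r))
        (injection⇒≤sum (λ j → Enum.to (l , j)) inj _ λ j → *-mono-≤ (𝟙-yes (Enum.to (l , j) ∈? X) (lost j))
          (≤-trans (hit j) (either b j)))
        where
        x = a , b , σ , P , (q , low)
        l = linkOf x
        inj : ∀ {j k} → Enum.to (l , j) ≡ Enum.to (l , k) → j ≡ k
        inj eq = cong proj₂ (trans (sym (Enum.strictlyInverseʳ _)) (trans (cong Enum.from eq) (Enum.strictlyInverseʳ _)))
        lost : ∀ j → Enum.to (l , j) ∈ X
        lost j = decidable-stable (Enum.to (l , j) ∈? X) λ ∉X → ¬live (j , ∉X)
        hit : ∀ j → 1 ≤ hits b v q (Enum.to (l , j))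
        hit j = *-mono-≤
          (𝟙-yes (lineV b (Enum.to (l , j)) Fin.≟ v) (trans (cong (λ ν → owner (proj₁ (proj₂ (hubAt b (proj₁ ν)))))
             (Enum.strictlyInverseʳ (l , j))) (trans (cong (owner ∘ proj₁ ∘ proj₂) (hubAt-linkOf x)) own)))
          (𝟙-yes (lineQ (Enum.to (l , j)) Fin.≟ q) (cong (proj₂ ∘ proj₂ ∘ proj₁) (Enum.strictlyInverseʳ (l , j))))
        either : ∀ b j → hits b v q (Enum.to (l , j)) ≤
                 hits false v q (Enum.to (l , j)) + hits true v q (Enum.to (l , j))
        either false j = m≤m+n _ _
        either true  j = m≤n+m _ (hits false v q (Enum.to (l , j)))

      hits-total : ∀ b i → sum (λ v → sum (λ q → hits b v q i)) ≤ 1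
      hits-total b i = begin
        sum (λ v → sum (λ q → hits b v q i))
          ≡⟨ sum-cong-≗ (λ v → sum-*ˡ (𝟙 (lineV b i Fin.≟ v)) _) ⟩
        sum (λ v → 𝟙 (lineV b i Fin.≟ v) * # (λ q → lineQ i Fin.≟ q))          ≡⟨ sum-*ʳ _ _ ⟩
        # (λ v → lineV b i Fin.≟ v) * # (λ q → lineQ i Fin.≟ q)
          ≤⟨ *-mono-≤ (#-subsingleton (λ v → lineV b i Fin.≟ v) (λ _ _ e e′ → trans (sym e) e′))
              (#-subsingleton (λ q → lineQ i Fin.≟ q) (λ _ _ e e′ → trans (sym e) e′)) ⟩
        1                                                                      ∎
        where open ≤-Reasoning

      total-dead : ∀ a → sum (dead a) * r ≤ 2 * ∣ X ∣
      total-dead a = begin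
        sum (dead a) * r                                            ≡⟨ sym (sum-*ʳ (dead a) r) ⟩
        sum (λ v → dead a v * r)
          ≡⟨ sum-cong-≗ (λ v → sym (sum-*ʳ (λ q → 𝟙 (deadLine? a v q)) r)) ⟩
        sum (λ v → sum (λ q → 𝟙 (deadLine? a v q) * r))
          ≤⟨ sum-mono-≤ (λ v → sum-mono-≤ (deadLine-lost a v)) ⟩
        sum (λ v → sum (λ q → sum (λ i → term v q i)))              ≡⟨ sum-cong-≗ (λ v → ∑-comm (term v)) ⟩
        sum (λ v → sum (λ i → sum (λ q → term v q i)))
          ≡⟨ ∑-comm (λ v i → sum (λ q → term v q i)) ⟩
        sum (λ i → sum (λ v → sum (λ q → term v q i)))              ≤⟨ sum-mono-≤ perNation ⟩
        sum (λ i → 𝟙 (i ∈? X) * 2)                                  ≡⟨ sum-*ʳ (λ i → 𝟙 (i ∈? X)) 2 ⟩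
        # (_∈? X) * 2                                               ≡⟨ *-comm (# (_∈? X)) 2 ⟩
        2 * # (_∈? X)                                               ≡⟨ cong (2 *_) (sym (∣p∣≡# X)) ⟩
        2 * ∣ X ∣                                                   ∎
        where
        open ≤-Reasoning
        term : Fin nH → Cell → Fin n → ℕ
        term v q i = 𝟙 (i ∈? X) * (hits false v q i + hits true v q i)
        perNation : ∀ i → sum (λ v → sum (λ q → term v q i)) ≤ 𝟙 (i ∈? X) * 2
        perNation i = begin
          sum (λ v → sum (λ q → term v q i))
            ≡⟨ sum-cong-≗ (λ v → sum-*ˡ (𝟙 (i ∈? X)) _) ⟩
          sum (λ v → 𝟙 (i ∈? X) * sum (λ q → hits false v q i + hits true v q i)) ≡⟨ sum-*ˡ (𝟙 (i ∈? X)) _ ⟩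
          𝟙 (i ∈? X) * sum (λ v → sum (λ q → hits false v q i + hits true v q i))
            ≡⟨ cong (𝟙 (i ∈? X) *_) (trans
                (sum-cong-≗ (λ v → ∑-distrib-+ (λ q → hits false v q i) (λ q → hits true v q i)))
                (∑-distrib-+ (λ v → sum (λ q → hits false v q i)) (λ v → sum (λ q → hits true v q i)))) ⟩
          𝟙 (i ∈? X) * (sum (λ v → sum (λ q → hits false v q i)) + sum (λ v → sum (λ q → hits true v q i)))
            ≤⟨ *-monoʳ-≤ (𝟙 (i ∈? X)) (+-mono-≤ (hits-total false i) (hits-total true i)) ⟩
          𝟙 (i ∈? X) * 2                                                        ∎

      Good : Fin nH → Set
      Good v = 2 * dead horizontal v < s × 2 * dead vertical v < s

      opaque
        good? : ∀ v → Dec (Good v)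
        good? v = (2 * dead horizontal v <? s) ×-dec (2 * dead vertical v <? s)

      bad? : ∀ v → Dec (¬ Good v)
      bad? v = ¬? (good? v)

      bad-dead : ∀ v → 𝟙 (bad? v) * s ≤ 2 * (dead horizontal v + dead vertical v)
      bad-dead v with good? v
      ... | yes _ = z≤n
      ... | no ¬good = ≤-trans (≤-reflexive (*-identityˡ s)) (≤-trans bound (≤-reflexive (sym (*-distribˡ-+ 2 (dead horizontal v) (dead vertical v)))))
        where
        bound : s ≤ 2 * dead horizontal v + 2 * dead vertical v
        bound with 2 * dead horizontal v <? s
        ... | no  ≮ = ≤-trans (≮⇒≥ ≮) (m≤m+n _ _)
        ... | yes h = ≤-trans (≮⇒≥ (λ v → ¬good (h , v))) (m≤n+m _ (2 * dead horizontal v))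

      bad-total : # bad? * s * r ≤ 8 * ∣ X ∣
      bad-total = begin
        # bad? * s * r
          ≡⟨ cong (_* r) (sym (sum-*ʳ (λ v → 𝟙 (bad? v)) s)) ⟩
        sum (λ v → 𝟙 (bad? v) * s) * r                              ≤⟨ *-monoˡ-≤ r (sum-mono-≤ bad-dead) ⟩
        sum (λ v → 2 * (dead horizontal v + dead vertical v)) * r
          ≡⟨ cong (_* r) (trans (sum-*ˡ 2 (λ v → dead horizontal v + dead vertical v)) (cong (2 *_) (∑-distrib-+ (dead horizontal) (dead vertical)))) ⟩
        2 * (sum (dead horizontal) + sum (dead vertical)) * r
          ≡⟨ expand (sum (dead horizontal)) (sum (dead vertical)) r ⟩
        2 * (sum (dead horizontal) * r + sum (dead vertical) * r)
          ≤⟨ *-monoʳ-≤ 2 (+-mono-≤ (total-dead horizontal) (total-dead vertical)) ⟩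
        2 * (2 * ∣ X ∣ + 2 * ∣ X ∣)                                 ≡⟨ eight ∣ X ∣ ⟩
        8 * ∣ X ∣                                                   ∎
        where
        open ≤-Reasoning
        expand : ∀ x y r → 2 * (x + y) * r ≡ 2 * (x * r + y * r)
        expand = solve-∀
        eight : ∀ x → 2 * (2 * x + 2 * x) ≡ 8 * x
        eight = solve-∀

      -- Here 64 is 8 · 8. The 8 in `bad-total` has a factor 2 for half of the lines, 2 for the two
      -- ends of a nation and 2 for the two axes; the other 8 leaves at most an eighth of the blocks
      -- bad.
      few-bad : 64 * ∣ X ∣ ≤ s * r * nH → 8 * # bad? ≤ nH
      few-bad small = *-cancelʳ-≤ (8 * # bad?) nH (s * r) (begin
        8 * # bad? * (s * r)     ≡⟨ regroup (# bad?) s r ⟩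
        8 * (# bad? * s * r)     ≤⟨ *-monoʳ-≤ 8 bad-total ⟩
        8 * (8 * ∣ X ∣)          ≡⟨ sym (*-assoc 8 8 ∣ X ∣) ⟩
        64 * ∣ X ∣               ≤⟨ small ⟩
        s * r * nH               ≡⟨ *-comm (s * r) nH ⟩
        nH * (s * r)             ∎)
        where
        open ≤-Reasoning
        regroup : ∀ b s r → 8 * b * (s * r) ≡ 8 * (b * s * r)
        regroup = solve-∀

      Step : Rel Base 0ℓ
      Step x y = Live (linkOf x) × Live (linkOf y) × (hubOf x ≡ hubOf y ⊎ linkOf x ≡ linkOf y)

      infix 4 _⇝_
      _⇝_ : Rel Base 0ℓ
      _⇝_ = Star Step

      reverseTrail : ∀ {x y} → x ⇝ y → y ⇝ x
      reverseTrail = Star.reverse λ (lx , ly , eq) → ly , lx , Sum.map sym sym eq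

      Walk-off : Rel (Fin n) 0ℓ
      Walk-off = Star (Avoiding graph (_∈ X))

      shareHub : ∀ {x y} j k → hubOf x ≡ hubOf y ⊎ linkOf x ≡ linkOf y → SharesHub (linkOf x , j) (linkOf y , k)
      shareHub {x} {y} j k (inj₁ eq) = colour x , (begin
        hubAt (colour x) (linkOf x) ≡⟨ hubAt-linkOf x ⟩
        hubOf x                     ≡⟨ eq ⟩
        hubOf y                     ≡⟨ sym (hubAt-linkOf y) ⟩
        hubAt (colour y) (linkOf y) ≡⟨ cong (λ h → hubAt (proj₁ h) (linkOf y)) (sym eq) ⟩
        hubAt (colour x) (linkOf y) ∎)
        where open ≡-Reasoning
      shareHub j k (inj₂ eq) = false , cong (hubAt false) eq

      hop : ∀ {ν ν′} → SharesHub ν ν′ → ¬ Lost ν → ¬ Lost ν′ → Walk-off (Enum.to ν) (Enum.to ν′)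
      hop {ν} {ν′} share ν∉X ν′∉X with Enum.to ν Fin.≟ Enum.to ν′
      ... | yes eq = subst (Walk-off (Enum.to ν)) eq ε
      ... | no  ne = ((ne , subst₂ SharesHub (sym (Enum.strictlyInverseʳ ν)) (sym (Enum.strictlyInverseʳ ν′)) share) ,
                      ν∉X , ν′∉X) ◅ ε

      trail⇒walk : ∀ {x y} → x ⇝ y → ∀ {j k} → ¬ Lost (linkOf x , j) → ¬ Lost (linkOf y , k) →
                   Walk-off (Enum.to (linkOf x , j)) (Enum.to (linkOf y , k))
      trail⇒walk {x} ε {j} {k} j∉ k∉ = hop (shareHub {x} {x} j k (inj₂ refl)) j∉ k∉
      trail⇒walk {x} (_◅_ {j = y} (_ , (i , i∉) , eq) t) {j} j∉ k∉ = hop (shareHub {x} {y} j i eq) j∉ i∉ ◅◅ trail⇒walk t i∉ k∉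

      on-liveLine : ∀ {a σ q} → ¬ DeadLine a (owner σ) q → ∀ b P e → Live (linkOf (a , b , σ , P , (q , e)))
      on-liveLine live b P e = decidable-stable (live? _) λ dead → live ((b , _ , P) , refl , dead)

      module _ {a σ q} (live : ¬ DeadLine a (owner σ) q) (e′ : Bool) where
        private
          at : Bool → Cell → Bool → Base
          at b p e = a , b , σ , (p , e) , (q , e′)

          live-at : ∀ b p e → Live (linkOf (at b p e))
          live-at b p e = on-liveLine live b (p , e) e′

          hubStep : ∀ b p e e₀ → at b p e ⇝ at b p e₀
          hubStep b p e e₀ = (live-at b p e , live-at b p e₀ , inj₁ refl) ◅ ε

          down : ∀ p b → ∃[ b′ ] at b p low ⇝ at b′ zero low
          down = <-weakInduction (λ p → ∀ b → ∃[ b′ ] at b p low ⇝ at b′ zero low) (λ b → b , ε)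
            λ i ih b → let (b′ , t) = ih (not b) in b′ ,
              (live-at b (suc i) low , live-at (not b) (inject₁ i) high , inj₂ (sym (linkOf-β₀ (at b (suc i) low)))) ◅
              hubStep (not b) (inject₁ i) high low ◅◅ t

          up : ∀ p b → ∃[ b′ ] at b zero low ⇝ at b′ p low
          up = <-weakInduction (λ p → ∀ b → ∃[ b′ ] at b zero low ⇝ at b′ p low) (λ b → b , ε)
            λ i ih b → let (b′ , t) = ih b in not b′ ,
              t ◅◅ hubStep b′ (inject₁ i) low high ◅◅
              (live-at b′ (inject₁ i) high , live-at (not b′) (suc i) low ,
               inj₂ (trans (sym (linkOf-β₀ (at b′ (inject₁ i) high)))
                 (cong (λ (σ , P) → linkOf (a , not b′ , σ , P , (q , e′))) (cross-just a σ (inject₁ i) high (lower-inject₁ i))))) ◅ ε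

        slide-live : ∀ p p₀ e e₀ b → ∃[ b′ ] at b p e ⇝ at b′ p₀ e₀
        slide-live p p₀ e e₀ b =
          let (b′ , t) = down p b
              (b″ , u) = up p₀ b′
          in b″ , hubStep b p e low ◅◅ t ◅◅ u ◅◅ hubStep b″ p₀ low e₀

      cross-over : ∀ {a σ q} e → ¬ DeadLine a (owner σ) q → ¬ DeadLine a (owner (glue a e σ)) q → ∀ b →
                   (a , b , σ , (extreme e , e) , (q , low)) ⇝ (a , not b , glue a e σ , (extreme e , e) , (q , low))
      cross-over {a} {σ} {q} e live live′ b =
        (on-liveLine live b _ low , on-liveLine live′ (not b) _ low ,
         inj₂ (trans (sym (linkOf-β₀ (a , b , σ , (extreme e , e) , (q , low))))
           (cong (λ (σ , P) → linkOf (a , not b , σ , P , (q , low))) (cross-nothing a σ (extreme e) e (wall-extreme e))))) ◅ ε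

      -- The foot of column `p` at the zipped side. Over that side the column continues on the other
      -- sheet, so both of its halves lead to the same anchor.
      anchor : Σ₀ → Cell → Base
      anchor σ p = vertical , false , σ , (zero , low) , (p , low)

      col⇝anchor : ∀ {σ p} → ¬ DeadLine vertical (owner σ) p → ∀ b q e → (vertical , b , σ , (q , e) , (p , low)) ⇝ anchor σ p
      col⇝anchor {σ} {p} live b q e =
        let (b′ , t) = slide-live live low q zero e low b in t ◅◅ switch′ b′
        where
        switch′ : ∀ b → (vertical , b , σ , (zero , low) , (p , low)) ⇝ anchor σ p
        switch′ false = ε
        switch′ true  = subst (λ τ → (vertical , true , σ , (zero , low) , (p , low)) ⇝ (vertical , false , τ , (zero , low) , (p , low)))
          (zipped σ) (cross-over low live (subst (λ τ → ¬ DeadLine vertical (owner τ) p) (sym (zipped σ)) live) true)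

      row⇝anchor : ∀ {σ q p} → ¬ DeadLine horizontal (owner σ) q → ¬ DeadLine vertical (owner σ) p →
                   ∀ b p₀ e → (horizontal , b , σ , (p₀ , e) , (q , low)) ⇝ anchor σ p
      row⇝anchor {σ} {q} {p} liveRow liveCol b p₀ e =
        let (b′ , t) = slide-live liveRow low p₀ p e low b
        in t ◅◅ (on-liveLine liveRow b′ _ low , on-liveLine liveCol b′ (q , low) low , inj₁ refl) ◅ col⇝anchor liveCol b′ q low

      change-col : ∀ {σ q p p′} → ¬ DeadLine horizontal (owner σ) q → ¬ DeadLine vertical (owner σ) p →
                   ¬ DeadLine vertical (owner σ) p′ → anchor σ p ⇝ anchor σ p′
      change-col liveRow liveCol liveCol′ =
        reverseTrail (row⇝anchor liveRow liveCol false zero low) ◅◅ row⇝anchor liveRow liveCol′ false zero low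

      neighbour : ∀ {σ q p} e → ¬ DeadLine horizontal (owner σ) q → ¬ DeadLine vertical (owner σ) p →
                  anchor σ p ⇝ anchor (glue horizontal e σ) p
      neighbour {σ} {q} {p} e liveRow liveCol =
        reverseTrail (row⇝anchor liveRow liveCol false (extreme e) e) ◅◅
        cross-over e liveRow liveRow′ false ◅◅
        row⇝anchor liveRow′ (subst (λ v → ¬ DeadLine vertical v p) (sym (owner-glue e σ)) liveCol) true (extreme e) e
        where liveRow′ = subst (λ v → ¬ DeadLine horizontal v q) (sym (owner-glue e σ)) liveRow

      change-piece : ∀ {v q p} → ¬ DeadLine horizontal v q → ¬ DeadLine vertical v p →
                     ∀ σ τ → owner σ ≡ v → owner τ ≡ v → anchor σ p ⇝ anchor τ p
      change-piece {v} {q} {p} liveRow liveCol σ τ σv τv =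
        proj₂ (Eq.gfold isEquiv id (λ { {σ} (e , refl) → edge e σ }) (chained σ τ (trans σv (sym τv)))) σv
        where
        -- Equality of owners is part of the relation, so that membership in the block `v` passes
        -- along the closure.
        S : Rel Σ₀ 0ℓ
        S σ τ = owner σ ≡ owner τ × (owner σ ≡ v → anchor σ p ⇝ anchor τ p)
        isEquiv : IsEquivalence S
        isEquiv = record
          { refl  = refl , λ _ → ε
          ; sym   = λ (eq , t) → sym eq , λ o → reverseTrail (t (trans eq o))
          ; trans = λ (eq , t) (eq′ , t′) → trans eq eq′ , λ o → t o ◅◅ t′ (trans (sym eq) o) }
        edge : ∀ e σ → S σ (glue horizontal e σ)
        edge e σ = sym (owner-glue e σ) , λ { refl → neighbour e liveRow liveCol }

      mate : ∀ {σ p} → ¬ DeadLine vertical (owner σ) p → ¬ DeadLine vertical (owner (glue vertical high σ)) p →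
             anchor σ p ⇝ anchor (glue vertical high σ) p
      mate {σ} {p} live live′ = reverseTrail (col⇝anchor live false (extreme high) high) ◅◅
        cross-over high live live′ false ◅◅ col⇝anchor live′ true (extreme high) high

      LiveLine : Bool → Fin nH → Cell → Set
      LiveLine a v q = ¬ DeadLine a v q

      liveLine? : ∀ a v q → Dec (LiveLine a v q)
      liveLine? a v q = ¬? (deadLine? a v q)

      most-live : ∀ a {v} → 2 * dead a v < s → s < 2 * # (liveLine? a v)
      most-live a {v} few = +-cancelˡ-< (2 * dead a v) s (2 * # (liveLine? a v)) (begin-strict
        2 * dead a v + s                             <⟨ +-monoˡ-< s few ⟩
        s + s                                        ≡⟨ cong (s +_) (sym (+-identityʳ s)) ⟩
        2 * s
          ≤⟨ *-monoʳ-≤ 2 (#-complement (deadLine? a v) (liveLine? a v) (λ _ ¬d → ¬d)) ⟩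
        2 * (dead a v + # (liveLine? a v))           ≡⟨ *-distribˡ-+ 2 (dead a v) (# (liveLine? a v)) ⟩
        2 * dead a v + 2 * # (liveLine? a v)         ∎)
        where open ≤-Reasoning

      good-live : ∀ a {v} → Good v → s < 2 * # (liveLine? a v)
      good-live horizontal (h , _) = most-live horizontal h
      good-live vertical   (_ , v) = most-live vertical v

      lineIn : Bool → Fin nH → Cell
      lineIn a v with Fin.any? (liveLine? a v)
      ... | yes (q , _) = q
      -- An arbitrary value for a block without surviving lines; a good block always has one.
      ... | no  _       = zero

      lineIn-live : ∀ a {v} → Good v → LiveLine a v (lineIn a v)
      lineIn-live a {v} good with Fin.any? (liveLine? a v)
      ... | yes (q , live) = live
      ... | no  none       = contradiction (proj₁ both , proj₁ (proj₂ both)) none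
        where both = majorities-meet (liveLine? a v) (liveLine? a v) (good-live a good) (good-live a good)

      centre : Fin nH → Base
      centre v = anchor (pieceOf v) (lineIn vertical v)

      centre⇝ : ∀ {v p} → Good v → LiveLine vertical v p → ∀ σ → owner σ ≡ v → centre v ⇝ anchor σ p
      centre⇝ {v} good liveCol σ refl =
        change-piece (lineIn-live horizontal good) (lineIn-live vertical good) (pieceOf v) σ (owner-pieceOf v) refl ◅◅
        change-col (lineIn-live horizontal good) (lineIn-live vertical good) liveCol

      -- A column keeps its number across the glued side, and in both blocks more than half of the
      -- column numbers survive, so one number survives in both.
      mates-joined : ∀ σ → Good (owner σ) → Good (owner (glue vertical high σ)) →
                     centre (owner σ) ⇝ centre (owner (glue vertical high σ))
      mates-joined σ good good′ =
        let (p , live , live′) = majorities-meet (liveLine? vertical (owner σ)) (liveLine? vertical (owner (glue vertical high σ)))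
                                   (good-live vertical good) (good-live vertical good′)
        in centre⇝ good live σ refl ◅◅ mate live live′ ◅◅ reverseTrail (centre⇝ good′ live′ _ refl)

      private
        -- `quotient` takes its edges as a family indexed by all pieces, so an edge with a bad end
        -- is replaced by a loop.
        target : ∀ {v w} → Dec (Good v) → Dec (Good w) → Fin nH
        target {v} {w} (yes _) (yes _) = w
        target {v} {w} _       _       = v

        target-good : ∀ {v w} (d : Dec (Good v)) (e : Dec (Good w)) → Good v → Good w → target d e ≡ w
        target-good (yes _) (yes _) g g′ = refl
        target-good (no ¬g) _       g g′ = contradiction g ¬g
        target-good (yes _) (no ¬g) g g′ = contradiction g′ ¬g

        target-elim : ∀ {v w} (d : Dec (Good v)) (e : Dec (Good w)) (C : Fin nH → Set) →
                      (Good v → Good w → C w) → C v → C (target d e)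
        target-elim (yes g) (yes g′) C both one = both g g′
        target-elim (no _)  _        C both one = one
        target-elim (yes _) (no _)   C both one = one

        piece : Fin K → Σ₀
        piece = Inverse.from (Finite.enumeration finΣ)

        start mateOwner finish : Fin K → Fin nH
        start     i = owner (piece i)
        mateOwner i = owner (glue vertical high (piece i))
        finish    i = target (good? (start i)) (good? (mateOwner i))

      opaque
        component : FiniteQuotient (Joined start finish)
        component = quotient start finish

      open FiniteQuotient component using (class; sound; exact) renaming (size to classes)

      mates-sameClass : ∀ σ → Good (owner σ) → Good (owner (glue vertical high σ)) →
                        class (owner σ) ≡ class (owner (glue vertical high σ))
      mates-sameClass σ good good′ =
        subst P (Inverse.strictlyInverseʳ enumΣ σ) enumerated
          good good′
        where
        enumΣ = Finite.enumeration finΣ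
        P : Σ₀ → Set
        P σ = Good (owner σ) → Good (owner (glue vertical high σ)) →
              class (owner σ) ≡ class (owner (glue vertical high σ))
        enumerated : P (piece (Inverse.to enumΣ σ))
        enumerated g g′ = trans (sound (Inverse.to enumΣ σ , refl , refl))
          (cong class (target-good (good? _) (good? _) g g′))

      sameClass⇒joined : ∀ v w → Good v → Good w → class v ≡ class w → centre v ⇝ centre w
      sameClass⇒joined v w good good′ eq = fromS (Eq.gfold isEquiv id joined (exact v w eq))
        where
        S : Rel (Fin nH) 0ℓ
        S v w = v ≡ w ⊎ (Good v × Good w × centre v ⇝ centre w)
        isEquiv : IsEquivalence S
        isEquiv = record
          { refl  = inj₁ refl
          ; sym   = λ { (inj₁ refl) → inj₁ refl ; (inj₂ (g , g′ , t)) → inj₂ (g′ , g , reverseTrail t) }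
          ; trans = λ { (inj₁ refl) s → s ; (inj₂ p) (inj₁ refl) → inj₂ p
                      ; (inj₂ (g , _ , t)) (inj₂ (_ , g′ , t′)) → inj₂ (g , g′ , t ◅◅ t′) } }
        joined : ∀ {v w} → Joined start finish v w → S v w
        joined (i , refl , refl) = target-elim (good? (start i)) (good? (mateOwner i)) (S (start i))
          (λ g g′ → inj₂ (g , g′ , mates-joined (piece i) g g′)) (inj₁ refl)
        fromS : S v w → centre v ⇝ centre w
        fromS (inj₁ refl)        = ε
        fromS (inj₂ (_ , _ , t)) = t

      opaque
        inClass? : ∀ c v → Dec (Good v × class v ≡ c)
        inClass? c v = good? v ×-dec (class v Fin.≟ c)

      module _ (fewBad : 8 * # bad? ≤ nH) (¬big : ¬ (∃[ c ] nH < 2 * # (inClass? c))) where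
        UpTo Above : ℕ → Fin nH → Set
        UpTo  t v = Good v × toℕ (class v) < t
        Above t v = Good v × t ≤ toℕ (class v)
        opaque
          upTo? : ∀ t v → Dec (UpTo t v)
          upTo? t v = good? v ×-dec (toℕ (class v) <? t)
          above? : ∀ t v → Dec (Above t v)
          above? t v = good? v ×-dec (t ≤? toℕ (class v))

        cover : ∀ t → nH ≤ # bad? + (# (upTo? t) + # (above? t))
        cover t = ≤-trans (#-complement bad? good? (λ v → decidable-stable (good? v))) (+-monoʳ-≤ (# bad?) (begin
          # good?                                            ≤⟨ sum-mono-≤ split ⟩
          sum (λ v → 𝟙 (upTo? t v) + 𝟙 (above? t v))         ≡⟨ ∑-distrib-+ _ _ ⟩
          # (upTo? t) + # (above? t)                         ∎))
          where
          open ≤-Reasoning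
          split : ∀ v → 𝟙 (good? v) ≤ 𝟙 (upTo? t v) + 𝟙 (above? t v)
          split v = 𝟙≤ (good? v) λ g → [ (λ <t → ≤-trans (𝟙-yes (upTo? t v) (g , <t)) (m≤m+n _ _)) ,
                                         (λ ≥t → ≤-trans (𝟙-yes (above? t v) (g , ≥t)) (m≤n+m _ (𝟙 (upTo? t v)))) ]′
                                       (<-≤-connex (toℕ (class v)) t)

        none : # (upTo? 0) ≡ 0
        none = trans (sum-cong-≗ (λ v → 𝟙-no (upTo? 0 v) λ ())) (trans (sum-const nH 0) (*-zeroʳ nH))

        none-above : # (above? classes) ≡ 0
        none-above = trans (sum-cong-≗ (λ v → 𝟙-no (above? classes v) λ (_ , le) → <⇒≱ (Fin.toℕ<n (class v)) le))
          (trans (sum-const nH 0) (*-zeroʳ nH))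

        Enough : ℕ → Set
        Enough t = nH ≤ 8 * # (upTo? t)

        all-enough : Enough classes
        all-enough = ≤-trans (m≤n*m nH 7) seven
          where
          open ≤-Reasoning
          eq₈ : ∀ x y → 8 * (x + (y + 0)) ≡ 8 * x + 8 * y
          eq₈ = solve-∀
          seven : 7 * nH ≤ 8 * # (upTo? classes)
          seven = +-cancelˡ-≤ nH _ _ (begin
            8 * nH                                                       ≤⟨ *-monoʳ-≤ 8 (cover classes) ⟩
            8 * (# bad? + (# (upTo? classes) + # (above? classes)))
              ≡⟨ cong (λ x → 8 * (# bad? + (# (upTo? classes) + x))) none-above ⟩
            8 * (# bad? + (# (upTo? classes) + 0))                       ≡⟨ eq₈ (# bad?) (# (upTo? classes)) ⟩
            8 * # bad? + 8 * # (upTo? classes)                           ≤⟨ +-monoˡ-≤ _ fewBad ⟩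
            nH + 8 * # (upTo? classes)                                   ∎)

        threshold : ∃[ t ] (t < classes × ¬ Enough t × Enough (suc t))
        threshold = crossing {Enough} (λ t → nH ≤? 8 * # (upTo? t))
          (λ e → contradiction (subst (λ x → nH ≤ 8 * x) none e) (<⇒≱ (>-nonZero⁻¹ nH))) classes all-enough

        module _ (t : ℕ) (t<classes : t < classes) (¬enough : ¬ Enough t) (enough : Enough (suc t)) where

          c : Fin classes
          c = Fin.fromℕ< t<classes

          next : # (upTo? (suc t)) ≤ # (upTo? t) + # (inClass? c)
          next = ≤-trans (sum-mono-≤ split) (≤-reflexive (∑-distrib-+ _ _))
            where
            split : ∀ v → 𝟙 (upTo? (suc t) v) ≤ 𝟙 (upTo? t v) + 𝟙 (inClass? c v)
            split v = 𝟙≤ (upTo? (suc t) v) λ (g , <1+t) →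
              [ (λ <t → ≤-trans (𝟙-yes (upTo? t v) (g , <t)) (m≤m+n _ _)) ,
                (λ ≡t → ≤-trans (𝟙-yes (inClass? c v) (g , Fin.toℕ-injective (trans ≡t (sym (Fin.toℕ-fromℕ< t<classes)))))
                          (m≤n+m _ (𝟙 (upTo? t v)))) ]′ (m≤n⇒m<n∨m≡n (≤-pred <1+t))

          rest : nH ≤ 8 * # (above? (suc t))
          rest = +-cancelˡ-≤ (6 * nH) _ _ (begin
            6 * nH + nH                        ≤⟨ m≤n+m _ nH ⟩
            nH + (6 * nH + nH)                 ≡⟨ e₁ nH ⟩
            8 * nH
              ≤⟨ *-monoʳ-≤ 8 (≤-trans (cover (suc t)) (+-monoʳ-≤ (# bad?) (+-monoˡ-≤ _ next))) ⟩
            8 * (# bad? + ((u + f) + a))       ≡⟨ e₂ (# bad?) u f a ⟩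
            (8 * # bad? + (8 * u + 4 * (2 * f))) + 8 * a
              ≤⟨ +-monoˡ-≤ (8 * a) (+-mono-≤ fewBad (+-mono-≤ (<⇒≤ (≰⇒> ¬enough)) (*-monoʳ-≤ 4 (≮⇒≥ (λ big → ¬big (c , big)))))) ⟩
            (nH + (nH + 4 * nH)) + 8 * a       ≡⟨ e₃ nH a ⟩
            6 * nH + 8 * a                     ∎)
            where
            open ≤-Reasoning
            u = # (upTo? t)
            f = # (inClass? c)
            a = # (above? (suc t))
            e₁ : ∀ x → x + (6 * x + x) ≡ 8 * x
            e₁ = solve-∀
            e₂ : ∀ b u f a → 8 * (b + ((u + f) + a)) ≡ (8 * b + (8 * u + 4 * (2 * f))) + 8 * a
            e₂ = solve-∀
            e₃ : ∀ x a → (x + (x + 4 * x)) + 8 * a ≡ 6 * x + 8 * a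
            e₃ = solve-∀

          disjoint : ∀ v → UpTo (suc t) v → ¬ Above (suc t) v
          disjoint v (_ , lt) (_ , ge) = <⇒≱ lt ge

          noEdge : ∃[ σ ] (UpTo (suc t) (owner σ) × Above (suc t) (owner (glue vertical high σ))) → ⊥
          noEdge (σ , (g , lt) , (g′ , ge)) = <⇒≱ lt (subst (suc t ≤_) (cong toℕ (sym (mates-sameClass σ g g′))) ge)

          absurd : ⊥
          absurd = noEdge (expanding (upTo? (suc t)) (above? (suc t)) disjoint enough rest)

      -- If no class held more than half of the blocks, add the classes one by one until they first
      -- hold an eighth of the blocks. Before the last addition they held less than an eighth, so
      -- now less than 5/8; with at most an eighth bad, at least a quarter remains above. Expansion
      -- then yields a gluing between good blocks on the two sides, although glued good blocks are
      -- in one class.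
      bigClass : 8 * # bad? ≤ nH → ∃[ c ] nH < 2 * # (inClass? c)
      bigClass fewBad = decidable-stable (Fin.any? (λ c → nH <? 2 * # (inClass? c))) λ ¬big →
        let (t , t< , ¬enough , enough) = threshold fewBad ¬big in absurd fewBad ¬big t t< ¬enough enough

    module _ {k : ℕ} (64k≤ : 64 * k ≤ s * r * nH) where

      private
        small : ∀ (X : Subset n) → ∣ X ∣ ≤ k → 64 * ∣ X ∣ ≤ s * r * nH
        small X ≤k = ≤-trans (*-monoʳ-≤ 64 ≤k) 64k≤

        main : ∀ X → ∣ X ∣ ≤ k → ∃[ c ] nH < 2 * # (Damaged.inClass? X c)
        main X ≤k = Damaged.bigClass X (Damaged.few-bad X (small X ≤k))

        member : ∀ X ≤k → ∃[ v ] (Damaged.Good X v × FiniteQuotient.class (Damaged.component X) v ≡ proj₁ (main X ≤k))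
        member X ≤k = let (c , big) = main X ≤k in #>0⇒∃ (Damaged.inClass? X c) (*-cancelˡ-< 2 0 _ (≤-<-trans z≤n big))

        survivor : ∀ X ≤k → Damaged.Live X (linkOf (Damaged.centre X (proj₁ (member X ≤k))))
        survivor X ≤k =
          let open Damaged X
              (v , good , _) = member X ≤k
          in on-liveLine (subst (λ w → LiveLine vertical w (lineIn vertical v)) (sym (owner-pieceOf v)) (lineIn-live vertical good))
               false (zero , low) low

      haven : HavenOfOrder k graph
      haven = record
        { home  = λ X ≤k → Enum.to (linkOf (Damaged.centre X (proj₁ (member X ≤k))) , proj₁ (survivor X ≤k))
        ; home∉ = λ X ≤k → proj₂ (survivor X ≤k)
        ; meet  = meet
        }
        where
        reach : ∀ X ≤k {v p} → Damaged.Good X v → FiniteQuotient.class (Damaged.component X) v ≡ proj₁ (main X ≤k) →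
                Damaged.LiveLine X vertical v p →
                ∃[ j ] Star (Avoiding graph (_∈ X))
                  (Enum.to (linkOf (Damaged.centre X (proj₁ (member X ≤k))) , proj₁ (survivor X ≤k)))
                  (Enum.to (linkOf (Damaged.anchor X (pieceOf v) p) , j))
        reach X ≤k {v} {p} good cl live =
          let open Damaged X
              (w , good′ , cl′) = member X ≤k
              (j , j∉) = on-liveLine (subst (λ w → LiveLine vertical w p) (sym (owner-pieceOf v)) live)
                           false (zero , low) low
          in j , trail⇒walk (sameClass⇒joined w v good′ good (trans cl′ (sym cl)) ◅◅
                             centre⇝ good live (pieceOf v) (owner-pieceOf v)) (proj₂ (survivor X ≤k)) j∉
        meet : ∀ X Y X≤k Y≤k → ∃₂ λ u v → Star (Avoiding graph (_∈ X)) _ u × Star (Avoiding graph (_∈ Y)) _ v × Touching graph u v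
        meet X Y X≤k Y≤k =
          let (c , bigX) = main X X≤k
              (c′ , bigY) = main Y Y≤k
              (v , (goodX , clX) , (goodY , clY)) = majorities-meet (Damaged.inClass? X c) (Damaged.inClass? Y c′) bigX bigY
              (p , liveX , liveY) = majorities-meet (Damaged.liveLine? X vertical v) (Damaged.liveLine? Y vertical v)
                                      (Damaged.good-live X vertical goodX) (Damaged.good-live Y vertical goodY)
              (j , walkX) = reach X X≤k goodX clX liveX
              (k , walkY) = reach Y Y≤k goodY clY liveY
          -- `X` and `Y` may spare different nations of the common link. Such nations are adjacent,
          -- as they share the hubs of that link.
          in _ , _ , walkX , walkY , touch (linkOf (vertical , false , pieceOf v , (zero , low) , (p , low))) j k
          where
          touch : ∀ l j k → Touching graph (Enum.to (l , j)) (Enum.to (l , k))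
          touch l j k with Enum.to (l , j) Fin.≟ Enum.to (l , k)
          ... | yes eq = inj₁ eq
          ... | no  ne = inj₂ (ne , false , cong (hubAt false)
            (trans (cong proj₁ (Enum.strictlyInverseʳ (l , j))) (sym (cong proj₁ (Enum.strictlyInverseʳ (l , k))))))

open Cores

-- Expanding matchings

module Expanders where

  large-term : ∀ {n l} .{{_ : NonZero n}} → (f : Fin n → ℕ) → n * l ≤ sum f → ∃[ i ] l ≤ f i
  large-term {n} {zero}  f le = Fin.fromℕ< (>-nonZero⁻¹ n) , z≤n
  large-term {n} {suc l} f le = decidable-stable (Fin.any? (λ i → suc l ≤? f i)) λ none →
    contradiction (≤-trans le (≤-trans (sum-mono-≤ (λ i → ≤-pred (≰⇒> (none ∘ (i ,_))))) (≤-reflexive (sum-const n l))))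
      (<⇒≱ (*-monoʳ-< n (n<1+n l)))

  ^-distribʳ-* : ∀ n a b → (a * b) ^ n ≡ a ^ n * b ^ n
  ^-distribʳ-* zero    a b = refl
  ^-distribʳ-* (suc n) a b = trans (cong (a * b *_) (^-distribʳ-* n a b)) (exchange a b (a ^ n) (b ^ n))
    where
    exchange : ∀ a b x y → a * b * (x * y) ≡ a * x * (b * y)
    exchange = solve-∀

  subsets : ∀ n → List (Subset n)
  subsets zero    = [] ∷ []
  subsets (suc n) = map (true ∷_) (subsets n) ++ map (false ∷_) (subsets n)

  length-subsets : ∀ n → length (subsets n) ≡ 2 ^ n
  length-subsets zero    = refl
  length-subsets (suc n) = trans (List.length-++ (map (true ∷_) (subsets n)))
    (cong₂ _+_ (trans (List.length-map _ (subsets n)) (length-subsets n))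
               (trans (List.length-map _ (subsets n)) (trans (length-subsets n) (sym (+-identityʳ (2 ^ n))))))

  ∈-subsets : ∀ {n} (A : Subset n) → A List.∈ subsets n
  ∈-subsets []          = here refl
  ∈-subsets (true  ∷ A) = List.∈-++⁺ˡ (List.∈-map⁺ (true ∷_) (∈-subsets A))
  ∈-subsets (false ∷ A) = List.∈-++⁺ʳ _ (List.∈-map⁺ (false ∷_) (∈-subsets A))

  length-cartesianProduct : {A B : Set} (as : List A) (bs : List B) →
                            length (cartesianProduct as bs) ≡ length as * length bs
  length-cartesianProduct []       bs = refl
  length-cartesianProduct (a ∷ as) bs = trans (List.length-++ (map (a ,_) bs))
    (cong₂ _+_ (List.length-map (a ,_) bs) (length-cartesianProduct as bs))

  module _ {A : Set} {P : A → Set} (P? : ∀ a → Dec (P a)) where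

    occurrences : List A → ℕ
    occurrences []       = 0
    occurrences (a ∷ as) = 𝟙 (P? a) + occurrences as

    length-filter-¬ : ∀ as → length (filter (λ a → ¬? (P? a)) as) + occurrences as ≡ length as
    length-filter-¬ []       = refl
    length-filter-¬ (a ∷ as) with P? a
    ... | yes _ = trans (+-suc _ _) (cong suc (length-filter-¬ as))
    ... | no  _ = cong suc (length-filter-¬ as)

    occurs : ∀ as → 0 < occurrences as → ∃[ a ] (a List.∈ as × P a)
    occurs (a ∷ as) pos with P? a
    ... | yes p = a , here refl , p
    ... | no  _ = let (b , b∈ , p) = occurs as pos in b , there b∈ , p

  -- A greedily chosen matching of the stubs Fin (n * D), of which each v : Fin n
  -- owns at least D.  While a sixteenth of the stubs at most are used up, some pair
  -- of free stubs joins a 256th of the pairs (A , B) of large disjoint sets not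
  -- joined so far, and there are only 4 ^ n such pairs.
  module Greedy {n D : ℕ} .{{_ : NonZero n}} .{{_ : NonZero D}} (owner : Fin (n * D) → Fin n)
                (fibre : ∀ v → D ≤ # (λ x → owner x Fin.≟ v)) where

    N : ℕ
    N = n * D

    Pair : Set
    Pair = Subset n × Subset n

    Large : Pair → Set
    Large (A , B) = (∀ v → v ∈ A → v ∉ B) × n ≤ 8 * ∣ A ∣ × n ≤ 8 * ∣ B ∣

    stubs≥ : (A : Subset n) → D * ∣ A ∣ ≤ # (λ x → owner x ∈? A)
    stubs≥ A = begin
      D * ∣ A ∣                                                       ≡⟨ cong (D *_) (∣p∣≡# A) ⟩
      D * # (_∈? A)                                                   ≡⟨ *-comm D (# (_∈? A)) ⟩
      # (_∈? A) * D                                                   ≡⟨ sym (sum-*ʳ (λ v → 𝟙 (v ∈? A)) D) ⟩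
      sum (λ v → 𝟙 (v ∈? A) * D)
        ≤⟨ sum-mono-≤ (λ v → *-monoʳ-≤ (𝟙 (v ∈? A)) (fibre v)) ⟩
      sum (λ v → 𝟙 (v ∈? A) * # (λ x → owner x Fin.≟ v))
        ≡⟨ sum-cong-≗ (λ v → sym (sum-*ˡ (𝟙 (v ∈? A)) (λ x → 𝟙 (owner x Fin.≟ v)))) ⟩
      sum (λ v → sum (λ x → 𝟙 (v ∈? A) * 𝟙 (owner x Fin.≟ v)))
        ≡⟨ ∑-comm (λ v x → 𝟙 (v ∈? A) * 𝟙 (owner x Fin.≟ v)) ⟩
      sum (λ x → sum (λ v → 𝟙 (v ∈? A) * 𝟙 (owner x Fin.≟ v)))
        ≤⟨ sum-mono-≤ (λ x → ≤-trans (sum-mono-≤ (pointwise x)) (single x)) ⟩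
      # (λ x → owner x ∈? A)                                          ∎
      where
      open ≤-Reasoning
      pointwise : ∀ x v → 𝟙 (v ∈? A) * 𝟙 (owner x Fin.≟ v) ≤ 𝟙 (owner x ∈? A) * 𝟙 (owner x Fin.≟ v)
      pointwise x v with owner x Fin.≟ v
      ... | yes refl = ≤-refl
      ... | no  _    = ≤-trans (≤-reflexive (*-zeroʳ (𝟙 (v ∈? A)))) z≤n
      single : ∀ x → sum (λ v → 𝟙 (owner x ∈? A) * 𝟙 (owner x Fin.≟ v)) ≤ 𝟙 (owner x ∈? A)
      single x = ≤-trans (≤-reflexive (sum-*ˡ (𝟙 (owner x ∈? A)) (λ v → 𝟙 (owner x Fin.≟ v))))
        (≤-trans (*-monoʳ-≤ (𝟙 (owner x ∈? A)) (#-subsingleton (λ v → owner x Fin.≟ v) (λ _ _ e e′ → trans (sym e) e′)))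
          (≤-reflexive (*-identityʳ _)))

    module Matching (μ : Fin N → Fin N) (involutive : Involutive _≡_ μ) where

      Free : Fin N → Set
      Free x = μ x ≡ x

      free? : ∀ x → Dec (Free x)
      free? x = μ x Fin.≟ x

      used : ℕ
      used = # (λ x → ¬? (free? x))

      Joins : Pair → Set
      Joins (A , B) = ∃[ x ] (¬ Free x × owner x ∈ A × owner (μ x) ∈ B)

      freeIn? : (A : Subset n) → ∀ x → Dec (Free x × owner x ∈ A)
      freeIn? A x = free? x ×-dec (owner x ∈? A)

      -- An eighth of the vertices owns at least an eighth of the stubs, and removing the used ones,
      -- at most a sixteenth, leaves a sixteenth. For two such sets this accounts for 256 = 16 · 16.
      free≥ : 16 * used ≤ N → ∀ A → n ≤ 8 * ∣ A ∣ → N ≤ 16 * # (freeIn? A)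
      free≥ few A large = +-cancelʳ-≤ N N (16 * # (freeIn? A)) (begin
        N + N                                         ≡⟨ double N ⟩
        2 * (n * D)                                   ≤⟨ *-monoʳ-≤ 2 (*-monoˡ-≤ D large) ⟩
        2 * (8 * ∣ A ∣ * D)                           ≡⟨ regroup ∣ A ∣ D ⟩
        16 * (D * ∣ A ∣)                              ≤⟨ *-monoʳ-≤ 16 (≤-trans (stubs≥ A) split) ⟩
        16 * (# (freeIn? A) + used)                   ≡⟨ *-distribˡ-+ 16 (# (freeIn? A)) used ⟩
        16 * # (freeIn? A) + 16 * used                ≤⟨ +-monoʳ-≤ (16 * # (freeIn? A)) few ⟩
        16 * # (freeIn? A) + N                        ∎)
        where
        open ≤-Reasoning
        double : ∀ x → x + x ≡ 2 * x
        double = solve-∀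
        regroup : ∀ a d → 2 * (8 * a * d) ≡ 16 * (d * a)
        regroup = solve-∀
        one : ∀ x → 𝟙 (owner x ∈? A) ≤ 𝟙 (freeIn? A x) + 𝟙 (¬? (free? x))
        one x = 𝟙≤ (owner x ∈? A) (λ x∈A → byFree (free? x) x∈A)
          where
          byFree : Dec (Free x) → owner x ∈ A → 1 ≤ 𝟙 (freeIn? A x) + 𝟙 (¬? (free? x))
          byFree (yes f) x∈A = ≤-trans (𝟙-yes (freeIn? A x) (f , x∈A)) (m≤m+n _ _)
          byFree (no ¬f) x∈A = ≤-trans (𝟙-yes (¬? (free? x)) ¬f) (m≤n+m _ (𝟙 (freeIn? A x)))
        split : # (λ x → owner x ∈? A) ≤ # (freeIn? A) + used
        split = ≤-trans (sum-mono-≤ one) (≤-reflexive (∑-distrib-+ (λ x → 𝟙 (freeIn? A x)) (λ x → 𝟙 (¬? (free? x)))))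

      Kills : Fin N → Fin N → Pair → Set
      Kills x y (A , B) = (Free x × owner x ∈ A) × (Free y × owner y ∈ B)

      kills? : ∀ x y p → Dec (Kills x y p)
      kills? x y (A , B) = freeIn? A x ×-dec freeIn? B y

      killed : Fin N → Fin N → List Pair → ℕ
      killed x y = occurrences (kills? x y)

      pair-killed : 16 * used ≤ N → ∀ p → Large p → N * N ≤ 256 * sum (λ x → sum (λ y → 𝟙 (kills? x y p)))
      pair-killed few (A , B) (_ , largeA , largeB) = begin
        N * N
          ≤⟨ *-mono-≤ (free≥ few A largeA) (free≥ few B largeB) ⟩
        16 * # (freeIn? A) * (16 * # (freeIn? B))          ≡⟨ regroup (# (freeIn? A)) (# (freeIn? B)) ⟩
        256 * (# (freeIn? A) * # (freeIn? B))
          ≡⟨ cong (256 *_) (sym (sum-*ʳ (λ x → 𝟙 (freeIn? A x)) (# (freeIn? B)))) ⟩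
        256 * sum (λ x → 𝟙 (freeIn? A x) * # (freeIn? B))  ≤⟨ *-monoʳ-≤ 256 (sum-mono-≤ λ x →
              ≤-trans (≤-reflexive (sym (sum-*ˡ (𝟙 (freeIn? A x)) (λ y → 𝟙 (freeIn? B y)))))
              (sum-mono-≤ λ y → 𝟙-× (freeIn? A x) (freeIn? B y))) ⟩
        256 * sum (λ x → sum (λ y → 𝟙 (kills? x y (A , B)))) ∎
        where
        open ≤-Reasoning
        regroup : ∀ a b → 16 * a * (16 * b) ≡ 256 * (a * b)
        regroup = solve-∀
        𝟙-× : ∀ {P Q : Set} (d : Dec P) (e : Dec Q) → 𝟙 d * 𝟙 e ≤ 𝟙 (d ×-dec e)
        𝟙-× (yes p) (yes q) = ≤-refl
        𝟙-× (yes p) (no _)  = z≤n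
        𝟙-× (no _)  _       = z≤n

      all-killed : 16 * used ≤ N → ∀ P → All Large P → N * (N * length P) ≤ sum (λ x → sum (λ y → 256 * killed x y P))
      all-killed few [] [] = ≤-trans (≤-reflexive (trans (cong (N *_) (*-zeroʳ N)) (*-zeroʳ N))) z≤n
      all-killed few (p ∷ P) (large ∷ larges) = begin
        N * (N * suc (length P))                                    ≡⟨ regroup N (length P) ⟩
        N * N + N * (N * length P)
          ≤⟨ +-mono-≤ (pair-killed few p large) (all-killed few P larges) ⟩
        256 * sum (λ x → sum (k₁ x)) + sum (λ x → sum (k₂ x))
          ≡⟨ cong (_+ sum (λ x → sum (k₂ x))) (trans (sym (sum-*ˡ 256 (λ x → sum (k₁ x))))
              (sum-cong-≗ (λ x → sym (sum-*ˡ 256 (k₁ x))))) ⟩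
        sum (λ x → sum (λ y → 256 * k₁ x y)) + sum (λ x → sum (k₂ x))
          ≡⟨ sym (∑-distrib-+ (λ x → sum (λ y → 256 * k₁ x y)) (λ x → sum (k₂ x))) ⟩
        sum (λ x → sum (λ y → 256 * k₁ x y) + sum (k₂ x))
          ≡⟨ sum-cong-≗ (λ x → trans (sym (∑-distrib-+ (λ y → 256 * k₁ x y) (k₂ x)))
              (sum-cong-≗ (λ y → sym (*-distribˡ-+ 256 (k₁ x y) (killed x y P))))) ⟩
        sum (λ x → sum (λ y → 256 * killed x y (p ∷ P)))            ∎
        where
        open ≤-Reasoning
        k₁ k₂ : Fin N → Fin N → ℕ
        k₁ x y = 𝟙 (kills? x y p)
        k₂ x y = 256 * killed x y P
        regroup : ∀ N l → N * (N * suc l) ≡ N * N + N * (N * l)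
        regroup = solve-∀

      -- Averaging over `x` and then over `y`: each open pair is killed by at least a 256th of all
      -- choices, so some choice kills a 256th of the open pairs.
      bestPair : 16 * used ≤ N → ∀ P → All Large P → ∃₂ λ x y → length P ≤ 256 * killed x y P
      bestPair few P larges =
        let instance N≢0 = m*n≢0 n D
            (x , le)  = large-term (λ x → sum (λ y → 256 * killed x y P)) (all-killed few P larges)
            (y , le′) = large-term (λ y → 256 * killed x y P) le
        in x , y , le′

      -- The owners of `x` and `y` lie in disjoint sets, hence the two stubs differ and may be
      -- matched.
      killed>0⇒ : ∀ x y P → All Large P → 0 < killed x y P → Free x × Free y × x ≢ y
      killed>0⇒ x y P larges pos =
        let (p , p∈P , (fx , x∈A) , (fy , y∈B)) = occurs (kills? x y) P pos
        in fx , fy , λ { refl → proj₁ (All.lookup larges p∈P) (owner x) x∈A y∈B }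

      module Swap {x y : Fin N} (free-x : Free x) (free-y : Free y) (x≢y : x ≢ y) where

        swapped : Fin N → Fin N
        swapped z with z Fin.≟ x | z Fin.≟ y
        ... | yes _ | _     = y
        ... | no  _ | yes _ = x
        ... | no  _ | no  _ = μ z

        swapped-x : swapped x ≡ y
        swapped-x with x Fin.≟ x
        ... | yes _  = refl
        ... | no x≢x = contradiction refl x≢x

        swapped-y : swapped y ≡ x
        swapped-y with y Fin.≟ x | y Fin.≟ y
        ... | yes y≡x | _       = contradiction (sym y≡x) x≢y
        ... | no  _   | yes _   = refl
        ... | no  _   | no y≢y  = contradiction refl y≢y

        swapped-other : ∀ {z} → z ≢ x → z ≢ y → swapped z ≡ μ z
        swapped-other {z} z≢x z≢y with z Fin.≟ x | z Fin.≟ y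
        ... | yes z≡x | _       = contradiction z≡x z≢x
        ... | no  _   | yes z≡y = contradiction z≡y z≢y
        ... | no  _   | no  _   = refl

        cases : ∀ z → z ≡ x ⊎ z ≡ y ⊎ (z ≢ x × z ≢ y)
        cases z with z Fin.≟ x | z Fin.≟ y
        ... | yes z≡x | _       = inj₁ z≡x
        ... | no  _   | yes z≡y = inj₂ (inj₁ z≡y)
        ... | no z≢x  | no z≢y  = inj₂ (inj₂ (z≢x , z≢y))

        swapped-involutive : Involutive _≡_ swapped
        swapped-involutive z with cases z
        ... | inj₁ refl        = trans (cong swapped swapped-x) swapped-y
        ... | inj₂ (inj₁ refl) = trans (cong swapped swapped-y) swapped-x
        ... | inj₂ (inj₂ (z≢x , z≢y)) = trans (cong swapped (swapped-other z≢x z≢y)) (trans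
                (swapped-other (λ e → z≢x (trans (sym (involutive z)) (trans (cong μ e) free-x)))
                               (λ e → z≢y (trans (sym (involutive z)) (trans (cong μ e) free-y)))) (involutive z))

        keep : ∀ {z} → ¬ Free z → swapped z ≡ μ z
        keep ¬free = swapped-other (λ { refl → ¬free free-x }) (λ { refl → ¬free free-y })

    open Matching

    swapped-used : ∀ μ inv {x y} (fx : Free μ inv x) (fy : Free μ inv y) (x≢y : x ≢ y) →
                   let open Swap μ inv fx fy x≢y in
                   used swapped swapped-involutive ≤ used μ inv + 2
    swapped-used μ inv {x} {y} fx fy x≢y = ≤-trans (sum-mono-≤ one) (≤-trans
        (≤-reflexive (trans (∑-distrib-+ (λ z → 𝟙 (¬? (free? μ inv z))) _) (cong (used μ inv +_)
           (∑-distrib-+ (λ z → 𝟙 (z Fin.≟ x)) (λ z → 𝟙 (z Fin.≟ y))))))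
        (+-monoʳ-≤ (used μ inv) (+-mono-≤ (#-subsingleton (λ z → z Fin.≟ x) (λ _ _ e e′ → trans e (sym e′)))
                                           (#-subsingleton (λ z → z Fin.≟ y) (λ _ _ e e′ → trans e (sym e′))))))
      where
      open Swap μ inv fx fy x≢y
      one : ∀ z → 𝟙 (¬? (free? swapped swapped-involutive z)) ≤ 𝟙 (¬? (free? μ inv z)) + (𝟙 (z Fin.≟ x) + 𝟙 (z Fin.≟ y))
      one z = 𝟙≤ (¬? (free? swapped swapped-involutive z)) λ ¬free → byCase ¬free (cases z)
        where
        byCase : ¬ (swapped z ≡ z) → z ≡ x ⊎ z ≡ y ⊎ (z ≢ x × z ≢ y) →
                 1 ≤ 𝟙 (¬? (free? μ inv z)) + (𝟙 (z Fin.≟ x) + 𝟙 (z Fin.≟ y))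
        byCase _ (inj₁ e) = ≤-trans (≤-trans (𝟙-yes (z Fin.≟ x) e) (m≤m+n _ _)) (m≤n+m _ (𝟙 (¬? (free? μ inv z))))
        byCase _ (inj₂ (inj₁ e)) = ≤-trans (≤-trans (𝟙-yes (z Fin.≟ y) e) (m≤n+m _ (𝟙 (z Fin.≟ x)))) (m≤n+m _ (𝟙 (¬? (free? μ inv z))))
        byCase ¬free (inj₂ (inj₂ (z≢x , z≢y))) =
          ≤-trans (𝟙-yes (¬? (free? μ inv z)) (λ f → ¬free (trans (swapped-other z≢x z≢y) f))) (m≤m+n _ _)

    record State (t : ℕ) : Set where
      field
        μ          : Fin N → Fin N
        involutive : Involutive _≡_ μ
        few        : used μ involutive ≤ 2 * t
        open-pairs : List Pair
        large      : All Large open-pairs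
        covers     : ∀ p → Large p → p List.∈ open-pairs ⊎ Joins μ involutive p
        -- Each step multiplies the number of open pairs by at most 255/256, starting from at most
        -- `4 ^ n`, the number of all pairs of subsets.
        shrinking  : length open-pairs * 256 ^ t ≤ 255 ^ t * 4 ^ n

    large? : ∀ p → Dec (Large p)
    large? (A , B) = Fin.all? v∈?→∉ ×-dec (n ≤? 8 * ∣ A ∣) ×-dec (n ≤? 8 * ∣ B ∣)
      where
      v∈?→∉ : ∀ v → Dec (v ∈ A → v ∉ B)
      v∈?→∉ v = (v ∈? A) →-dec ¬? (v ∈? B)

    module _ {t} (S : State t) where
      open State S

      private
        module _ (x y : Fin N) (best : length open-pairs ≤ 256 * killed μ involutive x y open-pairs)
                 (fx : Free μ involutive x) (fy : Free μ involutive y) (x≢y : x ≢ y) where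
          open Swap μ involutive fx fy x≢y

          left : List Pair
          left = filter (λ p → ¬? (kills? μ involutive x y p)) open-pairs

          left≤ : 256 * length left ≤ 255 * length open-pairs
          left≤ = +-cancelʳ-≤ (length open-pairs) _ _ (begin
            256 * length left + length open-pairs       ≤⟨ +-monoʳ-≤ (256 * length left) best ⟩
            256 * length left + 256 * k                 ≡⟨ sym (*-distribˡ-+ 256 (length left) k) ⟩
            256 * (length left + k)
              ≡⟨ cong (256 *_) (length-filter-¬ (kills? μ involutive x y) open-pairs) ⟩
            256 * length open-pairs                     ≡⟨ one (length open-pairs) ⟩
            255 * length open-pairs + length open-pairs ∎)
            where
            open ≤-Reasoning
            k = killed μ involutive x y open-pairs
            one : ∀ l → 256 * l ≡ 255 * l + l
            one = solve-∀

          join : State (suc t)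
          join = record
            { μ = swapped ; involutive = swapped-involutive
            ; few = ≤-trans (swapped-used μ involutive fx fy x≢y) (≤-trans (+-monoˡ-≤ 2 few) (≤-reflexive (plus2 t)))
            ; open-pairs = left
            ; large = All.filter⁺ _ large
            ; covers = λ p lp → cover p (covers p lp)
            ; shrinking = begin
                length left * (256 * 256 ^ t)     ≡⟨ r₁ (length left) (256 ^ t) ⟩
                256 * length left * 256 ^ t       ≤⟨ *-monoˡ-≤ (256 ^ t) left≤ ⟩
                255 * length open-pairs * 256 ^ t ≡⟨ *-assoc 255 (length open-pairs) (256 ^ t) ⟩
                255 * (length open-pairs * 256 ^ t) ≤⟨ *-monoʳ-≤ 255 shrinking ⟩
                255 * (255 ^ t * 4 ^ n)           ≡⟨ sym (*-assoc 255 (255 ^ t) (4 ^ n)) ⟩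
                255 * 255 ^ t * 4 ^ n             ∎
            }
            where
            open ≤-Reasoning
            plus2 : ∀ t → 2 * t + 2 ≡ 2 * suc t
            plus2 = solve-∀
            r₁ : ∀ l x → l * (256 * x) ≡ 256 * l * x
            r₁ = solve-∀
            cover : ∀ p → p List.∈ open-pairs ⊎ Joins μ involutive p → p List.∈ left ⊎ Joins swapped swapped-involutive p
            cover (A , B) (inj₂ (z , ¬free , z∈A , μz∈B)) = inj₂ (z ,
              (λ f → ¬free (trans (sym (keep ¬free)) f)) , z∈A , subst (λ w → owner w ∈ B) (sym (keep ¬free)) μz∈B)
            cover (A , B) (inj₁ p∈) with kills? μ involutive x y (A , B)
            ... | no ¬k = inj₁ (List.∈-filter⁺ (λ p → ¬? (kills? μ involutive x y p)) p∈ ¬k)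
            ... | yes ((_ , x∈A) , (_ , y∈B)) = inj₂ (x , (λ f → x≢y (trans (sym f) swapped-x)) , x∈A ,
                    subst (λ w → owner w ∈ B) (sym swapped-x) y∈B)

      next : 32 * t ≤ N → State (suc t)
      next 32t≤N with open-pairs in eq
      ... | [] = record
        { μ = μ ; involutive = involutive ; few = ≤-trans few (*-monoʳ-≤ 2 (n≤1+n t))
        ; open-pairs = [] ; large = [] ; covers = λ p lp → subst (λ P → p List.∈ P ⊎ Joins μ involutive p) eq (covers p lp)
        ; shrinking = z≤n }
      ... | p ∷ P =
        let few′ = ≤-trans (*-monoʳ-≤ 16 few) (≤-trans (≤-reflexive (sym (*-assoc 16 2 t))) 32t≤N)
            (x , y , best) = bestPair μ involutive few′ open-pairs large
            (fx , fy , x≢y) = killed>0⇒ μ involutive x y open-pairs large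
              (*-cancelˡ-< 256 0 _ (≤-trans (subst (λ Q → 1 ≤ length Q) (sym eq) (s≤s z≤n)) best))
        in join x y best fx fy x≢y

    initial : State 0
    initial = record
      { μ = λ x → x ; involutive = λ _ → refl
      ; few = ≤-reflexive (trans (sum-cong-≗ (λ x → 𝟙-no (¬? (free? (λ x → x) (λ _ → refl) x)) (λ ¬f → ¬f refl)))
                            (trans (sum-const N 0) (*-zeroʳ N)))
      ; open-pairs = filter large? pairs
      ; large = All.all-filter large? pairs
      ; covers = λ p lp → inj₁ (List.∈-filter⁺ large? (List.∈-cartesianProduct⁺ (∈-subsets (proj₁ p)) (∈-subsets (proj₂ p))) lp)
      ; shrinking = begin
          length (filter large? pairs) * 1     ≡⟨ *-identityʳ _ ⟩
          length (filter large? pairs)         ≤⟨ List.length-filter large? pairs ⟩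
          length pairs                         ≡⟨ length-cartesianProduct (subsets n) (subsets n) ⟩
          length (subsets n) * length (subsets n) ≡⟨ cong₂ _*_ (length-subsets n) (length-subsets n) ⟩
          2 ^ n * 2 ^ n                        ≡⟨ sym (^-distribʳ-* n 2 2) ⟩
          4 ^ n                                ≡⟨ sym (*-identityˡ (4 ^ n)) ⟩
          1 * 4 ^ n                            ∎
      }
      where
      open ≤-Reasoning
      pairs : List Pair
      pairs = cartesianProduct (subsets n) (subsets n)

    iterate : ∀ t → 32 * t ≤ N → State t
    iterate zero    _  = initial
    iterate (suc t) le = let le′ = ≤-trans (*-monoʳ-≤ 32 (n≤1+n t)) le in next (iterate t le′) le′

    -- After `m` steps no pair is open, as `shrinking` with at least one open pair would contradict
    -- the inequality between the powers.
    matching : ∀ m → 32 * m ≤ N → 255 ^ m * 4 ^ n < 256 ^ m →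
               ∃[ μ ] (Involutive _≡_ μ × (∀ A B → Large (A , B) → ∃[ x ] (owner x ∈ A × owner (μ x) ∈ B)))
    matching m le lt = μ , involutive , λ A B large → joined A B (covers (A , B) large)
      where
      open State (iterate m le)
      joined : ∀ A B → (A , B) List.∈ open-pairs ⊎ Joins μ involutive (A , B) → ∃[ x ] (owner x ∈ A × owner (μ x) ∈ B)
      joined A B (inj₂ (x , _ , x∈A , μx∈B)) = x , x∈A , μx∈B
      joined A B (inj₁ p∈) = contradiction (≤-trans (m≤n*m (256 ^ m) (length open-pairs) {{nonEmpty p∈}}) shrinking) (<⇒≱ lt)
        where
        nonEmpty : ∀ {p P} → p List.∈ P → NonZero (length P)
        nonEmpty (here _)  = _
        nonEmpty (there _) = _

  -- (256 / 255) ^ 360 > 4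
  360-steps : ∀ n .{{_ : NonZero n}} → 255 ^ (360 * n) * 4 ^ n < 256 ^ (360 * n)
  360-steps n = powers (255 ^ 360) (256 ^ 360) (<ᵇ⇒< _ _ _) (^-*-assoc 255 360 n) (^-*-assoc 256 360 n)
    where
    powers : ∀ a b {c d} → a * 4 < b → a ^ n ≡ c → b ^ n ≡ d → c * 4 ^ n < d
    powers a b lt refl refl = subst (_< b ^ n) (^-distribʳ-* n a 4) (^-monoˡ-< n lt)

open Expanders

-- Gluing patterns for the pieces

module Scaffolds where

  -- The interface between the gluing patterns and the haven. It is met by a single sphere, for
  -- small genus, and by an expander of blocks.
  record Scaffold (nH : ℕ) : Set₁ where
    field
      Σ₀              : Set
      glue            : Bool → Bool → Σ₀ → Σ₀
      glue-involutive : ∀ a e → Involutive _≡_ (glue a e)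
      finΣ            : Finite Σ₀
      σ₀              : Σ₀
      zipped          : ∀ σ → glue vertical low σ ≡ σ
      linked          : ∀ σ τ → EqClosure (λ σ τ → ∃₂ λ a e → τ ≡ glue a e σ) σ τ
      owner           : Σ₀ → Fin nH
      pieceOf         : Fin nH → Σ₀
      owner-pieceOf   : ∀ v → owner (pieceOf v) ≡ v
      owner-glue      : ∀ e σ → owner (glue horizontal e σ) ≡ owner σ
      chained         : ∀ σ τ → owner σ ≡ owner τ → EqClosure (λ σ τ → ∃[ e ] τ ≡ glue horizontal e σ) σ τ
      expanding       : ∀ {A B : Fin nH → Set} (A? : ∀ v → Dec (A v)) (B? : ∀ v → Dec (B v)) →
                        (∀ v → A v → ¬ B v) → nH ≤ 8 * # A? → nH ≤ 8 * # B? →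
                        ∃[ σ ] (A (owner σ) × B (owner (glue vertical high σ)))

  -- With all four sides zipped the piece is a sphere. `expanding` is vacuous, for one block has no
  -- two disjoint non-empty sets.
  singlePiece : Scaffold 1
  singlePiece = record
    { Σ₀ = Fin 1 ; glue = λ _ _ σ → σ ; glue-involutive = λ _ _ _ → refl ; finΣ = finite-Fin 1 ; σ₀ = zero
    ; zipped = λ _ → refl ; linked = λ { zero zero → Eq.reflexive _ }
    ; owner = id ; pieceOf = id ; owner-pieceOf = λ _ → refl ; owner-glue = λ _ _ → refl
    ; chained = λ { zero zero _ → Eq.reflexive _ }
    ; expanding = λ {A} {B} A? B? disjoint hA hB →
        let (v , a) = #>0⇒∃ A? (*-cancelˡ-< 8 0 _ hA)
            (w , b) = #>0⇒∃ B? (*-cancelˡ-< 8 0 _ hB)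
        in contradiction b (disjoint w (subst A (only v w) a))
    }
    where
    only : ∀ (v w : Fin 1) → v ≡ w
    only zero zero = refl

  -- The two matchings that make up the path 0 — 1 — 2 — … on Fin n.
  evenSwap oddSwap : ∀ {n} → Fin n → Fin n
  evenSwap {suc zero}    zero          = zero
  evenSwap {suc (suc n)} zero          = suc zero
  evenSwap {suc (suc n)} (suc zero)    = zero
  evenSwap {suc (suc n)} (suc (suc i)) = suc (suc (evenSwap i))
  oddSwap zero    = zero
  oddSwap (suc i) = suc (evenSwap i)

  evenSwap-involutive : ∀ {n} → Involutive _≡_ (evenSwap {n})
  evenSwap-involutive {suc zero}    zero          = refl
  evenSwap-involutive {suc (suc n)} zero          = refl
  evenSwap-involutive {suc (suc n)} (suc zero)    = refl
  evenSwap-involutive {suc (suc n)} (suc (suc i)) = cong (λ i → suc (suc i)) (evenSwap-involutive i)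

  oddSwap-involutive : ∀ {n} → Involutive _≡_ (oddSwap {n})
  oddSwap-involutive zero    = refl
  oddSwap-involutive (suc i) = cong suc (evenSwap-involutive i)

  path-edge : ∀ {n} (i : Fin n) → suc i ≡ evenSwap (inject₁ i) ⊎ suc i ≡ oddSwap (inject₁ i)
  path-edge zero    = inj₁ refl
  path-edge (suc i) with path-edge i
  ... | inj₁ eq = inj₂ (cong suc eq)
  path-edge (suc zero)    | inj₂ ()
  path-edge (suc (suc i)) | inj₂ eq = inj₁ (cong (λ i → suc (suc i)) (Fin.suc-injective eq))

  path-connected : ∀ {n} (i j : Fin n) → EqClosure (λ i j → j ≡ evenSwap i ⊎ j ≡ oddSwap i) i j
  path-connected {suc n} i j = Eq.transitive _ (toZero i) (Eq.symmetric _ (toZero j))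
    where
    toZero : ∀ i → EqClosure (λ i j → j ≡ evenSwap i ⊎ j ≡ oddSwap i) i zero
    toZero = <-weakInduction _ (Eq.reflexive _) λ i ih →
      Eq.transitive _ (Eq.symmetric _ (Eq.return (path-edge i))) ih

  -- The pieces (v , 0) and (v , 1) serve to join v to its neighbours on a path, and
  -- the others are matched up by an expander.
  module _ (n D₀ : ℕ) .{{_ : NonZero n}} (enough : 32 * 360 ≤ D₀) where

    private
      instance
        D₀≢0 : NonZero D₀
        D₀≢0 = >-nonZero (≤-trans (s≤s z≤n) enough)

      stubOwner : Fin (n * D₀) → Fin n
      stubOwner x = proj₁ (remQuot D₀ x)

      fibre : ∀ v → D₀ ≤ # (λ x → stubOwner x Fin.≟ v)
      fibre v = injection⇒≤sum (combine v) (λ eq → proj₂ (Fin.combine-injective v _ v _ eq)) _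
        λ j → 𝟙-yes (stubOwner (combine v j) Fin.≟ v) (cong proj₁ (Fin.remQuot-combine v j))

      expander : ∃[ μ ] (Involutive _≡_ μ × (∀ A B → Greedy.Large stubOwner fibre (A , B) →
                   ∃[ x ] (stubOwner x ∈ A × stubOwner (μ x) ∈ B)))
      expander = Greedy.matching stubOwner fibre (360 * n)
        (≤-trans (≤-reflexive (trans (sym (*-assoc 32 360 n)) (*-comm (32 * 360) n))) (*-monoʳ-≤ n enough)) (360-steps n)

    module _ (μ : Fin (n * D₀) → Fin (n * D₀)) (μ-involutive : Involutive _≡_ μ)
             (joins : ∀ A B → Greedy.Large stubOwner fibre (A , B) → ∃[ x ] (stubOwner x ∈ A × stubOwner (μ x) ∈ B)) where

      private
        Piece : Set
        Piece = Fin n × Fin (2 + D₀)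

        mate : Fin n → Fin D₀ → Piece
        mate v i = let (w , j) = remQuot D₀ (μ (combine v i)) in w , suc (suc j)

        -- A stub left over by the greedy choice is a fixed point of `μ`, and its piece is zipped on
        -- this side as well.
        onTop : Piece → Piece
        onTop (v , zero)        = evenSwap v , zero
        onTop (v , suc zero)    = oddSwap v , suc zero
        onTop (v , suc (suc i)) = mate v i

        onTop-involutive : Involutive _≡_ onTop
        onTop-involutive (v , zero)        = cong (_, zero) (evenSwap-involutive v)
        onTop-involutive (v , suc zero)    = cong (_, suc zero) (oddSwap-involutive v)
        onTop-involutive (v , suc (suc i)) = cong (λ (w , j) → w , suc (suc j)) (begin
          remQuot D₀ (μ (combine (proj₁ wj) (proj₂ wj)))
            ≡⟨ cong (remQuot D₀ ∘ μ) (Fin.combine-remQuot {n} D₀ (μ (combine v i))) ⟩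
          remQuot D₀ (μ (μ (combine v i)))               ≡⟨ cong (remQuot D₀) (μ-involutive (combine v i)) ⟩
          remQuot D₀ (combine v i)                       ≡⟨ Fin.remQuot-combine v i ⟩
          v , i                                          ∎)
          where
          open ≡-Reasoning
          wj = remQuot {n} D₀ (μ (combine v i))

        glue : Bool → Bool → Piece → Piece
        glue horizontal low  (v , i) = v , oddSwap i
        glue horizontal high (v , i) = v , evenSwap i
        glue vertical   low  σ       = σ
        glue vertical   high σ       = onTop σ

        glue-involutive : ∀ a e → Involutive _≡_ (glue a e)
        glue-involutive horizontal low  (v , i) = cong (v ,_) (oddSwap-involutive i)
        glue-involutive horizontal high (v , i) = cong (v ,_) (evenSwap-involutive i)
        glue-involutive vertical   low  σ       = refl
        glue-involutive vertical   high σ       = onTop-involutive σ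

        chained : ∀ σ τ → proj₁ σ ≡ proj₁ τ → EqClosure (λ σ τ → ∃[ e ] τ ≡ glue horizontal e σ) σ τ
        chained (v , i) (.v , j) refl = Eq.gmap (v ,_)
          (λ { (inj₁ eq) → high , cong (v ,_) eq ; (inj₂ eq) → low , cong (v ,_) eq }) (path-connected i j)

        Glued : Piece → Piece → Set
        Glued = EqClosure (λ σ τ → ∃₂ λ a e → τ ≡ glue a e σ)

        along : ∀ {v} i j → Glued (v , i) (v , j)
        along i j = Eq.map (λ (e , eq) → horizontal , e , eq) (chained (_ , i) (_ , j) refl)

        -- The expander joins only large sets of blocks, so it may leave single blocks isolated;
        -- connectedness rests on the pieces numbered 0 and 1, which form a path through all blocks.
        linked : ∀ σ τ → Glued σ τ
        linked (v , i) (w , j) = Eq.transitive _ (along i zero) (Eq.transitive _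
          (Eq.gfold (Eq.isEquivalence _) (_, zero) (λ
            { (inj₁ refl) → Eq.return (vertical , high , refl)
            ; (inj₂ refl) → Eq.transitive _ (along zero (suc zero))
                (Eq.transitive _ (Eq.return (vertical , high , refl)) (along (suc zero) zero)) }) (path-connected v w))
          (along zero j))

        expanding : ∀ {A B : Fin n → Set} (A? : ∀ v → Dec (A v)) (B? : ∀ v → Dec (B v)) →
                    (∀ v → A v → ¬ B v) → n ≤ 8 * # A? → n ≤ 8 * # B? →
                    ∃[ σ ] (A (proj₁ σ) × B (proj₁ (glue vertical high σ)))
        expanding {A} {B} A? B? disjoint hA hB =
          let (x , x∈A , μx∈B) = joins ⟦ A? ⟧ ⟦ B? ⟧
                ( (λ v v∈A v∈B → disjoint v (∈⟦⟧⁻ A? v∈A) (∈⟦⟧⁻ B? v∈B))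
                , ≤-trans hA (*-monoʳ-≤ 8 (large A?)) , ≤-trans hB (*-monoʳ-≤ 8 (large B?)))
              (v , i) = remQuot {n} D₀ x
          in (v , suc (suc i)) , ∈⟦⟧⁻ A? x∈A ,
             subst (λ y → B (stubOwner (μ y))) (sym (Fin.combine-remQuot {n} D₀ x)) (∈⟦⟧⁻ B? μx∈B)
          where
          large : ∀ {P : Fin n → Set} (P? : ∀ v → Dec (P v)) → # P? ≤ ∣ ⟦ P? ⟧ ∣
          large P? = ≤-trans (sum-mono-≤ (λ v → 𝟙-mono (P? v) (v ∈? ⟦ P? ⟧) (∈⟦⟧⁺ P?))) (≤-reflexive (sym (∣p∣≡# ⟦ P? ⟧)))

      gluedAlong : Scaffold n
      gluedAlong = record
        { Σ₀ = Piece ; glue = glue ; glue-involutive = glue-involutive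
        ; finΣ = finite-Fin n ×-finite finite-Fin (2 + D₀) ; σ₀ = Fin.fromℕ< (>-nonZero⁻¹ n) , zero
        ; zipped = λ _ → refl ; linked = linked
        ; owner = proj₁ ; pieceOf = _, zero ; owner-pieceOf = λ _ → refl
        ; owner-glue = λ { low _ → refl ; high _ → refl }
        ; chained = chained ; expanding = expanding
        }

    expanderScaffold : ∃[ S ] ∥ Scaffold.finΣ {n} S ∥ ≡ n * (2 + D₀)
    expanderScaffold = let (μ , inv , joins) = expander in gluedAlong μ inv joins , refl

open Scaffolds

-- Comparison of naturals with rational multiples

module Rationals where

  module _ (M : ℕ) where

    reciprocal : ℚ
    reciprocal = nat 1 ℚ./ suc M

    private
      toᵘ : ∀ i n → ℚ.toℚᵘ (i ℚ./ suc n) ℚᵘ.≃ mkℚᵘ i n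
      toᵘ i n = ℚ.toℚᵘ-fromℚᵘ (mkℚᵘ i n)

    reciprocal-positive : 0ℚ ℚ.< reciprocal
    reciprocal-positive = ℚ.toℚᵘ-cancel-< (ℚᵘ.<-respʳ-≃ (ℚᵘ.≃-sym (toᵘ (nat 1) M)) (*<* (ℤ.+<+ (s≤s z≤n))))

    reciprocal-* : ∀ x y → x ≤ suc M * y → reciprocal ℚ.* ℕ→ℚ x ℚ.≤ ℕ→ℚ y
    reciprocal-* x y le = ℚ.toℚᵘ-cancel-≤ (begin
      ℚ.toℚᵘ (reciprocal ℚ.* ℕ→ℚ x)                ≃⟨ ℚ.toℚᵘ-homo-* reciprocal (ℕ→ℚ x) ⟩
      ℚ.toℚᵘ reciprocal ℚᵘ.* ℚ.toℚᵘ (ℕ→ℚ x)        ≃⟨ ℚᵘ.*-cong (toᵘ (nat 1) M) (toᵘ (nat x) 0) ⟩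
      mkℚᵘ (nat 1) M ℚᵘ.* mkℚᵘ (nat x) 0               ≤⟨ *≤* (subst₂ ℤ._≤_ (eqˡ x) (eqʳ y) (ℤ.+≤+ le)) ⟩
      mkℚᵘ (nat y) 0                                 ≃⟨ ℚᵘ.≃-sym (toᵘ (nat y) 0) ⟩
      ℚ.toℚᵘ (ℕ→ℚ y)                               ∎)
      where
      open ℚᵘ.≤-Reasoning
      eqˡ : ∀ x → nat x ≡ (nat 1 ℤ.* nat x) ℤ.* nat 1
      eqˡ x = sym (trans (ℤ.*-identityʳ (nat 1 ℤ.* nat x)) (ℤ.*-identityˡ (nat x)))
      eqʳ : ∀ y → nat (suc M * y) ≡ nat y ℤ.* nat (suc M * 1)
      eqʳ y = trans (cong nat (trans (*-comm (suc M) y) (cong (y *_) (sym (*-identityʳ (suc M)))))) (ℤ.pos-* y (suc M * 1))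

    ℕ→ℚ-* : ∀ x y → ℕ→ℚ (x * y) ≡ ℕ→ℚ x ℚ.* ℕ→ℚ y
    ℕ→ℚ-* x y = ℚ.toℚᵘ-injective (begin
      ℚ.toℚᵘ (ℕ→ℚ (x * y))                 ≈⟨ toᵘ (nat (x * y)) 0 ⟩
      mkℚᵘ (nat (x * y)) 0                   ≡⟨ cong (λ z → mkℚᵘ z 0) (ℤ.pos-* x y) ⟩
      mkℚᵘ (nat x) 0 ℚᵘ.* mkℚᵘ (nat y) 0
        ≈⟨ ℚᵘ.*-cong (ℚᵘ.≃-sym (toᵘ (nat x) 0)) (ℚᵘ.≃-sym (toᵘ (nat y) 0)) ⟩
      ℚ.toℚᵘ (ℕ→ℚ x) ℚᵘ.* ℚ.toℚᵘ (ℕ→ℚ y)   ≈⟨ ℚᵘ.≃-sym (ℚ.toℚᵘ-homo-* (ℕ→ℚ x) (ℕ→ℚ y)) ⟩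
      ℚ.toℚᵘ (ℕ→ℚ x ℚ.* ℕ→ℚ y)             ∎)
      where open import Relation.Binary.Reasoning.Setoid ℚᵘ.≃-setoid

    -- One factor `reciprocal` already brings `x` below `y * y`, and the other is at most 1. So the
    -- same constant serves for the treewidth and for the layered treewidth.
    reciprocal-√ : ∀ x y → x ≤ suc M * (y * y) → reciprocal √ x ≤ y
    reciprocal-√ x y le = begin
      reciprocal ℚ.* reciprocal ℚ.* ℕ→ℚ x    ≡⟨ ℚ.*-assoc reciprocal reciprocal (ℕ→ℚ x) ⟩
      reciprocal ℚ.* (reciprocal ℚ.* ℕ→ℚ x)
        ≤⟨ ℚ.*-monoˡ-≤-nonNeg reciprocal {{ℚ.nonNegative (ℚ.<⇒≤ reciprocal-positive)}} (reciprocal-* x (y * y) le) ⟩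
      reciprocal ℚ.* ℕ→ℚ (y * y)             ≤⟨ reciprocal-* (y * y) (y * y) (m≤n*m (y * y) (suc M)) ⟩
      ℕ→ℚ (y * y)                            ≡⟨ ℕ→ℚ-* y y ⟩
      ℕ→ℚ y ℚ.* ℕ→ℚ y                        ∎
      where open ℚ.≤-Reasoning

open Rationals

-- The estimates and the choice of the constants

finite-nonZero : {A : Set} (fin : Finite A) → A → NonZero ∥ fin ∥
finite-nonZero fin a = Fin.nonZeroIndex (Inverse.to (Finite.enumeration fin) a)

-- The haven of order 2 * unit survives a cut of unit vertices together with a slice
-- of unit vertices, and p * unit bounds the number n of all vertices.
module Estimates (a D M : ℕ) (128≤a : 128 ≤ a) .{{_ : NonZero D}} (M-large : 128 * (a * a) * (D * D) ≤ suc M)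
                 {g d nH : ℕ} .{{_ : NonZero nH}} (S : Scaffold nH)
                 (K≤ : ∥ Scaffold.finΣ S ∥ ≤ D * nH) (2K≤2+g : 2 * ∥ Scaffold.finΣ S ∥ ≤ 2 + g)
                 (1+g≤ : g + 1 ≤ 4 * D * nH) (r′ : ℕ) (4r≤d : 4 * suc r′ ≤ d) (d≤8r : d ≤ 8 * suc r′)
                 (m S₁ : ℕ) (s≡aS₁ : suc m ≡ a * S₁) where
  open Scaffold S
  open Pieces m glue glue-involutive using (module Strips)
  open Strips r′ finΣ σ₀ zipped linked using (r; n; graph; isMapGraph)

  private
    instance
      a≢0 : NonZero a
      a≢0 = >-nonZero (≤-trans (s≤s z≤n) 128≤a)

      K≢0 : NonZero ∥ finΣ ∥
      K≢0 = finite-nonZero finΣ σ₀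

      S₁≢0 : NonZero S₁
      S₁≢0 = m*n≢0⇒n≢0 a {{subst NonZero s≡aS₁ _}}

    unit k : ℕ
    unit = S₁ * r * nH
    k    = 2 * unit

    n≡ : n ≡ 4 * ∥ finΣ ∥ * (suc m * suc m) * r
    n≡ = lemma ∥ finΣ ∥ (suc m) r
      where
      lemma : ∀ K s r → 2 * ((K * (s * 2)) * s) * r ≡ 4 * K * (s * s) * r
      lemma = solve-∀

    n≤ : n ≤ 4 * D * (a * a) * S₁ * unit
    n≤ = begin
      n                                            ≡⟨ n≡ ⟩
      4 * ∥ finΣ ∥ * (suc m * suc m) * r           ≡⟨ cong (λ s → 4 * ∥ finΣ ∥ * (s * s) * r) s≡aS₁ ⟩
      4 * ∥ finΣ ∥ * (a * S₁ * (a * S₁)) * r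
        ≤⟨ *-monoˡ-≤ r (*-monoˡ-≤ (a * S₁ * (a * S₁)) (*-monoʳ-≤ 4 K≤)) ⟩
      4 * (D * nH) * (a * S₁ * (a * S₁)) * r       ≡⟨ lemma D nH a S₁ r ⟩
      4 * D * (a * a) * S₁ * (S₁ * r * nH)         ∎
      where
      open ≤-Reasoning
      lemma : ∀ D h a S r → 4 * (D * h) * (a * S * (a * S)) * r ≡ 4 * D * (a * a) * S * (S * r * h)
      lemma = solve-∀

    gd≤ : (g + 1) * d ≤ 32 * D * (r * nH)
    gd≤ = ≤-trans (*-mono-≤ 1+g≤ d≤8r) (≤-reflexive (lemma D nH r))
      where
      lemma : ∀ D h r → 4 * D * h * (8 * r) ≡ 32 * D * (r * h)
      lemma = solve-∀

    64k≤ : 64 * k ≤ suc m * r * nH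
    64k≤ = begin
      64 * (2 * (S₁ * r * nH)) ≡⟨ lemma S₁ r nH ⟩
      128 * S₁ * r * nH        ≤⟨ *-monoˡ-≤ nH (*-monoˡ-≤ r (*-monoˡ-≤ S₁ 128≤a)) ⟩
      a * S₁ * r * nH          ≡⟨ cong (λ s → s * r * nH) (sym s≡aS₁) ⟩
      suc m * r * nH           ∎
      where
      open ≤-Reasoning
      lemma : ∀ S r h → 64 * (2 * (S * r * h)) ≡ 128 * S * r * h
      lemma = solve-∀

    H : HavenOfOrder k graph
    H = Network.haven m glue glue-involutive r′ finΣ σ₀ zipped linked owner pieceOf
          owner-pieceOf owner-glue chained expanding 64k≤

  order≥ : S₁ ≤ n
  order≥ = begin
    S₁                                   ≤⟨ m≤n*m S₁ a ⟩
    a * S₁                               ≡⟨ sym s≡aS₁ ⟩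
    suc m                                ≤⟨ m≤m*n (suc m) (suc m) ⟩
    suc m * suc m                        ≤⟨ m≤n*m (suc m * suc m) (4 * ∥ finΣ ∥) {{m*n≢0 4 ∥ finΣ ∥}} ⟩
    4 * ∥ finΣ ∥ * (suc m * suc m)       ≤⟨ m≤m*n _ r ⟩
    4 * ∥ finΣ ∥ * (suc m * suc m) * r   ≡⟨ sym n≡ ⟩
    n                                    ∎
    where open ≤-Reasoning

  mapGraph : IsMapGraph g d graph
  mapGraph = isMapGraph 2K≤2+g 4r≤d

  -- The factor `S₁` of the bound on `n` and the factor `r * nH` of the bound on `(g + 1) * d` make
  -- up a second `unit`, so that the product is a constant times the square of `unit`.
  wide : treewidth graph ≥ reciprocal M √ ((g + 1) * d * n)
  wide 𝒟 = reciprocal-√ M _ (width 𝒟) (begin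
    (g + 1) * d * n                                            ≤⟨ *-mono-≤ gd≤ n≤ ⟩
    32 * D * (r * nH) * (4 * D * (a * a) * S₁ * unit)          ≡⟨ lemma D r nH a S₁ ⟩
    128 * (a * a) * (D * D) * (unit * unit)                    ≤⟨ *-mono-≤ M-large (*-mono-≤ unit≤ unit≤) ⟩
    suc M * (width 𝒟 * width 𝒟)                                ∎)
    where
    open ≤-Reasoning
    lemma : ∀ D r h a S → 32 * D * (r * h) * (4 * D * (a * a) * S * (S * r * h)) ≡ 128 * (a * a) * (D * D) * (S * r * h * (S * r * h))
    lemma = solve-∀
    unit≤ : unit ≤ width 𝒟
    unit≤ = ≤-trans (m≤n*m unit 2) (≤-pred (≤-trans (haven⇒largeBag H 𝒟) (m≤n+m∸n _ 1)))

  layeredWide : layeredTreewidth graph ≥ (reciprocal M ℚ.* ℕ→ℚ ((g + 1) * d))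
  layeredWide 𝒟 L = reciprocal-* M _ ℓ (begin
    (g + 1) * d                           ≤⟨ gd≤ ⟩
    32 * D * (r * nH)                     ≤⟨ *-monoʳ-≤ (32 * D) (<⇒≤ (≰⇒> thick)) ⟩
    32 * D * (4 * D * (a * a) * ℓ)        ≡⟨ lemma D a ℓ ⟩
    128 * (a * a) * (D * D) * ℓ           ≤⟨ *-monoˡ-≤ ℓ M-large ⟩
    suc M * ℓ                             ∎)
    where
    open ≤-Reasoning
    ℓ = widthAlong 𝒟 L
    p = 4 * D * (a * a) * S₁
    lemma : ∀ D a ℓ → 32 * D * (4 * D * (a * a) * ℓ) ≡ 128 * (a * a) * (D * D) * ℓ
    lemma = solve-∀
    -- As `S₁` divides the period `p`, the assumption is just what makes `p * ℓ` at most
    -- `unit = S₁ * r * nH`; cut and slice together then stay within the order of the haven.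
    thick : ¬ (4 * D * (a * a) * ℓ ≤ r * nH)
    thick thin = <-irrefl refl (haven⇒layeredWidth H 𝒟 L p {{p≢0}} unit n≤ ℓ (begin
      unit + p * ℓ                             ≡⟨ cong (unit +_) (regroup (4 * D * (a * a)) S₁ ℓ) ⟩
      unit + S₁ * (4 * D * (a * a) * ℓ)        ≤⟨ +-monoʳ-≤ unit (*-monoʳ-≤ S₁ thin) ⟩
      unit + S₁ * (r * nH)                     ≡⟨ double S₁ r nH ⟩
      2 * unit                                 ∎))
      where
      p≢0 : NonZero p
      p≢0 = m*n≢0 (4 * D * (a * a)) S₁ {{m*n≢0 (4 * D) (a * a) {{m*n≢0 4 D}} {{m*n≢0 a a}}}}
      regroup : ∀ x S ℓ → x * S * ℓ ≡ S * (x * ℓ)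
      regroup = solve-∀
      double : ∀ S r h → S * r * h + S * (r * h) ≡ 2 * (S * r * h)
      double = solve-∀

Conclusion : ℚ → ℕ → ℕ → ℕ → Set₁
Conclusion c g d N = ∃[ n ] (N ≤ n × ∃[ G ] (IsMapGraph g d {n} G
  × treewidth G ≥ c √ ((g + 1) * d * n) × layeredTreewidth G ≥ (c ℚ.* ℕ→ℚ ((g + 1) * d))))

quarter : ∀ d → 8 ≤ d → ∃[ r′ ] (4 * suc r′ ≤ d × d ≤ 8 * suc r′)
quarter d 8≤d = pred (d / 4) , subst (λ r → 4 * r ≤ d × d ≤ 8 * r) (sym (suc-pred (d / 4) {{q≢0}}))
  (≤-trans (≤-reflexive (*-comm 4 (d / 4))) (m/n*n≤m d 4) ,
   (begin
     d                       ≡⟨ m≡m%n+[m/n]*n d 4 ⟩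
     d % 4 + d / 4 * 4       ≤⟨ +-monoˡ-≤ (d / 4 * 4) (≤-trans (<⇒≤ (m%n<n d 4)) (m≤n*m 4 (d / 4) {{q≢0}})) ⟩
     d / 4 * 4 + d / 4 * 4   ≡⟨ eight (d / 4) ⟩
     8 * (d / 4)             ∎))
  where
  open ≤-Reasoning
  q≢0 : NonZero (d / 4)
  q≢0 = >-nonZero (≤-trans (s≤s z≤n) (/-monoˡ-≤ 4 8≤d))
  eight : ∀ q → q * 4 + q * 4 ≡ 8 * q
  eight = solve-∀

module _ (a D₀ : ℕ) (128≤a : 128 ≤ a) (enough : 32 * 360 ≤ D₀) where

  private
    D : ℕ
    D = 2 + D₀

    M : ℕ
    M = 128 * (a * a) * (D * D)

    c : ℚ
    c = reciprocal M

    fromScaffold : ∀ {g d N nH} .{{_ : NonZero nH}} (S : Scaffold nH) → ∥ Scaffold.finΣ S ∥ ≤ D * nH →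
                   2 * ∥ Scaffold.finΣ S ∥ ≤ 2 + g → g + 1 ≤ 4 * D * nH → 8 ≤ d → Conclusion c g d N
    fromScaffold {d = d} {N} S K≤ 2K≤ 1+g≤ 8≤d =
      let (r′ , 4r≤d , d≤8r) = quarter d 8≤d
          -- The side of the grids grows with `N`, which makes the order of the graph large, and is
          -- a multiple of `a` so that `unit` is exactly the a-th part of s r nH.
          m = pred (a * suc N)
          s≡aS₁ = suc-pred (a * suc N) {{m*n≢0 a (suc N) {{>-nonZero (≤-trans (s≤s z≤n) 128≤a)}}}}
          open Estimates a D M 128≤a (n≤1+n M) S K≤ 2K≤ 1+g≤ r′ 4r≤d d≤8r m (suc N) s≡aS₁
      in _ , ≤-trans (n≤1+n N) order≥ , _ , mapGraph , wide , layeredWide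

  mapGraphs : ∃[ c ] (0ℚ ℚ.< c × (∀ g d → 8 ≤ d → ∀ N → Conclusion c g d N))
  mapGraphs = c , reciprocal-positive M , λ g d 8≤d N → choose g d 8≤d N ((2 + g) / (2 * D)) refl
    where
    choose : ∀ g d → 8 ≤ d → ∀ N q → (2 + g) / (2 * D) ≡ q → Conclusion c g d N
    -- The genus does not suffice for a block of `D` pieces. A single sphere serves instead, as
    -- `g + 1 < 2 * D` is absorbed by the constant.
    choose g d 8≤d N zero eq = fromScaffold singlePiece (s≤s z≤n) (m≤m+n 2 g) bound 8≤d
      where
      open ≤-Reasoning
      bound : g + 1 ≤ 4 * D * 1
      bound = begin
        g + 1           ≤⟨ ≤-trans (≤-reflexive (+-comm g 1)) (n≤1+n (1 + g)) ⟩
        2 + g           ≤⟨ <⇒≤ (m/n≡0⇒m<n eq) ⟩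
        2 * D           ≤⟨ *-monoˡ-≤ D (m≤m+n 2 2) ⟩
        4 * D           ≡⟨ sym (*-identityʳ (4 * D)) ⟩
        4 * D * 1       ∎
    choose g d 8≤d N q@(suc _) eq =
      let (S , K≡) = expanderScaffold q D₀ enough
      in fromScaffold S (≤-reflexive (trans K≡ (*-comm q D)))
           (≤-trans (≤-reflexive (trans (cong (2 *_) K≡) (regroup q D))) (≤-trans (≤-reflexive (cong (_* (2 * D)) (sym eq))) (m/n*n≤m (2 + g) (2 * D))))
           bound 8≤d
      where
      open ≤-Reasoning
      regroup : ∀ q D → 2 * (q * D) ≡ q * (2 * D)
      regroup = solve-∀
      double : ∀ q D → q * (2 * D) + q * (2 * D) ≡ 4 * D * q
      double = solve-∀
      bound : g + 1 ≤ 4 * D * q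
      bound = begin
        g + 1
          ≤⟨ ≤-trans (≤-reflexive (+-comm g 1)) (n≤1+n (1 + g)) ⟩
        2 + g                                               ≡⟨ m≡m%n+[m/n]*n (2 + g) (2 * D) ⟩
        (2 + g) % (2 * D) + (2 + g) / (2 * D) * (2 * D)
          ≤⟨ +-mono-≤ (≤-trans (<⇒≤ (m%n<n (2 + g) (2 * D))) (m≤n*m (2 * D) q)) (≤-reflexive (cong (_* (2 * D)) eq)) ⟩
        q * (2 * D) + q * (2 * D)                           ≡⟨ double q D ⟩
        4 * D * q                                           ∎

theorem28 : ∃[ c ] (0ℚ ℚ.< c × (∀ (g d : ℕ) → 8 ≤ d → ∀ (N : ℕ) →
    ∃[ n ] (N ≤ n × ∃[ G ] (IsMapGraph g d {n} G
    × treewidth G ≥ c √ ((g + 1) * d * n)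
    × layeredTreewidth G ≥ (c ℚ.* ℕ→ℚ ((g + 1) * d))))))
-- 128 is 64 · 2: the haven survives the loss of s r nH / 64 nations, and this has to cover two
-- units of s r nH / 128. In 32 · 360, each of the 360 n greedy steps uses two stubs, and at most a
-- sixteenth of the n D₀ stubs may be used.
theorem28 = mapGraphs 128 (32 * 360) ≤-refl ≤-refl
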